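{- For every $k,p,l,c\ge 1$ there is an integer $l'$ such that the following holds. Let $G$ be a digraph of bramble number at least $l'$. Then $G$ contains a cylindrical grid of order $k$ as a butterfly minor, or a $(p',l\cdot p')$-web with avoidance $c$, for some $p'\ge p$, such that the top and the bottom of the web are subsets of a well linked set $A\subseteq V(G)$.
   Context: All paths are directed. A linkage is a set of pairwise vertex-disjoint paths; a $Z_1$-$Z_2$ linkage is a linkage each of whose paths goes from a vertex of $Z_1$ to a vertex of $Z_2$; its order is its number of paths. A set $A\subseteq V(G)$ is well linked if for all $X,Y\subseteq A$ with $|X|=|Y|=r$ there is an $X$-$Y$ linkage of order $r$. Minimality: for $C,D\subseteq V(G)$ and a subgraph $H$ of $G$, a $C$-$D$ linkage $\mathcal{L}$ of order $k$ is $H$-minimal if for every edge $e\in \bigcup_{P\in\mathcal L}E(P)\setminus E(H)$ there is no $C$-$D$ linkage of order $k$ in $(\bigcup\mathcal{L}\cup H)-e$ (a linkage used as $H$ means the subgraph formed by its paths). Webs: for integers $p,q,d\ge0$, a $(p,q)$-web with avoidance $d$ consists of linkages $\mathcal{P}=\{P_1,\dots,P_p\}$ and $\mathcal{Q}=\{Q_1,\dots,Q_q\}$ such that $\mathcal{P}$ is an $A$-$B$ linkage for two distinct vertex sets $A,B$, $\mathcal{Q}$ is a $C$-$D$ linkage for two distinct vertex sets $C,D$, each $Q_i$ intersects all but at most $\frac1d p$ paths of $\mathcal{P}$ (for $d=0$: intersects all paths of $\mathcal P$), and $\mathcal{P}$ is $\mathcal{Q}$-minimal. Its top is $C\cap V(\mathcal{Q})$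 and its bottom is $D\cap V(\mathcal Q)$. Brambles: a bramble is a set of strongly connected subgraphs any two of which intersect or are joined by edges in both directions; its order is the minimum size of a vertex set meeting all its elements; the bramble number of $G$ is the maximum order of a bramble in $G$. Butterfly minors and cylindrical grids: an edge $(u,v)$ is butterfly-contractible if it is the only out-edge of $u$ or the only in-edge of $v$; contracting merges $u,v$; a butterfly minor is obtained from a subgraph by such contractions. A cylindrical grid of order $k$ consists of $k$ disjoint directed cycles $C_1,\dots,C_k$ and $2k$ disjoint paths $P_1,\dots,P_{2k}$, each $P_i$ meeting each $C_j$ in exactly one vertex, the $P_i$ appearing in order $P_1,\dots,P_{2k}$ on each $C_j$, and the cycles appearing on $P_i$ in order $C_1,\dots,C_k$ for odd $i$ and $C_k,\dots,C_1$ for even $i$. -}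

module Defs where

open import Data.Nat as ℕ using (ℕ; zero; suc; _≤_; _<_; _*_)
open import Data.Nat.Properties using (_<?_)
open import Data.Bool using (Bool; true; false; T; if_then_else_)
open import Data.Fin as Fin using (Fin; toℕ; fromℕ<; inject₁; _≟_)
open import Data.Fin.Subset using (Subset; ∣_∣; _⊆_) renaming (_∈_ to _∈ₛ_)
open import Data.List using (List; []; _∷_; length; filter)
open import Data.List.Membership.Propositional using (_∈_)
import Data.List.Membership.DecPropositional as DecMem
open import Data.List.Relation.Unary.All using (All)
open import Data.List.Relation.Unary.Any as Any using (Any)
open import Data.List.Relation.Unary.AllPairs using (AllPairs)
open import Data.List.Relation.Unary.Unique.Propositional using (Unique)
open import Data.List.Relation.Unary.Linked using (Linked)
open import Data.Product using (Σ; ∃; ∃-syntax; _×_; _,_; proj₁; proj₂)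
open import Data.Sum using (_⊎_)
open import Data.Empty using (⊥)
open import Relation.Nullary using (¬_; Dec; yes; no; ¬?)
open import Relation.Binary.PropositionalEquality using (_≡_; _≢_)
open import Function.Bundles using (_↔_; Inverse)
open import Function.Definitions using (Injective; Surjective)

record Digraph : Set where
  field
    n   : ℕ
    adj : Fin n → Fin n → Bool

module _ (G : Digraph) where
  open Digraph G

  V : Set
  V = Fin n

  Edge : V → V → Set
  Edge u v = T (adj u v)

  pairs : List V → List (V × V)
  pairs []             = []
  pairs (x ∷ [])       = []
  pairs (x ∷ y ∷ xs)   = (x , y) ∷ pairs (y ∷ xs)

  lastOf : V → List V → V
  lastOf x []       = x
  lastOf x (y ∷ ys) = lastOf y ys

  record Path : Set where
    field
      first  : V
      rest   : List V
      unique : Unique (first ∷ rest)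
      linked : Linked Edge (first ∷ rest)

  verts : Path → List V
  verts P = Path.first P ∷ Path.rest P

  start : Path → V
  start = Path.first

  end : Path → V
  end P = lastOf (Path.first P) (Path.rest P)

  edgesOf : Path → List (V × V)
  edgesOf P = pairs (verts P)

  record Subgraph : Set₁ where
    field
      SV : V → Set
      SE : V → V → Set

  VDisjoint : Path → Path → Set
  VDisjoint P Q = ∀ x → x ∈ verts P → x ∈ verts Q → ⊥

  IsLinkage : List Path → Set
  IsLinkage L = AllPairs VDisjoint L

  IsLinkageOf : Subset n → Subset n → ℕ → List Path → Set
  IsLinkageOf Z₁ Z₂ k L =
    IsLinkage L × length L ≡ k ×
    All (λ P → start P ∈ₛ Z₁ × end P ∈ₛ Z₂) L

  PathIn : Subgraph → Path → Set
  PathIn H P = All (Subgraph.SV H) (verts P) ×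
               All (λ e → Subgraph.SE H (proj₁ e) (proj₂ e)) (edgesOf P)

  LinkageIn : Subgraph → List Path → Set
  LinkageIn H L = All (PathIn H) L

  ⟦_⟧ : List Path → Subgraph
  ⟦ L ⟧ = record
    { SV = λ x → Any (λ P → x ∈ verts P) L
    ; SE = λ u v → Any (λ P → (u , v) ∈ edgesOf P) L }

  _∪_ : Subgraph → Subgraph → Subgraph
  H₁ ∪ H₂ = record
    { SV = λ x → Subgraph.SV H₁ x ⊎ Subgraph.SV H₂ x
    ; SE = λ u v → Subgraph.SE H₁ u v ⊎ Subgraph.SE H₂ u v }

  _─_ : Subgraph → V × V → Subgraph
  H ─ (a , b) = record
    { SV = Subgraph.SV H
    ; SE = λ u v → Subgraph.SE H u v × ¬ (u ≡ a × v ≡ b) }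

  WellLinked : Subset n → Set
  WellLinked A = ∀ (X Y : Subset n) → X ⊆ A → Y ⊆ A → ∣ X ∣ ≡ ∣ Y ∣ →
    ∃[ L ] IsLinkageOf X Y ∣ X ∣ L

  Minimal : Subset n → Subset n → Subgraph → List Path → Set
  Minimal C D H L = ∀ u v → Any (λ P → (u , v) ∈ edgesOf P) L →
    ¬ Subgraph.SE H u v →
    ¬ (∃[ L' ] (IsLinkageOf C D (length L) L' ×
                LinkageIn ((⟦ L ⟧ ∪ H) ─ (u , v)) L'))

  Meets : Path → Path → Set
  Meets P Q = Any (λ x → x ∈ verts Q) (verts P)

  meets? : ∀ P Q → Dec (Meets P Q)
  meets? P Q = Any.any? (λ x → DecMem._∈?_ (_≟_ {n}) x (verts Q)) (verts P)

  missed : List Path → Path → ℕ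
  missed 𝒫 Q = length (filter (λ P → ¬? (meets? P Q)) 𝒫)

  -- "Q meets all but at most p/d paths of 𝒫" (all of them if d = 0)
  AvoidOK : ℕ → ℕ → ℕ → Set
  AvoidOK d p m = (d ≡ 0 → m ≡ 0) × (d * m ≤ p)

  record Web (p q d : ℕ) : Set₁ where
    field
      A B C D : Subset n
      A≢B     : A ≢ B
      C≢D     : C ≢ D
      𝒫 𝒬     : List Path
      𝒫-link  : IsLinkageOf A B p 𝒫
      𝒬-link  : IsLinkageOf C D q 𝒬
      avoid   : All (λ Q → AvoidOK d p (missed 𝒫 Q)) 𝒬
      minimal : Minimal A B ⟦ 𝒬 ⟧ 𝒫

  top : ∀ {p q d} → Web p q d → V → Set
  top W x = x ∈ₛ Web.C W × Any (λ Q → x ∈ verts Q) (Web.𝒬 W)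

  bottom : ∀ {p q d} → Web p q d → V → Set
  bottom W x = x ∈ₛ Web.D W × Any (λ Q → x ∈ verts Q) (Web.𝒬 W)

  -- brambles (elements given by their vertex sets; each induces a
  -- nonempty strongly connected subgraph)
  Induced : Subset n → Subgraph
  Induced S = record { SV = λ x → x ∈ₛ S ; SE = λ u v → u ∈ₛ S × v ∈ₛ S }

  StronglyConnected : Subset n → Set
  StronglyConnected S = ∀ u v → u ∈ₛ S → v ∈ₛ S →
    ∃[ P ] (start P ≡ u × end P ≡ v × PathIn (Induced S) P)

  EdgeBetween : Subset n → Subset n → Set
  EdgeBetween S T' = ∃[ u ] ∃[ v ] (u ∈ₛ S × v ∈ₛ T' × Edge u v)

  Touch : Subset n → Subset n → Set
  Touch S T' = (∃[ x ] (x ∈ₛ S × x ∈ₛ T'))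
             ⊎ (EdgeBetween S T' × EdgeBetween T' S)

  record Bramble : Set where
    field
      elems   : List (Subset n)
      nonempt : All (λ S → ∃[ x ] x ∈ₛ S) elems
      strong  : All StronglyConnected elems
      touch   : ∀ S T' → S ∈ elems → T' ∈ elems → Touch S T'

  Hits : Subset n → Bramble → Set
  Hits X β = All (λ S → ∃[ x ] (x ∈ₛ X × x ∈ₛ S)) (Bramble.elems β)

  OrderAtLeast : Bramble → ℕ → Set
  OrderAtLeast β m = ∀ X → Hits X β → m ≤ ∣ X ∣

  BrambleNumberAtLeast : ℕ → Set
  BrambleNumberAtLeast m = ∃[ β ] OrderAtLeast β m

-- Directed multigraphs (needed since butterfly contraction can create
-- parallel edges and loops), butterfly minors

record MDigraph : Set₁ where
  field
    MV MV-E : Set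
    tl hd   : MV-E → MV

open MDigraph

toM : Digraph → MDigraph
toM G = record
  { MV = Fin (Digraph.n G)
  ; MV-E = Σ (Fin (Digraph.n G) × Fin (Digraph.n G)) (λ e → Edge G (proj₁ e) (proj₂ e))
  ; tl = λ e → proj₁ (proj₁ e)
  ; hd = λ e → proj₂ (proj₁ e) }

record _≅_ (G H : MDigraph) : Set where
  field
    fV : MV G ↔ MV H
    fE : MV-E G ↔ MV-E H
    tl-comm : ∀ e → tl H (Inverse.to fE e) ≡ Inverse.to fV (tl G e)
    hd-comm : ∀ e → hd H (Inverse.to fE e) ≡ Inverse.to fV (hd G e)

record _⊑_ (H G : MDigraph) : Set where
  field
    fV : MV H → MV G
    fE : MV-E H → MV-E G
    fV-inj : Injective _≡_ _≡_ fV
    fE-inj : Injective _≡_ _≡_ fE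
    tl-comm : ∀ e → tl G (fE e) ≡ fV (tl H e)
    hd-comm : ∀ e → hd G (fE e) ≡ fV (hd H e)

ButterflyContractible : (G : MDigraph) → MV-E G → Set
ButterflyContractible G e =
  (∀ e' → tl G e' ≡ tl G e → e' ≡ e) ⊎ (∀ e' → hd G e' ≡ hd G e → e' ≡ e)

record ContractsTo (G : MDigraph) (e : MV-E G) (G' : MDigraph) : Set where
  field
    nonloop   : tl G e ≢ hd G e
    butterfly : ButterflyContractible G e
    fV        : MV G → MV G'
    fV-surj   : Surjective _≡_ _≡_ fV
    fV-ident  : ∀ x y → (fV x ≡ fV y → x ≡ y ⊎ (x ≡ tl G e × y ≡ hd G e)
                                           ⊎ (x ≡ hd G e × y ≡ tl G e))
    merges    : fV (tl G e) ≡ fV (hd G e)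
    fE        : Σ (MV-E G) (λ e' → e' ≢ e) ↔ MV-E G'
    tl-comm   : ∀ e' → tl G' (Inverse.to fE e') ≡ fV (tl G (proj₁ e'))
    hd-comm   : ∀ e' → hd G' (Inverse.to fE e') ≡ fV (hd G (proj₁ e'))

data Contr* : MDigraph → MDigraph → Set₁ where
  done : ∀ {G H} → G ≅ H → Contr* G H
  step : ∀ {G G' H} (e : MV-E G) → ContractsTo G e G' → Contr* G' H → Contr* G H

ButterflyMinor : MDigraph → MDigraph → Set₁
ButterflyMinor H G = ∃[ G' ] (G' ⊑ G × Contr* G' H)

-- cylindrical grid of order k: vertex (j , i) is the intersection of
-- cycle C_(j+1) and path P_(i+1)

next : ∀ {m} → Fin (suc m) → Fin (suc m)
next {m} i with suc (toℕ i) <? suc m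
... | yes p = fromℕ< p
... | no _  = Fin.zero

isEven : ℕ → Bool
isEven zero          = true
isEven (suc zero)    = false
isEven (suc (suc m)) = isEven m

data GridEdge (k' : ℕ) : Set where
  cyc  : Fin (suc k') → Fin (2 * suc k') → GridEdge k'
  rung : Fin k' → Fin (2 * suc k') → GridEdge k'

gridTl gridHd : ∀ {k'} → GridEdge k' → Fin (suc k') × Fin (2 * suc k')
gridTl (cyc j i)  = j , i
gridTl (rung j i) = if isEven (toℕ i) then (inject₁ j , i) else (Fin.suc j , i)
gridHd (cyc j i)  = j , next i
gridHd (rung j i) = if isEven (toℕ i) then (Fin.suc j , i) else (inject₁ j , i)

CylGrid : ℕ → MDigraph
CylGrid zero = record { MV = ⊥ ; MV-E = ⊥ ; tl = λ () ; hd = λ () }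
CylGrid (suc k') = record
  { MV = Fin (suc k') × Fin (2 * suc k')
  ; MV-E = GridEdge k'
  ; tl = gridTl
  ; hd = gridHd }

-- Only the web outcome is needed.  A path through all elements of a bramble of high order is cut into cells, each of
-- large order with respect to the bramble, separated by stations; by Menger, the stations form a well linked set.
-- Fix linkages between sets of stations.  If disjoint paths with ends at stations meet almost all of a minimal linkage
-- we have a web with these paths as 𝒬; otherwise the linkage can be rerouted to avoid one of them.  Playing this with
-- subpaths D s of the path, from station to station, yields D 0, …, D (q − 1) and linkages from each D s to the next
-- that touch the D's only near their ends, in regions reserved for them.  Rerouting these linkages along one another
-- makes one path out of each linkage, all disjoint.  Joined along the D's they form disjoint tracks, each crossing
-- every D s; a linkage inside the tracks and the D's that is minimal with respect to the D's still meets every D s,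
-- so it is a web together with the D's.

module Submission where

open import Defs
open import Data.Nat as ℕ using (ℕ; zero; suc; _+_; _*_; _^_; _∸_; _≤_; _<_; z≤n; s≤s; s≤s⁻¹)
open import Data.Nat.Properties
open import Data.Nat.Solver using (module +-*-Solver)
open import Data.Bool using (T?; true; false)
open import Data.Fin using (Fin)
import Data.Fin as Fin
import Data.Fin.Properties as Finₚ
open import Data.Fin.Subset using (Subset; ⁅_⁆; ∣_∣) renaming (_∈_ to _∈ₛ_; _∪_ to _∪ₛ_; ⊥ to ⊥ₛ)
import Data.Fin.Subset.Properties as Subsetₚ
open import Data.List using (List; []; _∷_; _++_; length; map; filter; foldr; take; concat; deduplicate; upTo; allFin; cartesianProduct)
import Data.List.Properties as Listₚ
open import Data.List.Properties using (length-map; length-take; length-++)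
open import Data.List.Membership.Propositional using (_∈_; _∉_; mapWith∈; find; lose) renaming (_─_ to _∖_)
open import Data.List.Membership.Propositional.Properties
import Data.List.Membership.DecPropositional as DecMem
open import Data.List.Relation.Unary.All as All using (All; []; _∷_)
open import Data.List.Relation.Unary.Any as Any using (Any; here; there)
open import Data.List.Relation.Unary.AllPairs as AllPairs using (AllPairs; []; _∷_)
import Data.List.Relation.Unary.AllPairs.Properties as AllPairsₚ
open import Data.List.Relation.Unary.Unique.Propositional using (Unique)
import Data.List.Relation.Unary.Unique.Propositional.Properties as Uniqueₚ
open import Data.List.Relation.Unary.Unique.DecPropositional.Properties using (deduplicate-!)
open import Data.List.Relation.Unary.Linked using (Linked; []; [-]; _∷_)
open import Data.List.Relation.Binary.Subset.Propositional using (_⊆_)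
open import Data.Product using (Σ; ∃-syntax; _×_; _,_; proj₁; proj₂)
open import Data.Product.Properties using (≡-dec)
open import Data.Sum using (_⊎_; inj₁; inj₂; [_,_]′)
open import Data.Empty using (⊥; ⊥-elim)
open import Relation.Nullary using (¬_; Dec; yes; no; ¬?; contradiction)
open import Relation.Nullary.Decidable using (_→-dec_; _×-dec_)
open import Relation.Unary using (Decidable)
open import Relation.Binary.Definitions using (tri<; tri≈; tri>)
open import Relation.Binary.PropositionalEquality using (_≡_; _≢_; refl; sym; trans; cong; cong₂; subst; subst₂)
open import Function using (_∘_; id; case_of_)


-- The linkages between the `D s` have to end on the `D s`, so they cannot simply avoid them; what
-- they can avoid is the stretch on either side of such an end. Which interval around an end can be
-- cleared in this way cannot be prescribed. Nested intervals are therefore offered in the shape of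
-- a `k`-ary tree: every leaf picks the interval of some ancestor, and a node picked from below each
-- of its `k` children becomes `D s`, with one region per child. Avoidance is affordable because
-- minimality with respect to a family passes to subfamilies: `l * (c * m)` paths resisting one
-- linkage already form a web with it, so among more than `g * (l * (c * m))` paths one can be
-- avoided by `g` linkages, each keeping order `m` out of `c * m`. The constants are not circular
-- because the slots of the backbone are processed from the last to the first. The length of a slot
-- depends only on what lies below it and on the order that must survive the slots below, so lengths
-- and orders come from one upward recursion.

module Lists where

  -- Removal from lists and the pigeonhole principle

  module _ {A : Set} where

    ∈-∖ : ∀ {x y : A} {xs} (x∈ : x ∈ xs) → y ∈ xs → y ≢ x → y ∈ (xs ∖ x∈)
    ∈-∖ (here refl) (here refl) y≢ = contradiction refl y≢
    ∈-∖ (here refl) (there y∈)  y≢ = y∈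
    ∈-∖ (there x∈)  (here refl) y≢ = here refl
    ∈-∖ (there x∈)  (there y∈)  y≢ = there (∈-∖ x∈ y∈ y≢)

    ∖⊆ : ∀ {x : A} {xs} (x∈ : x ∈ xs) → (xs ∖ x∈) ⊆ xs
    ∖⊆ (here refl) y∈          = there y∈
    ∖⊆ (there x∈)  (here refl) = here refl
    ∖⊆ (there x∈)  (there y∈)  = there (∖⊆ x∈ y∈)

    length-∖ : ∀ {x : A} {xs} (x∈ : x ∈ xs) → length xs ≡ suc (length (xs ∖ x∈))
    length-∖ (here refl) = refl
    length-∖ (there x∈)  = cong suc (length-∖ x∈)

    All-∖ : ∀ {P : A → Set} {x xs} (x∈ : x ∈ xs) → All P xs → All P (xs ∖ x∈)
    All-∖ x∈ ps = All.tabulate (λ y∈ → All.lookup ps (∖⊆ x∈ y∈))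

    AllPairs-∖ : ∀ {R : A → A → Set} {x xs} (x∈ : x ∈ xs) → AllPairs R xs → AllPairs R (xs ∖ x∈)
    AllPairs-∖ (here refl) (_ ∷ rs) = rs
    AllPairs-∖ (there x∈)  (r ∷ rs) = All-∖ x∈ r ∷ AllPairs-∖ x∈ rs

    AllPairs-removed : ∀ {R : A → A → Set} → (∀ {x y} → R x y → R y x) →
      ∀ {x xs} (x∈ : x ∈ xs) → AllPairs R xs → ∀ {y} → y ∈ (xs ∖ x∈) → R x y
    AllPairs-removed R-sym (here refl) (r ∷ _)  y∈         = All.lookup r y∈
    AllPairs-removed R-sym (there x∈)  (r ∷ _)  (here refl) = R-sym (All.lookup r x∈)
    AllPairs-removed R-sym (there x∈)  (_ ∷ rs) (there y∈)  = AllPairs-removed R-sym x∈ rs y∈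

    AllPairs-map∈ : ∀ {R R′ : A → A → Set} {xs} → (∀ {x y} → x ∈ xs → y ∈ xs → R x y → R′ x y) →
      AllPairs R xs → AllPairs R′ xs
    AllPairs-map∈ f []       = []
    AllPairs-map∈ f (r ∷ rs) =
      All.tabulate (λ y∈ → f (here refl) (there y∈) (All.lookup r y∈)) ∷
      AllPairs-map∈ (λ x∈ y∈ → f (there x∈) (there y∈)) rs

    mapWith∈⁺ : ∀ {B : Set} {xs : List A} (f : ∀ {x} → x ∈ xs → B) {x} (x∈ : x ∈ xs) → f x∈ ∈ mapWith∈ xs f
    mapWith∈⁺ f (here refl) = here refl
    mapWith∈⁺ f (there x∈)  = there (mapWith∈⁺ (f ∘ there) x∈)

    length-mapWith∈ : ∀ {B : Set} (xs : List A) (f : ∀ {x} → x ∈ xs → B) → length (mapWith∈ xs f) ≡ length xs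
    length-mapWith∈ []       f = refl
    length-mapWith∈ (x ∷ xs) f = cong suc (length-mapWith∈ xs (f ∘ there))

    attach : (xs : List A) → List (Σ A (_∈ xs))
    attach xs = mapWith∈ xs (λ x∈ → _ , x∈)

    unique-⊆-length : ∀ {xs ys : List A} → Unique xs → xs ⊆ ys → length xs ≤ length ys
    unique-⊆-length []       _  = z≤n
    unique-⊆-length {x ∷ xs} {ys} (x∉ ∷ u) xs⊆ = subst (suc (length xs) ≤_) (sym (length-∖ x∈))
      (s≤s (unique-⊆-length u (λ y∈ → ∈-∖ x∈ (xs⊆ (there y∈)) (λ y≡x → All.lookup x∉ y∈ (sym y≡x)))))
      where x∈ = xs⊆ (here refl)

    -- Pigeonhole, removing the head of `xs` from both lists. It shows that a linkage as large as
    -- the set it ends in uses every element of that set.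
    covered : ∀ {xs ys : List A} → Unique xs → xs ⊆ ys → length ys ≤ length xs → ys ⊆ xs
    covered {[]} {[]} _ _ _ ()
    covered {x ∷ xs} {ys} (x∉ ∷ u) xs⊆ le {z} z∈ = [ here , there ∘ covered u xs⊆′ le′ ]′ (split x∈ z∈)
      where
      x∈ = xs⊆ (here refl)
      xs⊆′ : xs ⊆ (ys ∖ x∈)
      xs⊆′ y∈ = ∈-∖ x∈ (xs⊆ (there y∈)) (λ y≡x → All.lookup x∉ y∈ (sym y≡x))
      le′ : length (ys ∖ x∈) ≤ length xs
      le′ = s≤s⁻¹ (subst (_≤ suc (length xs)) (length-∖ x∈) le)
      split : ∀ {w zs} (w∈ : w ∈ zs) → z ∈ zs → z ≡ w ⊎ z ∈ (zs ∖ w∈)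
      split (here refl) (here refl) = inj₁ refl
      split (here refl) (there z∈)  = inj₂ z∈
      split (there w∈)  (here refl) = inj₂ (here refl)
      split (there w∈)  (there z∈)  with split w∈ z∈
      ... | inj₁ eq = inj₁ eq
      ... | inj₂ q  = inj₂ (there q)

    -- The same count leaves no room for repetitions in `ys`; in Menger's theorem this keeps the
    -- head of the new edge out of the separator.
    unique-covers : ∀ {xs ys : List A} → Unique xs → xs ⊆ ys → length ys ≤ length xs → Unique ys
    unique-covers {_}      {[]}    _ _ _ = []
    unique-covers {[]}     {_ ∷ _} _ _ ()
    unique-covers {x ∷ xs} {y ∷ ys} u xs⊆ le = All.tabulate y∉ ∷ unique-covers u′ sub le′
      where
      y∈ : y ∈ x ∷ xs
      y∈ = covered u xs⊆ le (here refl)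
      u′ = AllPairs-∖ y∈ u
      y-off : ∀ {z} → z ∈ ((x ∷ xs) ∖ y∈) → y ≢ z
      y-off = AllPairs-removed (λ p q → p (sym q)) y∈ u
      sub : ((x ∷ xs) ∖ y∈) ⊆ ys
      sub z∈ with xs⊆ (∖⊆ y∈ z∈)
      ... | here refl = contradiction refl (y-off z∈)
      ... | there q   = q
      le′ : length ys ≤ length ((x ∷ xs) ∖ y∈)
      le′ = s≤s⁻¹ (subst (suc (length ys) ≤_) (length-∖ y∈) le)
      y∉ : ∀ {z} → z ∈ ys → y ≢ z
      y∉ z∈ refl = y-off (covered u′ sub le′ z∈) refl

  length-cartesianProduct : ∀ {A B : Set} (xs : List A) (ys : List B) → length (cartesianProduct xs ys) ≡ length xs * length ys
  length-cartesianProduct []       ys = refl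
  length-cartesianProduct (x ∷ xs) ys = trans (length-++ (map (x ,_) ys)) (cong₂ _+_ (length-map (x ,_) ys) (length-cartesianProduct xs ys))

open Lists

-- Vertex sets given by lists

module Subsets where

  open import Data.Vec using ([]; _∷_)

  private
    variable
      n : ℕ

  toSubset : List (Fin n) → Subset n
  toSubset = foldr (λ x S → ⁅ x ⁆ ∪ₛ S) ⊥ₛ

  ∈-toSubset⁺ : ∀ {xs : List (Fin n)} {x} → x ∈ xs → x ∈ₛ toSubset xs
  ∈-toSubset⁺ {xs = x ∷ xs} (here refl) = Subsetₚ.x∈p∪q⁺ (inj₁ (Subsetₚ.x∈⁅x⁆ x))
  ∈-toSubset⁺ {xs = x ∷ xs} (there x∈)  = Subsetₚ.x∈p∪q⁺ {p = ⁅ x ⁆} (inj₂ (∈-toSubset⁺ x∈))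

  ∈-toSubset⁻ : ∀ (xs : List (Fin n)) {x} → x ∈ₛ toSubset xs → x ∈ xs
  ∈-toSubset⁻ []       x∈ = ⊥-elim (Subsetₚ.∉⊥ x∈)
  ∈-toSubset⁻ (y ∷ xs) x∈ with Subsetₚ.x∈p∪q⁻ ⁅ y ⁆ (toSubset xs) x∈
  ... | inj₁ q = here (Subsetₚ.x∈⁅y⁆⇒x≡y y q)
  ... | inj₂ q = there (∈-toSubset⁻ xs q)

  ∣∪∣≤ : ∀ (P Q : Subset n) → ∣ P ∪ₛ Q ∣ ≤ ∣ P ∣ + ∣ Q ∣
  ∣∪∣≤ []          []          = z≤n
  ∣∪∣≤ (true ∷ P)  (true ∷ Q)  = s≤s (≤-trans (∣∪∣≤ P Q) (+-monoʳ-≤ ∣ P ∣ (n≤1+n ∣ Q ∣)))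
  ∣∪∣≤ (true ∷ P)  (false ∷ Q) = s≤s (∣∪∣≤ P Q)
  ∣∪∣≤ (false ∷ P) (true ∷ Q)  = ≤-trans (s≤s (∣∪∣≤ P Q)) (≤-reflexive (sym (+-suc ∣ P ∣ ∣ Q ∣)))
  ∣∪∣≤ (false ∷ P) (false ∷ Q) = ∣∪∣≤ P Q

  ∣⁅⁆∪∣≤ : ∀ (x : Fin n) (S : Subset n) → ∣ ⁅ x ⁆ ∪ₛ S ∣ ≤ suc ∣ S ∣
  ∣⁅⁆∪∣≤ x S = ≤-trans (∣∪∣≤ ⁅ x ⁆ S) (≤-reflexive (cong (_+ ∣ S ∣) (Subsetₚ.∣⁅x⁆∣≡1 x)))

  ∣toSubset∣≤ : ∀ (xs : List (Fin n)) → ∣ toSubset xs ∣ ≤ length xs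
  ∣toSubset∣≤ {n} []   = ≤-reflexive (Subsetₚ.∣⊥∣≡0 n)
  ∣toSubset∣≤ (x ∷ xs) = ≤-trans (∣⁅⁆∪∣≤ x (toSubset xs)) (s≤s (∣toSubset∣≤ xs))

open Subsets

-- Numerical parameters

module Sizes (l c : ℕ) where

  -- Parameters for clearing g linkages down to order m.
  many order height : ℕ → ℕ → ℕ
  many m g   = suc (g * (l * (c * m)))
  order m g  = c ^ many m g * (c * m)
  height m g = many m g + g * (l * order m g)

  -- Length, counted in stations, of an interval that holds a `k`-ary tree of height `t`. The three
  -- extra steps per child separate it from its two gap stations and from the preceding gap; the
  -- final `suc` leaves a nonempty stretch after the last gap.
  treeSize : ℕ → ℕ → ℕ
  treeSize k zero    = 1
  treeSize k (suc t) = suc (k * (3 + treeSize k t))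

  -- One more than the number of blocks that `f` linkages of order `c * m` can refuse, at
  -- `l * (c * m)` blocks each.
  blocks : ℕ → ℕ → ℕ
  blocks m f = suc (f * (l * (c * m)))

  slotLength : ℕ → ℕ → ℕ → ℕ → ℕ
  slotLength k m g f = blocks m f * suc (treeSize k (height m g))

  -- Slot w of the backbone starts at station off w; ord w is the order required before the slots below w are processed.
  module Schedule (k q n : ℕ) where

    schedule : ℕ → ℕ × ℕ
    slot : ℕ × ℕ → ℕ

    -- Outside the slot there are at most `o` cells in the slots below and `q * k` regions in the
    -- slots above. Each of these is linked with a cell of the slot in both directions, whence the
    -- sum; pairs of them account for the product.
    slot (o , m) = slotLength k m ((o + q * k) + (o + q * k)) ((o + q * k) * (o + q * k))

    schedule zero    = 0 , n
    schedule (suc w) = suc (proj₁ (schedule w) + slot (schedule w)) ,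
      order (proj₂ (schedule w)) ((proj₁ (schedule w) + q * k) + (proj₁ (schedule w) + q * k))

    off ord len others : ℕ → ℕ
    off w    = proj₁ (schedule w)
    ord w    = proj₂ (schedule w)
    len w    = slot (schedule w)
    others w = off w + q * k

  -- Order required of each of J + 1 commodities so that one can be routed and the other J kept.
  routeOrder : ℕ → ℕ → ℕ
  routeOrder m zero    = m
  routeOrder m (suc J) = suc (J * (l * (c * routeOrder m J)) + c * routeOrder m J)

module OfDigraph (G : Digraph) where

  open Digraph G using (n)

  -- Walks and paths

  module Paths where

    Vertex : Set
    Vertex = V G

    _∈?_ : (x : Vertex) (xs : List Vertex) → Dec (x ∈ xs)
    _∈?_ = DecMem._∈?_ (Fin._≟_ {n})

    Rel : Set₁
    Rel = Vertex → Vertex → Set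

    Pr : Set₁
    Pr = Vertex → Set

    Pth : Set
    Pth = Path G

    vts : Pth → List Vertex
    vts = verts G

    st en : Pth → Vertex
    st = start G
    en = end G

    eds : Pth → List (Vertex × Vertex)
    eds = edgesOf G

    Disj : Pth → Pth → Set
    Disj = VDisjoint G

    Disj-sym : ∀ {P Q} → Disj P Q → Disj Q P
    Disj-sym d x x∈ x∈′ = d x x∈′ x∈

    st∈ : ∀ P → st P ∈ vts P
    st∈ P = here refl

    last∈ : ∀ x xs → lastOf G x xs ∈ x ∷ xs
    last∈ x []       = here refl
    last∈ x (y ∷ ys) = there (last∈ y ys)

    en∈ : ∀ P → en P ∈ vts P
    en∈ P = last∈ (Path.first P) (Path.rest P)

    same-path : ∀ {L P Q x} → AllPairs Disj L → P ∈ L → Q ∈ L → x ∈ vts P → x ∈ vts Q → P ≡ Q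
    same-path d P∈ Q∈ x∈P x∈Q with ∈-AllPairs₂ d P∈ Q∈
    ... | inj₁ eq       = eq
    ... | inj₂ (inj₁ r) = ⊥-elim (r _ x∈P x∈Q)
    ... | inj₂ (inj₂ r) = ⊥-elim (r _ x∈Q x∈P)

    private
      variable
        E E′ : Rel
        K K′ : Pr
        x y z : Vertex

    -- Walks may repeat vertices and so concatenate freely; `toPath` removes the loops once at the
    -- end. Confinement to a set, or avoidance of one, is carried by `K`.
    data Walk (E : Rel) (K : Pr) : Rel where
      stop : K x → Walk E K x x
      _,_▸_ : K x → E x y → Walk E K y z → Walk E K x z

    infixr 5 _,_▸_

    walk-first : Walk E K x y → K x
    walk-first (stop k)    = k
    walk-first (k , _ ▸ _) = k

    walk-last : Walk E K x y → K y
    walk-last (stop k)    = k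
    walk-last (_ , _ ▸ w) = walk-last w

    walk-map : (∀ {u v} → K u → K v → E u v → E′ u v) → (∀ {u} → K u → K′ u) → Walk E K x y → Walk E′ K′ x y
    walk-map f g (stop k)    = stop (g k)
    walk-map f g (k , e ▸ w) = g k , f k (walk-first w) e ▸ walk-map f g w

    _⧺_ : Walk E K x y → Walk E K y z → Walk E K x z
    stop _      ⧺ w′ = w′
    (k , e ▸ w) ⧺ w′ = k , e ▸ (w ⧺ w′)

    module _ {S : Pr} (S? : Decidable S) where

      firstHit : Walk E K x y →
        (∃[ s ] (S s × Walk (λ u v → E u v × ¬ S u) K x s)) ⊎ Walk E (λ u → K u × ¬ S u) x y
      firstHit {x = x} (stop k) with S? x
      ... | yes s = inj₁ (x , s , stop k)
      ... | no ¬s = inj₂ (stop (k , ¬s))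
      firstHit {x = x} (k , e ▸ w) with S? x
      ... | yes s = inj₁ (x , s , stop k)
      ... | no ¬s with firstHit w
      ... | inj₁ (s , Ss , w′) = inj₁ (s , Ss , (k , (e , ¬s) ▸ w′))
      ... | inj₂ w′            = inj₂ ((k , ¬s) , e ▸ w′)

      lastHit : Walk E K x y →
        (∃[ s ] (S s × Walk (λ u v → E u v × ¬ S v) K s y)) ⊎ Walk E (λ u → K u × ¬ S u) x y
      lastHit {x = x} (stop k) with S? x
      ... | yes s = inj₁ (x , s , stop k)
      ... | no ¬s = inj₂ (stop (k , ¬s))
      lastHit {x = x} (k , e ▸ w) with lastHit w
      ... | inj₁ hit = inj₁ hit
      ... | inj₂ w′ with S? x
      ... | yes s = inj₁ (x , s , (k , (e , proj₂ (walk-first w′)) ▸ walk-map (λ _ kv e′ → e′ , proj₂ kv) proj₁ w′))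
      ... | no ¬s = inj₂ ((k , ¬s) , e ▸ w′)

    -- Being linked by E, phrased on the list of consecutive pairs used by the definitions.
    _⊢_ : Rel → Pth → Set
    E ⊢ P = Linked E (vts P)

    linked⇒ : ∀ {x xs} → Linked E (x ∷ xs) → ∀ {u v} → (u , v) ∈ pairs G (x ∷ xs) → E u v
    linked⇒ {xs = _ ∷ _} (e ∷ l) (here refl) = e
    linked⇒ {xs = _ ∷ _} (e ∷ l) (there p)   = linked⇒ l p

    ⇒linked : ∀ {x xs} → (∀ {u v} → (u , v) ∈ pairs G (x ∷ xs) → E u v) → Linked E (x ∷ xs)
    ⇒linked {xs = []}    f = [-]
    ⇒linked {xs = _ ∷ _} f = f (here refl) ∷ ⇒linked (f ∘ there)

    ⊢-map : ∀ {P} → (∀ {u v} → E u v → E′ u v) → E ⊢ P → E′ ⊢ P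
    ⊢-map f l = ⇒linked (λ p → f (linked⇒ l p))

    pair-left∈ : ∀ {x xs u v} → (u , v) ∈ pairs G (x ∷ xs) → u ∈ x ∷ xs
    pair-left∈ {xs = _ ∷ _} (here refl) = here refl
    pair-left∈ {xs = _ ∷ _} (there p)   = there (pair-left∈ p)

    pair-right∈ : ∀ {x xs u v} → (u , v) ∈ pairs G (x ∷ xs) → v ∈ xs
    pair-right∈ {xs = _ ∷ _} (here refl) = here refl
    pair-right∈ {xs = _ ∷ _} (there p)   = there (pair-right∈ p)

    record InPath (E : Rel) (K : Pr) (x y : Vertex) : Set where
      field
        path   : Pth
        starts : st path ≡ x
        ends   : en path ≡ y
        inside : ∀ {v} → v ∈ vts path → K v
        uses   : E ⊢ path

    module _ (E⇒ : ∀ {u v} → E u v → Edge G u v) where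

      private
        suffix : ∀ {x y ys} → Unique (y ∷ ys) → Linked E (y ∷ ys) → x ∈ y ∷ ys →
          InPath E (_∈ y ∷ ys) x (lastOf G y ys)
        suffix {ys = ys} u l (here refl) = record
          { path = record { first = _ ; rest = ys ; unique = u ; linked = ⇒linked (λ p → E⇒ (linked⇒ l p)) }
          ; starts = refl ; ends = refl ; inside = id ; uses = l }
        suffix {ys = _ ∷ _} (_ ∷ u) (_ ∷ l) (there x∈) = record
          { path = path ; starts = starts ; ends = ends ; inside = there ∘ inside ; uses = uses }
          where open InPath (suffix u l x∈)

      toPath : Walk E K x y → InPath E K x y
      toPath {x = x} (stop k) = record
        { path = record { first = x ; rest = [] ; unique = [] ∷ [] ; linked = [-] }
        ; starts = refl ; ends = refl ; inside = λ { (here refl) → k } ; uses = [-] }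
      toPath {K = K} {x = x} {y = z} (k , e ▸ w) with toPath w
      ... | record { path = P ; starts = refl ; ends = refl ; inside = i ; uses = l } with x ∈? vts P
      ... | yes x∈ = record { path = path ; starts = starts ; ends = ends ; inside = i ∘ inside ; uses = uses }
        where open InPath (suffix (Path.unique P) l x∈)
      ... | no x∉ = record
        { path = record
          { first = x ; rest = vts P
          ; unique = All.tabulate (λ v∈ x≡v → x∉ (subst (_∈ vts P) (sym x≡v) v∈)) ∷ Path.unique P
          ; linked = E⇒ e ∷ Path.linked P }
        ; starts = refl ; ends = refl
        ; inside = λ { (here refl) → k ; (there v∈) → i v∈ }
        ; uses = e ∷ l }

    -- The second clause says that a proper prefix does not reach `en P`. It serves paths that meet
    -- a separator only at their ends: their proper prefixes avoid it.
    prefixWalk : ∀ {P v} → E ⊢ P → v ∈ vts P →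
      Walk E (λ u → u ∈ vts P × (u ≡ en P → v ≡ u)) (st P) v
    prefixWalk {E} {P} l v∈ = go (Path.unique P) l v∈
      where
      go : ∀ {x xs v} → Unique (x ∷ xs) → Linked E (x ∷ xs) → v ∈ x ∷ xs →
        Walk E (λ u → u ∈ x ∷ xs × (u ≡ lastOf G x xs → v ≡ u)) x v
      go _ _ (here refl) = stop (here refl , λ _ → refl)
      go {x} {y ∷ ys} (x∉ ∷ u) (e ∷ l) (there v∈) =
        (here refl , λ eq → ⊥-elim (All.lookup x∉ (last∈ y ys) eq)) , e ▸
        walk-map (λ _ _ e → e) (λ { (u∈ , f) → there u∈ , f }) (go u l v∈)

    suffixWalk : ∀ {P v} → E ⊢ P → v ∈ vts P →
      Walk E (λ u → u ∈ vts P × (u ≡ st P → v ≡ u)) v (en P)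
    suffixWalk {E} {P} l v∈ = go (Path.unique P) l v∈
      where
      whole : ∀ {x xs} → Linked E (x ∷ xs) → Walk E (_∈ x ∷ xs) x (lastOf G x xs)
      whole [-]     = stop (here refl)
      whole (e ∷ l) = here refl , e ▸ walk-map (λ _ _ e → e) there (whole l)
      go : ∀ {x xs v} → Unique (x ∷ xs) → Linked E (x ∷ xs) → v ∈ x ∷ xs →
        Walk E (λ u → u ∈ x ∷ xs × (u ≡ x → v ≡ u)) v (lastOf G x xs)
      go _ l (here refl) = walk-map (λ _ _ e → e) (λ u∈ → u∈ , sym) (whole l)
      go {x} (x∉ ∷ u) (_ ∷ l) (there v∈) =
        walk-map (λ _ _ e → e) (λ (u∈ , f) → there u∈ , λ { refl → ⊥-elim (All.lookup x∉ u∈ refl) }) (go u l v∈)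

    pathWalk : ∀ {P} → E ⊢ P → Walk E (_∈ vts P) (st P) (en P)
    pathWalk {P = P} l = walk-map (λ _ _ e → e) proj₁ (suffixWalk {P = P} l (here refl))

    -- A vertex of `S` that lies in one of the disjoint sets lies in no other, so that set and that
    -- vertex can be discarded together.
    misses-one : ∀ {X : Set} (W : X → List Vertex) S xs →
      AllPairs (λ a b → ∀ v → v ∈ W a → v ∈ W b → ⊥) xs → length S < length xs →
      ∃[ a ] (a ∈ xs × (∀ {v} → v ∈ W a → v ∉ S))
    misses-one W S (a ∷ xs) (d ∷ ds) lt with search (W a)
      where
      search : ∀ ws → (∃[ v ] (v ∈ ws × v ∈ S)) ⊎ (∀ {v} → v ∈ ws → v ∉ S)
      search [] = inj₂ λ ()
      search (w ∷ ws) with w ∈? S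
      ... | yes w∈ = inj₁ (w , here refl , w∈)
      ... | no w∉ with search ws
      ... | inj₁ (v , v∈ , q) = inj₁ (v , there v∈ , q)
      ... | inj₂ none = inj₂ λ { (here refl) → w∉ ; (there v∈) → none v∈ }
    ... | inj₂ none = a , here refl , none
    ... | inj₁ (v , v∈ , v∈S) with misses-one W (S ∖ v∈S) xs ds (s≤s⁻¹ (subst (_< length (a ∷ xs)) (length-∖ v∈S) lt))
    ... | b , b∈ , none = b , there b∈ , λ {w} w∈ w∈S → none w∈ (∈-∖ v∈S w∈S λ { refl → All.lookup d b∈ w v∈ w∈ })

    -- The stretch of a walk from its last vertex in S to the next vertex in U.
    module _ {S U : Pr} (S? : Decidable S) (U? : Decidable U) where

      stretch : Walk E K x y → S x → U y → ∃[ a ] ∃[ b ] (S a × U b × K a × K b ×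
        Walk (λ u v → E u v × (u ≡ a ⊎ ¬ S u) × ¬ U u × ¬ S v) K a b)
      stretch w sx uy with lastHit S? w
      ... | inj₂ w′ = ⊥-elim (proj₂ (walk-first w′) sx)
      ... | inj₁ (a , sa , w′) with firstHit U? (after w′)
        where
        tag : ∀ {E : Rel} {K x y} → ¬ S x → Walk (λ u v → E u v × ¬ S v) K x y →
          Walk (λ u v → E u v × (u ≡ a ⊎ ¬ S u) × ¬ S v) K x y
        tag ¬s (stop k)    = stop k
        tag ¬s (k , e ▸ w) = k , (proj₁ e , inj₂ ¬s , proj₂ e) ▸ tag (proj₂ e) w
        after : ∀ {E : Rel} {K y} → Walk (λ u v → E u v × ¬ S v) K a y →
          Walk (λ u v → E u v × (u ≡ a ⊎ ¬ S u) × ¬ S v) K a y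
        after (stop k)    = stop k
        after (k , e ▸ w) = k , (proj₁ e , inj₁ refl , proj₂ e) ▸ tag (proj₂ e) w
      ... | inj₂ w″ = ⊥-elim (proj₂ (walk-last w″) uy)
      ... | inj₁ (b , ub , w″) = a , b , sa , ub , walk-first w″ , walk-last w″ ,
            walk-map (λ { _ _ ((e , t , ¬s) , ¬u) → e , t , ¬u , ¬s }) id w″

  open Paths public

  -- Menger's theorem

  module Menger where

    record Link (E : Rel) (C D : List Vertex) (k : ℕ) : Set where
      field
        paths  : List Pth
        disj   : AllPairs Disj paths
        size   : length paths ≡ k
        starts : ∀ {P} → P ∈ paths → st P ∈ C
        ends   : ∀ {P} → P ∈ paths → en P ∈ D
        uses   : ∀ {P} → P ∈ paths → E ⊢ P

    Separates : Rel → List Vertex → List Vertex → List Vertex → Set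
    Separates E C D S = ∀ {x y} → x ∈ C → y ∈ D → ¬ Walk E (_∉ S) x y

    mapDisj : ∀ {L} (f : Pth → Vertex) → (∀ P → f P ∈ vts P) → AllPairs Disj L → Unique (map f L)
    mapDisj f f∈ d = AllPairsₚ.map⁺ (AllPairs.map (λ {P} {Q} r eq → r (f P) (f∈ P) (subst (_∈ vts Q) (sym eq) (f∈ Q))) d)

    starts-unique : ∀ {L} → AllPairs Disj L → Unique (map st L)
    starts-unique = mapDisj st st∈

    ends-unique : ∀ {L} → AllPairs Disj L → Unique (map en L)
    ends-unique = mapDisj en en∈

    pick-≡ : ∀ {A B : Set} (f : A → B) {x xs} → x ∈ map f xs → ∃[ a ] (a ∈ xs × x ≡ f a)
    pick-≡ f = ∈-map⁻ f

    OnList : List (Vertex × Vertex) → Rel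
    OnList Es u v = (u , v) ∈ Es

    -- Induction on the edges, adding e = (x , y): if x ∷ S and y ∷ S are both as large as required, linkages
    -- C → x ∷ S and y ∷ S → D avoiding e meet only in S, and are glued along S and along e.
    menger : ∀ Es → (∀ {u v} → OnList Es u v → Edge G u v) → ∀ C D k →
      Link (OnList Es) C D k ⊎ (∃[ S ] (length S < k × Separates (OnList Es) C D S))
    menger [] _ C D k = base (k ≤? length I)
      where
      I = deduplicate Fin._≟_ (filter (_∈? D) C)
      I∈ : ∀ {x} → x ∈ I → x ∈ C × x ∈ D
      I∈ x∈ = ∈-filter⁻ (_∈? D) (∈-deduplicate⁻ Fin._≟_ (filter (_∈? D) C) x∈)
      triv : Vertex → Pth
      triv x = record { first = x ; rest = [] ; unique = [] ∷ [] ; linked = [-] }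
      J = take k I
      take∈ : ∀ {A : Set} k {xs : List A} {x} → x ∈ take k xs → x ∈ xs
      take∈ (suc k) {_ ∷ _} (here eq) = here eq
      take∈ (suc k) {_ ∷ _} (there p) = there (take∈ k p)
      base : Dec (k ≤ length I) → _
      base (yes le) = inj₁ record
        { paths = map triv J
        ; disj = AllPairsₚ.map⁺ (AllPairs.map (λ { ne _ (here refl) (here refl) → ne refl })
                   (AllPairsₚ.take⁺ k (deduplicate-! Fin._≟_ (filter (_∈? D) C))))
        ; size = trans (length-map triv J) (trans (length-take k I) (m≤n⇒m⊓n≡m le))
        ; starts = λ P∈ → case pick-≡ triv P∈ of λ { (x , x∈ , refl) → proj₁ (I∈ (take∈ k x∈)) }
        ; ends = λ P∈ → case pick-≡ triv P∈ of λ { (x , x∈ , refl) → proj₂ (I∈ (take∈ k x∈)) }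
        ; uses = λ P∈ → case pick-≡ triv P∈ of λ { (x , x∈ , refl) → [-] } }
      base (no ≰) = inj₂ (I , ≰⇒> ≰ , λ { x∈ y∈ (stop x∉) → x∉ (∈-deduplicate⁺ Fin._≟_ (∈-filter⁺ (_∈? D) x∈ y∈)) })
    menger ((x , y) ∷ Es) E⇒ C D k = add (menger Es (E⇒ ∘ there) C D k)
      where
      E E′ : Rel
      E = OnList Es
      E′ = OnList ((x , y) ∷ Es)
      old : ∀ {u v} → ¬ (u ≡ x × v ≡ y) → E′ u v → E u v
      old ne (here refl) = ⊥-elim (ne (refl , refl))
      old ne (there p)   = p
      widen : ∀ {C D} → Link E C D k → Link E′ C D k
      widen l = record { Link l ; uses = λ {P} P∈ → ⊢-map {P = P} there (Link.uses l P∈) }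
      Goal = Link E′ C D k ⊎ (∃[ S ] (length S < k × Separates E′ C D S))

      module Glue (S : List Vertex) (S<k : length S < k) (sep : Separates E C D S)
                  (l₁ : Link E C (x ∷ S) k) (l₂ : Link E (y ∷ S) D k) where
        open Link l₁ using () renaming (paths to L₁; disj to d₁; ends to e₁; uses to u₁)
        open Link l₂ using () renaming (paths to L₂; disj to d₂; starts to s₂; uses to u₂)

        en⊆ : map en L₁ ⊆ x ∷ S
        en⊆ v∈ = case pick-≡ en v∈ of λ { (P , P∈ , refl) → e₁ P∈ }
        st⊆ : map st L₂ ⊆ y ∷ S
        st⊆ v∈ = case pick-≡ st v∈ of λ { (P , P∈ , refl) → s₂ P∈ }
        S≤₁ : suc (length S) ≤ length (map en L₁)
        S≤₁ = subst (suc (length S) ≤_) (sym (trans (length-map en L₁) (Link.size l₁))) S<k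
        S≤₂ : suc (length S) ≤ length (map st L₂)
        S≤₂ = subst (suc (length S) ≤_) (sym (trans (length-map st L₂) (Link.size l₂))) S<k

        -- `x ∷ S` has at most `k` elements and `k` disjoint paths end in it, so each element is the
        -- end of one of them, and by disjointness no path passes through it earlier.
        at-end : ∀ {P s} → P ∈ L₁ → s ∈ vts P → s ∈ x ∷ S → s ≡ en P
        at-end {P} P∈ s∈P s∈ with pick-≡ en (covered (ends-unique d₁) en⊆ S≤₁ s∈)
        ... | Q , Q∈ , refl with same-path d₁ P∈ Q∈ s∈P (en∈ Q)
        ... | refl = refl
        at-start : ∀ {P s} → P ∈ L₂ → s ∈ vts P → s ∈ y ∷ S → s ≡ st P
        at-start {P} P∈ s∈P s∈ with pick-≡ st (covered (starts-unique d₂) st⊆ S≤₂ s∈)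
        ... | Q , Q∈ , refl with same-path d₂ P∈ Q∈ s∈P (st∈ Q)
        ... | refl = refl

        y∉S : y ∉ S
        y∉S y∈ with unique-covers (starts-unique d₂) st⊆ S≤₂
        ... | y∉ ∷ _ = All.lookup y∉ y∈ refl

        -- A common vertex outside `S` would give a walk from `C` to `D`, along `P` and then along
        -- `Q`, that avoids `S` because both paths meet `S` only at the ends facing each other.
        crossing : ∀ {P Q v} → P ∈ L₁ → Q ∈ L₂ → v ∈ vts P → v ∈ vts Q → v ≡ en P × v ≡ st Q × v ∈ S
        crossing {P} {Q} {v} P∈ Q∈ v∈P v∈Q with v ∈? S
        ... | yes v∈S = at-end P∈ v∈P (there v∈S) , at-start Q∈ v∈Q (there v∈S) , v∈S
        ... | no v∉S = ⊥-elim (sep (Link.starts l₁ P∈) (Link.ends l₂ Q∈)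
          (walk-map (λ _ _ e → e) (λ (u∈ , f) u∈S → v∉S (subst (_∈ S) (sym (f (at-end P∈ u∈ (there u∈S)))) u∈S))
             (prefixWalk {P = P} (u₁ P∈) v∈P)
           ⧺ walk-map (λ _ _ e → e) (λ (u∈ , f) u∈S → v∉S (subst (_∈ S) (sym (f (at-start Q∈ u∈ (there u∈S)))) u∈S))
             (suffixWalk {P = Q} (u₂ Q∈) v∈Q)))

        record Glued (P : Pth) : Set where
          field
            path   : Pth
            onward : Pth
            onward∈ : onward ∈ L₂
            joint  : (en P ≡ x × st onward ≡ y) ⊎ (en P ∈ S × st onward ≡ en P)
            starts : st path ≡ st P
            ends   : en path ≡ en onward
            uses   : E′ ⊢ path
            inside : ∀ {v} → v ∈ vts path → v ∈ vts P ⊎ v ∈ vts onward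

        glue : ∀ {P} → P ∈ L₁ → Glued P
        glue {P} P∈ with e₁ P∈
        ... | here en≡x with pick-≡ st (covered (starts-unique d₂) st⊆ S≤₂ (here refl))
        ... | Q , Q∈ , y≡ = record
          { path = path ; onward = Q ; onward∈ = Q∈ ; joint = inj₁ (en≡x , sym y≡)
          ; starts = starts ; ends = ends ; uses = uses ; inside = inside }
          where
          walk : Walk E′ (λ v → v ∈ vts P ⊎ v ∈ vts Q) (st P) (en Q)
          walk = walk-map (λ _ _ → there) inj₁ (pathWalk {P = P} (u₁ P∈)) ⧺
                 (inj₁ (en∈ P) , subst (λ v → E′ v (st Q)) (sym en≡x) (subst (E′ x) y≡ (here refl)) ▸
                  walk-map (λ _ _ → there) inj₂ (pathWalk {P = Q} (u₂ Q∈)))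
          open InPath (toPath E⇒ walk)
        glue {P} P∈ | there en∈S with pick-≡ st (covered (starts-unique d₂) st⊆ S≤₂ (there en∈S))
        ... | Q , Q∈ , en≡ = record
          { path = path ; onward = Q ; onward∈ = Q∈ ; joint = inj₂ (en∈S , sym en≡)
          ; starts = starts ; ends = ends ; uses = uses ; inside = inside }
          where
          walk : Walk E′ (λ v → v ∈ vts P ⊎ v ∈ vts Q) (st P) (en Q)
          walk = walk-map (λ _ _ → there) inj₁ (pathWalk {P = P} (u₁ P∈)) ⧺
                 subst (λ v → Walk E′ (λ u → u ∈ vts P ⊎ u ∈ vts Q) v (en Q)) (sym en≡)
                   (walk-map (λ _ _ → there) inj₂ (pathWalk {P = Q} (u₂ Q∈)))
          open InPath (toPath E⇒ walk)

        onward-injective : ∀ {P Q} (P∈ : P ∈ L₁) (Q∈ : Q ∈ L₁) →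
          Glued.onward (glue P∈) ≡ Glued.onward (glue Q∈) → en P ≡ en Q
        onward-injective P∈ Q∈ eq with Glued.joint (glue P∈) | Glued.joint (glue Q∈)
        ... | inj₁ (a , b) | inj₁ (a′ , b′) = trans a (sym a′)
        ... | inj₁ (a , b) | inj₂ (a′ , b′) = ⊥-elim (y∉S (subst (_∈ S) (trans (sym b′) (trans (cong st (sym eq)) b)) a′))
        ... | inj₂ (a , b) | inj₁ (a′ , b′) = ⊥-elim (y∉S (subst (_∈ S) (trans (sym b) (trans (cong st eq) b′)) a))
        ... | inj₂ (a , b) | inj₂ (a′ , b′) = trans (sym b) (trans (cong st eq) b′)

        onward-avoids : ∀ {P Q v} (P∈ : P ∈ L₁) (Q∈ : Q ∈ L₁) → Disj P Q → v ∈ vts P → v ∈ vts (Glued.onward (glue Q∈)) → ⊥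
        onward-avoids {P} {Q} P∈ Q∈ d a b with crossing P∈ (Glued.onward∈ (glue Q∈)) a b | Glued.joint (glue Q∈)
        ... | _ , v≡st , v∈S | inj₁ (_ , st≡y)  = y∉S (subst (_∈ S) (trans v≡st st≡y) v∈S)
        ... | _ , v≡st , _   | inj₂ (_ , st≡en) = d _ a (subst (_∈ vts Q) (sym (trans v≡st st≡en)) (en∈ Q))

        glue-disjoint : ∀ {P Q} (P∈ : P ∈ L₁) (Q∈ : Q ∈ L₁) → Disj P Q → Disj (Glued.path (glue P∈)) (Glued.path (glue Q∈))
        glue-disjoint {P} {Q} P∈ Q∈ d v v∈P v∈Q with Glued.inside (glue P∈) v∈P | Glued.inside (glue Q∈) v∈Q
        ... | inj₁ a | inj₁ b = d v a b
        ... | inj₂ a | inj₂ b = d (en P) (en∈ P) (subst (_∈ vts Q) (sym (onward-injective P∈ Q∈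
                (same-path d₂ (Glued.onward∈ (glue P∈)) (Glued.onward∈ (glue Q∈)) a b))) (en∈ Q))
        ... | inj₁ a | inj₂ b = onward-avoids P∈ Q∈ d a b
        ... | inj₂ a | inj₁ b = onward-avoids Q∈ P∈ (Disj-sym {P} {Q} d) b a

        glued : Link E′ C D k
        glued = record
          { paths = mapWith∈ L₁ (λ P∈ → Glued.path (glue P∈))
          ; disj = glue-all L₁ id d₁
          ; size = trans (length-mapWith∈ L₁ _) (Link.size l₁)
          ; starts = λ Q∈ → case back L₁ id Q∈ of λ { (P , P∈ , refl) → subst (_∈ C) (sym (Glued.starts (glue P∈))) (Link.starts l₁ P∈) }
          ; ends = λ Q∈ → case back L₁ id Q∈ of λ { (P , P∈ , refl) → subst (_∈ D) (sym (Glued.ends (glue P∈))) (Link.ends l₂ (Glued.onward∈ (glue P∈))) }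
          ; uses = λ Q∈ → case back L₁ id Q∈ of λ { (P , P∈ , refl) → Glued.uses (glue P∈) } }
          where
          back : ∀ L (⊆L : ∀ {P} → P ∈ L → P ∈ L₁) {Q} → Q ∈ mapWith∈ L (λ P∈ → Glued.path (glue (⊆L P∈))) →
            ∃[ P ] Σ (P ∈ L₁) λ P∈ → Q ≡ Glued.path (glue P∈)
          back (P ∷ L) ⊆L (here eq)  = P , ⊆L (here refl) , eq
          back (P ∷ L) ⊆L (there Q∈) = back L (⊆L ∘ there) Q∈
          all-glued : ∀ L (⊆L : ∀ {P} → P ∈ L → P ∈ L₁) {P} (P∈ : P ∈ L₁) → All (Disj P) L →
            All (Disj (Glued.path (glue P∈))) (mapWith∈ L (λ Q∈ → Glued.path (glue (⊆L Q∈))))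
          all-glued []      ⊆L P∈ []       = []
          all-glued (Q ∷ L) ⊆L P∈ (r ∷ rs) = glue-disjoint P∈ (⊆L (here refl)) r ∷ all-glued L (⊆L ∘ there) P∈ rs
          glue-all : ∀ L (⊆L : ∀ {P} → P ∈ L → P ∈ L₁) → AllPairs Disj L →
            AllPairs Disj (mapWith∈ L (λ P∈ → Glued.path (glue (⊆L P∈))))
          glue-all []      ⊆L []       = []
          glue-all (P ∷ L) ⊆L (r ∷ rs) = all-glued L (⊆L ∘ there) (⊆L (here refl)) r ∷ glue-all L (⊆L ∘ there) rs

      add : Link E C D k ⊎ (∃[ S ] (length S < k × Separates E C D S)) → Goal
      add (inj₁ l) = inj₁ (widen l)
      add (inj₂ (S , S<k , sep)) with menger Es (E⇒ ∘ there) C (x ∷ S) k | menger Es (E⇒ ∘ there) (y ∷ S) D k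
      ... | inj₁ l₁ | inj₁ l₂ = inj₁ (Glue.glued S S<k sep l₁ l₂)
      -- A walk avoiding `U` cannot reach `x ∷ S`: up to its first vertex there it uses old edges
      -- only, against `sepU`. If it never gets there, it does not use the new edge, whose tail is
      -- `x`, and it avoids `S`. The other case is symmetric, with the head `y` and the last vertex
      -- in `y ∷ S`.
      ... | inj₂ (U , U<k , sepU) | _ = inj₂ (U , U<k , λ x∈ y∈ w → case firstHit (_∈? (x ∷ S)) w of λ
        { (inj₁ (s , s∈ , w′)) → sepU x∈ s∈ (walk-map (λ { _ _ (e , u∉) → old (λ { (refl , _) → u∉ (here refl) }) e }) id w′)
        ; (inj₂ w′) → sep x∈ y∈ (walk-map (λ { (_ , u∉) _ e → old (λ { (refl , _) → u∉ (here refl) }) e }) (λ (_ , u∉) → u∉ ∘ there) w′) })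
      ... | inj₁ _ | inj₂ (U , U<k , sepU) = inj₂ (U , U<k , λ x∈ y∈ w → case lastHit (_∈? (y ∷ S)) w of λ
        { (inj₁ (s , s∈ , w′)) → sepU s∈ y∈ (walk-map (λ { _ _ (e , v∉) → old (λ { (_ , refl) → v∉ (here refl) }) e }) id w′)
        ; (inj₂ w′) → sep x∈ y∈ (walk-map (λ { _ (_ , v∉) e → old (λ { (_ , refl) → v∉ (here refl) }) e }) (λ (_ , u∉) → u∉ ∘ there) w′) })

  open Menger public

  -- Rerouting and minimal linkages

  module Linkages where

    VertexEdge : Set
    VertexEdge = Vertex × Vertex

    edges : List Pth → List VertexEdge
    edges L = concat (map eds L)

    _∈ₑ_ _∉ₑ_ : VertexEdge → List Pth → Set
    e ∈ₑ L = ∃[ P ] (P ∈ L × e ∈ eds P)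
    e ∉ₑ L = ¬ (e ∈ₑ L)

    listed : ∀ {L e} → e ∈ₑ L → e ∈ edges L
    listed (P , P∈ , e∈) = ∈-concat⁺′ e∈ (∈-map⁺ eds P∈)

    unlisted : ∀ L {e} → e ∈ edges L → e ∈ₑ L
    unlisted L e∈ with ∈-concat⁻′ (map eds L) e∈
    ... | es , e∈es , es∈ with ∈-map⁻ eds es∈
    ... | P , P∈ , refl = P , P∈ , e∈es

    _∈ₑ?_ : ∀ e L → Dec (e ∈ₑ L)
    e ∈ₑ? L with DecMem._∈?_ (≡-dec Fin._≟_ Fin._≟_) e (edges L)
    ... | yes e∈ = yes (unlisted L e∈)
    ... | no e∉ = no (e∉ ∘ listed)

    ∈ₑ-Edge : ∀ {L u v} → (u , v) ∈ₑ L → Edge G u v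
    ∈ₑ-Edge (P , _ , e∈P) = linked⇒ (Path.linked P) e∈P

    _∈ᵥ_ : Vertex → List Pth → Set
    x ∈ᵥ L = ∃[ P ] (P ∈ L × x ∈ vts P)

    _∈ᵥ?_ : ∀ x L → Dec (x ∈ᵥ L)
    x ∈ᵥ? L with Any.any? (λ P → x ∈? vts P) L
    ... | yes a = yes (let P , P∈ , x∈ = find a in P , P∈ , x∈)
    ... | no ¬a = no (λ (P , P∈ , x∈) → ¬a (lose P∈ x∈))

    Nontrivial : Pth → Set
    Nontrivial P = st P ≢ en P

    -- Trivial paths are excluded for two reasons: the end sets of a web have to differ, and the
    -- vertices of a rerouted linkage are traced back through its edges, which requires every vertex
    -- to lie on an edge.
    record Linkage (L : List Pth) : Set where
      field
        disj    : AllPairs Disj L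
        nontriv : ∀ {P} → P ∈ L → Nontrivial P

    -- L′ is obtained from L by rerouting through 𝒬.
    record Ref (𝒬 L′ L : List Pth) : Set where
      field
        starts : ∀ {P} → P ∈ L′ → st P ∈ map st L
        ends   : ∀ {P} → P ∈ L′ → en P ∈ map en L
        edge   : ∀ {e} → e ∈ₑ L′ → e ∈ₑ L ⊎ e ∈ₑ 𝒬
        vert   : ∀ {x} → x ∈ᵥ L′ → x ∈ᵥ L ⊎ x ∈ᵥ 𝒬

    module _ {𝒬 : List Pth} where

      sublinkage : ∀ {L′ L} → L′ ⊆ L → Ref 𝒬 L′ L
      sublinkage {L′} {L} s = record
        { starts = λ P∈ → ∈-map⁺ st (s P∈) ; ends = λ P∈ → ∈-map⁺ en (s P∈)
        ; edge = λ (P , P∈ , q) → inj₁ (P , s P∈ , q)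
        ; vert = λ (P , P∈ , q) → inj₁ (P , s P∈ , q) }

      Ref-trans : ∀ {𝒬′ L″ L′ L} → 𝒬′ ⊆ 𝒬 → Ref 𝒬′ L″ L′ → Ref 𝒬 L′ L → Ref 𝒬 L″ L
      Ref-trans {𝒬′} s r₂ r₁ = record
        { starts = λ P∈ → case ∈-map⁻ st (Ref.starts r₂ P∈) of λ (Q , Q∈ , eq) → subst (_∈ _) (sym eq) (Ref.starts r₁ Q∈)
        ; ends = λ P∈ → case ∈-map⁻ en (Ref.ends r₂ P∈) of λ (Q , Q∈ , eq) → subst (_∈ _) (sym eq) (Ref.ends r₁ Q∈)
        ; edge = λ e∈ → [ Ref.edge r₁ , (λ (P , P∈ , q) → inj₂ (P , s P∈ , q)) ]′ (Ref.edge r₂ e∈)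
        ; vert = λ x∈ → [ Ref.vert r₁ , (λ (P , P∈ , q) → inj₂ (P , s P∈ , q)) ]′ (Ref.vert r₂ x∈) }

    on-edge : ∀ {P x} → Nontrivial P → x ∈ vts P →
      (∃[ y ] (x , y) ∈ eds P) ⊎ (∃[ y ] (y , x) ∈ eds P)
    on-edge {P} nt x∈ = go (Path.first P) (Path.rest P) nt x∈
      where
      later : ∀ {x} y ys → x ∈ ys → ∃[ z ] (z , x) ∈ pairs G (y ∷ ys)
      later y (z ∷ zs) (here refl) = y , here refl
      later y (z ∷ zs) (there x∈)  = let w , q = later z zs x∈ in w , there q
      go : ∀ {x} y ys → y ≢ lastOf G y ys → x ∈ y ∷ ys →
        (∃[ z ] (x , z) ∈ pairs G (y ∷ ys)) ⊎ (∃[ z ] (z , x) ∈ pairs G (y ∷ ys))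
      go y []       nt _           = ⊥-elim (nt refl)
      go y (z ∷ zs) nt (here refl) = inj₁ (z , here refl)
      go y (z ∷ zs) nt (there x∈)  = inj₂ (later y (z ∷ zs) x∈)

    Hits-all : ∀ {E C D k S} → Link E C D k → Separates E C D S → k ≤ length S
    Hits-all {k = k} {S} l sep with k ≤? length S
    ... | yes le = le
    ... | no ≰ with misses-one vts S (Link.paths l) (Link.disj l) (subst (length S <_) (sym (Link.size l)) (≰⇒> ≰))
    ... | P , P∈ , none = ⊥-elim (sep (Link.starts l P∈) (Link.ends l P∈)
          (walk-map (λ _ _ e → e) none (pathWalk {P = P} (Link.uses l P∈))))

    link-mono : ∀ {E E′ C D k} → (∀ {u v} → E u v → E′ u v) → Link E C D k → Link E′ C D k
    link-mono f l = record { Link l ; uses = λ {P} P∈ → ⊢-map {P = P} f (Link.uses l P∈) }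

    -- Menger's theorem decides the question, since a separator smaller than `k` refutes the
    -- linkage. This decision drives the edge-by-edge minimisation.
    link? : ∀ Es → (∀ {u v} → OnList Es u v → Edge G u v) → ∀ C D k → Dec (Link (OnList Es) C D k)
    link? Es E⇒ C D k with menger Es E⇒ C D k
    ... | inj₁ l = yes l
    ... | inj₂ (S , S<k , sep) = no λ l → <⇒≱ S<k (Hits-all l sep)

    Without : VertexEdge → Rel → Rel
    Without (a , b) E u v = E u v × ¬ (u ≡ a × v ≡ b)

    Union : List Pth → List Pth → Rel
    Union L 𝒬 u v = (u , v) ∈ₑ L ⊎ (u , v) ∈ₑ 𝒬

    Min : List Pth → List Pth → Set
    Min L 𝒬 = ∀ {e} → e ∈ₑ L → e ∉ₑ 𝒬 →
      ¬ Link (Without e (Union L 𝒬)) (map st L) (map en L) (length L)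

    -- Every edge of L outside 𝒬 is dropped in turn if a linkage of the same order survives.
    module _ {L : List Pth} (lk : Linkage L) (𝒬 : List Pth) where

      private
        C = map st L
        D = map en L
        k = length L
        E𝒬 = edges 𝒬

        Prune : List VertexEdge → VertexEdge → List VertexEdge
        Prune F e = filter (λ f → ¬? (≡-dec Fin._≟_ Fin._≟_ f e)) F

        LinkF : List VertexEdge → Set
        LinkF F = Link (OnList (F ++ E𝒬)) C D k

        ++-mono : ∀ {F F′} → F ⊆ F′ → ∀ {u v} → OnList (F ++ E𝒬) u v → OnList (F′ ++ E𝒬) u v
        ++-mono {F} {F′} s e∈ = [ ∈-++⁺ˡ ∘ s , ∈-++⁺ʳ F′ ]′ (∈-++⁻ F e∈)

        loop : ∀ todo F → (∀ {u v} → (u , v) ∈ F → Edge G u v) → LinkF F →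
          ∃[ F′ ] (F′ ⊆ F × LinkF F′ × (∀ {e} → e ∈ todo → e ∉ F′ ⊎ ¬ LinkF (Prune F′ e)))
        loop [] F F⇒ l = F , id , l , λ ()
        loop (e ∷ todo) F F⇒ l
          with link? (Prune F e ++ E𝒬) (λ q → [ F⇒ ∘ proj₁ ∘ ∈-filter⁻ _ , ∈ₑ-Edge ∘ unlisted 𝒬 ]′ (∈-++⁻ (Prune F e) q)) C D k
        ... | yes l′ with loop todo (Prune F e) (F⇒ ∘ proj₁ ∘ ∈-filter⁻ _) l′
        ... | F′ , s , l″ , f = F′ , proj₁ ∘ ∈-filter⁻ _ ∘ s , l″ ,
          λ { (here refl) → inj₁ (λ e∈ → proj₂ (∈-filter⁻ _ {xs = F} (s e∈)) refl) ; (there q) → f q }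
        loop (e ∷ todo) F F⇒ l | no ¬l with loop todo F F⇒ l
        ... | F′ , s , l″ , f = F′ , s , l″ , λ
          -- The refusal was found for `F`; it persists for the final `F′ ⊆ F`, because pruning is
          -- monotone.
          { (here refl) → inj₂ (λ l₃ → ¬l (link-mono (++-mono (λ q → case ∈-filter⁻ _ {xs = F′} q of λ (a , b) → ∈-filter⁺ _ (s a) b)) l₃))
          ; (there q) → f q }

        self : LinkF (edges L)
        self = record
          { paths = L ; disj = Linkage.disj lk ; size = refl
          ; starts = ∈-map⁺ st ; ends = ∈-map⁺ en
          ; uses = λ P∈ → ⇒linked (λ e∈ → ∈-++⁺ˡ (listed (_ , P∈ , e∈))) }

      minimise : ∃[ L′ ] (Linkage L′ × Ref 𝒬 L′ L × length L′ ≡ length L × Min L′ 𝒬)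
      minimise with loop (edges L) (edges L) (∈ₑ-Edge ∘ unlisted L) self
      ... | F , F⊆ , l , f = L′ , lk′ , record { starts = starts ; ends = ends ; edge = edge ; vert = vert } , size , min
        where
        open Link l renaming (paths to L′ ; disj to d)
        lk′ : Linkage L′
        -- If start and end of a path coincided, a start and an end of `L` would coincide. By
        -- disjointness they belong to one path of `L`, which would then be trivial.
        lk′ = record { disj = d ; nontriv = λ {P} P∈ eq →
          case ∈-map⁻ st (starts P∈) , ∈-map⁻ en (ends P∈) of λ ((P₁ , P₁∈ , eq₁) , (P₂ , P₂∈ , eq₂)) →
          case same-path (Linkage.disj lk) P₁∈ P₂∈ (st∈ P₁) (subst (_∈ vts P₂) (trans (sym eq₂) (trans (sym eq) eq₁)) (en∈ P₂))
          of λ { refl → Linkage.nontriv lk P₁∈ (trans (sym eq₁) (trans eq eq₂)) } }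
        edgeF : ∀ {e} → e ∈ₑ L′ → e ∈ F ++ E𝒬
        edgeF (P , P∈ , q) = linked⇒ (uses P∈) q
        edge : ∀ {e} → e ∈ₑ L′ → e ∈ₑ L ⊎ e ∈ₑ 𝒬
        edge e∈ = [ inj₁ ∘ unlisted L ∘ F⊆ , inj₂ ∘ unlisted 𝒬 ]′ (∈-++⁻ F (edgeF e∈))
        vert : ∀ {x} → x ∈ᵥ L′ → x ∈ᵥ L ⊎ x ∈ᵥ 𝒬
        vert {x} (P , P∈ , x∈) with on-edge {P} (Linkage.nontriv lk′ P∈) x∈
        ... | inj₁ (y , e∈) = case edge (_ , P∈ , e∈) of λ
          { (inj₁ (R , R∈ , r)) → inj₁ (R , R∈ , pair-left∈ r)
          ; (inj₂ (R , R∈ , r)) → inj₂ (R , R∈ , pair-left∈ r) }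
        ... | inj₂ (y , e∈) = case edge (_ , P∈ , e∈) of λ
          { (inj₁ (R , R∈ , r)) → inj₁ (R , R∈ , there (pair-right∈ r))
          ; (inj₂ (R , R∈ , r)) → inj₂ (R , R∈ , there (pair-right∈ r)) }
        min : Min L′ 𝒬
        min {e} e∈ e∉ l₂ with ∈-++⁻ F (edgeF e∈)
        ... | inj₂ q = e∉ (unlisted 𝒬 q)
        ... | inj₁ q with f (F⊆ q)
        ... | inj₁ e∉F = e∉F q
        ... | inj₂ ¬l = ¬l record
          { paths = Link.paths l₂ ; disj = Link.disj l₂ ; size = trans (Link.size l₂) size
          ; starts = λ P∈ → case ∈-map⁻ st (Link.starts l₂ P∈) of λ (R , R∈ , eq) → subst (_∈ C) (sym eq) (starts R∈)
          ; ends = λ P∈ → case ∈-map⁻ en (Link.ends l₂ P∈) of λ (R , R∈ , eq) → subst (_∈ D) (sym eq) (ends R∈)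
          ; uses = λ {P} P∈ → ⊢-map {P = P} shrink (Link.uses l₂ P∈) }
          where
          shrink : ∀ {u v} → Without e (Union L′ 𝒬) u v → OnList (Prune F e ++ E𝒬) u v
          shrink (inj₂ a , _) = ∈-++⁺ʳ (Prune F e) (listed a)
          shrink {u} {v} (inj₁ a , ne) with ∈-++⁻ F (edgeF a)
          ... | inj₂ b = ∈-++⁺ʳ (Prune F e) b
          ... | inj₁ b = ∈-++⁺ˡ (∈-filter⁺ _ b (λ { refl → ne (refl , refl) }))

    successor-unique : ∀ {P u v w} → (u , v) ∈ eds P → (u , w) ∈ eds P → v ≡ w
    successor-unique {P} = go (Path.unique P)
      where
      go : ∀ {x xs u v w} → Unique (x ∷ xs) → (u , v) ∈ pairs G (x ∷ xs) → (u , w) ∈ pairs G (x ∷ xs) → v ≡ w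
      go {xs = _ ∷ _} _        (here refl) (here refl) = refl
      go {xs = _ ∷ _} (x∉ ∷ _) (here refl) (there q)   = ⊥-elim (All.lookup x∉ (pair-left∈ q) refl)
      go {xs = _ ∷ _} (x∉ ∷ _) (there p)   (here refl) = ⊥-elim (All.lookup x∉ (pair-left∈ p) refl)
      go {xs = _ ∷ _} (_ ∷ u)  (there p)   (there q)   = go u p q

    end-no-successor : ∀ {P v} → (en P , v) ∉ eds P
    end-no-successor {P} = go (Path.unique P)
      where
      go : ∀ {x xs v} → Unique (x ∷ xs) → (lastOf G x xs , v) ∉ pairs G (x ∷ xs)
      go {x} {y ∷ ys} (x∉ ∷ _) (here eq) = All.lookup x∉ (last∈ y ys) (sym (cong proj₁ eq))
      go {x} {y ∷ ys} (_ ∷ u) (there p) = go u p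

    successor : ∀ P {u} → u ∈ vts P → u ≡ en P ⊎ (∃[ v ] (u , v) ∈ eds P)
    successor P = go (Path.first P) (Path.rest P)
      where
      go : ∀ x xs {u} → u ∈ x ∷ xs → u ≡ lastOf G x xs ⊎ (∃[ v ] (u , v) ∈ pairs G (x ∷ xs))
      go x []       (here refl) = inj₁ refl
      go x (y ∷ ys) (here refl) = inj₂ (y , here refl)
      go x (y ∷ ys) (there u∈) with go y ys u∈
      ... | inj₁ eq       = inj₁ eq
      ... | inj₂ (v , p)  = inj₂ (v , there p)

    -- Suppose a linkage L″ contradicts the 𝒬′-minimality.  Every edge of L unused by L″ lies on 𝒬, and if it lies on
    -- a path of 𝒬 outside 𝒬′ then L″ cannot leave its tail otherwise; walking back along L one reaches a start.
    min-sub : ∀ {L 𝒬 𝒬′} → AllPairs Disj L → AllPairs Disj 𝒬 → 𝒬′ ⊆ 𝒬 → Min L 𝒬 → Min L 𝒬′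
    min-sub {L} {𝒬} {𝒬′} dL d𝒬 𝒬′⊆ min {e = a , b} ab∈ ab∉ l = contra
      where
      open Link l renaming (paths to L″)
      unused : ∀ {u v} → (u , v) ∈ₑ L → (u , v) ∉ₑ L″ → (u , v) ∈ₑ 𝒬
      unused {u} {v} uv∈ uv∉ with (u , v) ∈ₑ? 𝒬
      ... | yes q = q
      ... | no q = ⊥-elim (min uv∈ q record
        { paths = L″ ; disj = disj ; size = size ; starts = starts ; ends = ends
        ; uses = λ P∈ → ⇒linked λ {s} {t} e∈ →
            widen (proj₁ (linked⇒ (uses P∈) e∈)) , λ { (refl , refl) → uv∉ (_ , P∈ , e∈) } })
        where
        widen : ∀ {s t} → Union L 𝒬′ s t → Union L 𝒬 s t
        widen (inj₁ q) = inj₁ q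
        widen (inj₂ (R , R∈ , r)) = inj₂ (R , 𝒬′⊆ R∈ , r)
      -- The tail `u` is not an end of `L`, so the path of `L″` through it goes on; away from `𝒬′`
      -- the only edge available at `u` is the one of `P`.
      leaves : ∀ {P u v} → P ∈ L → (u , v) ∈ eds P → ¬ (u ∈ᵥ 𝒬′) → u ∈ᵥ L″ → (u , v) ∈ₑ L″
      leaves {P} {u} {v} P∈ uv∈ u∉ (X , X∈ , u∈X) with successor X u∈X
      ... | inj₁ refl = case ∈-map⁻ en (ends X∈) of λ (R , R∈ , eq) →
        case same-path dL P∈ R∈ (pair-left∈ uv∈) (subst (_∈ vts R) (sym eq) (en∈ R)) of λ
          { refl → ⊥-elim (end-no-successor {P} (subst (λ w → (w , v) ∈ eds P) eq uv∈)) }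
      ... | inj₂ (w , uw∈) with proj₁ (linked⇒ (uses X∈) uw∈)
      ... | inj₂ (R , R∈ , r) = ⊥-elim (u∉ (R , R∈ , pair-left∈ r))
      ... | inj₁ (R , R∈ , r) with same-path dL P∈ R∈ (pair-left∈ uv∈) (pair-left∈ r)
      ... | refl = subst (λ t → (u , t) ∈ₑ L″) (successor-unique {P} r uv∈) (_ , X∈ , uw∈)
      Outside : Vertex → Set
      Outside u = u ∈ᵥ 𝒬 × ¬ (u ∈ᵥ 𝒬′)
      forward : ∀ {P} → P ∈ L → ∀ x xs → pairs G (x ∷ xs) ⊆ eds P → (Outside x → x ∈ᵥ L″) →
        ∀ {u} → u ∈ x ∷ xs → Outside u → u ∈ᵥ L″
      forward P∈ x xs s h (here refl) o = h o
      forward {P} P∈ x (y ∷ ys) s h (there u∈) o = forward P∈ y ys (s ∘ there) h′ u∈ o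
        where
        h′ : Outside y → y ∈ᵥ L″
        h′ ((Q , Q∈ , y∈Q) , y∉) with y ∈ᵥ? L″
        ... | yes q = q
        ... | no y∉L″ = ⊥-elim (xy∉ (leaves P∈ (s (here refl)) x∉ (h ((Q , Q∈ , x∈Q) , x∉))))
          where
          xy∉ : (x , y) ∉ₑ L″
          xy∉ (R , R∈ , r) = y∉L″ (R , R∈ , there (pair-right∈ r))
          xy∈Q : (x , y) ∈ eds Q
          xy∈Q with (unused (_ , P∈ , s (here refl)) xy∉)
          ... | R , R∈ , r with same-path d𝒬 Q∈ R∈ y∈Q (there (pair-right∈ r))
          ... | refl = r
          x∈Q = pair-left∈ xy∈Q
          x∉ : ¬ (x ∈ᵥ 𝒬′)
          x∉ (R , R∈ , r) with same-path d𝒬 Q∈ (𝒬′⊆ R∈) x∈Q r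
          ... | refl = y∉ (Q , R∈ , y∈Q)
      start-used : ∀ {P} → P ∈ L → st P ∈ᵥ L″
      start-used P∈ with ∈-map⁻ st (covered (starts-unique disj)
          (λ q → case ∈-map⁻ st q of λ { (R , R∈ , refl) → starts R∈ })
          (≤-reflexive (trans (length-map st L) (trans (sym size) (sym (length-map st L″))))) (∈-map⁺ st P∈))
      ... | R , R∈ , eq = R , R∈ , subst (_∈ vts R) (sym eq) (st∈ R)
      ab∉L″ : (a , b) ∉ₑ L″
      ab∉L″ (R , R∈ , r) = proj₂ (linked⇒ (uses R∈) r) (refl , refl)
      outside : ∀ {Q} → Q ∈ 𝒬 → (a , b) ∈ eds Q → ¬ (a ∈ᵥ 𝒬′)
      outside {Q} Q∈ q (R , R∈ , r) with same-path d𝒬 Q∈ (𝒬′⊆ R∈) (pair-left∈ q) r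
      ... | refl = ab∉ (Q , R∈ , q)
      contra : ⊥
      contra = case ab∈ , unused ab∈ ab∉L″ of λ ((P , P∈ , p) , (Q , Q∈ , q)) →
        ab∉L″ (leaves P∈ p (outside Q∈ q) (forward P∈ _ _ id (λ _ → start-used P∈) (pair-left∈ p)
          ((Q , Q∈ , pair-left∈ q) , outside Q∈ q)))

  open Linkages public

  -- A path through the bramble and its cells

  module Spine where

    private
      variable
        E : Rel
        K : Pr
        x y : Vertex

    dbl : ℕ → ℕ
    dbl zero    = zero
    dbl (suc i) = suc (suc (dbl i))

    module _ (blk : ℕ → List Vertex) where

      span : ℕ → ℕ → List Vertex
      span a zero    = []
      span a (suc m) = blk a ++ span (suc a) m

    span-cong : ∀ {f g} a b m → (∀ i → f (a + i) ≡ g (b + i)) → span f a m ≡ span g b m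
    span-cong a b zero    h = refl
    span-cong {f} {g} a b (suc m) h = cong₂ _++_
      (trans (sym (cong f (+-identityʳ a))) (trans (h 0) (cong g (+-identityʳ b))))
      (span-cong (suc a) (suc b) m (λ i → trans (cong f (sym (+-suc a i))) (trans (h (suc i)) (cong g (+-suc b i)))))

    allEdges : List VertexEdge
    allEdges = filter (λ e → T? (Digraph.adj G (proj₁ e) (proj₂ e))) (cartesianProduct (allFin n) (allFin n))

    allEdges⇒ : ∀ {u v} → OnList allEdges u v → Edge G u v
    allEdges⇒ e∈ = proj₂ (∈-filter⁻ (λ e → T? (Digraph.adj G (proj₁ e) (proj₂ e))) {xs = cartesianProduct (allFin n) (allFin n)} e∈)

    ⇒allEdges : ∀ {u v} → Edge G u v → OnList allEdges u v
    ⇒allEdges {u} {v} e = ∈-filter⁺ (λ e → T? (Digraph.adj G (proj₁ e) (proj₂ e))) (∈-cartesianProduct⁺ (∈-allFin u) (∈-allFin v)) e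

    after-lastHit : ∀ {S : Pr} → Walk (λ u v → E u v × ¬ S v) K x y → Walk E (λ v → v ≡ x ⊎ (K v × ¬ S v)) x y
    after-lastHit (stop k) = stop (inj₁ refl)
    after-lastHit {E = E} {S = S} (k , e ▸ w) = inj₁ refl , proj₁ e ▸ walk-map (λ _ _ e → e) inj₂ (rest w (proj₂ e))
      where
      rest : ∀ {K x y} → Walk (λ u v → E u v × ¬ S v) K x y → ¬ S x → Walk E (λ v → K v × ¬ S v) x y
      rest (stop k)     ¬s = stop (k , ¬s)
      rest (k , e ▸ w) ¬s = (k , ¬s) , proj₁ e ▸ rest w (proj₂ e)

    linked-join : ∀ {a as xs} → Linked E (a ∷ as) → Linked E (lastOf G a as ∷ xs) → Linked E (a ∷ as ++ xs)
    linked-join [-]     l′ = l′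
    linked-join (e ∷ l) l′ = e ∷ linked-join l l′

    linked-++⁻ : ∀ xs {ys} → Linked E (xs ++ ys) → Linked E xs × Linked E ys
    linked-++⁻ []           l       = [] , l
    linked-++⁻ (x ∷ [])     [-]     = [-] , []
    linked-++⁻ (x ∷ [])     (e ∷ l) = [-] , l
    linked-++⁻ (x ∷ y ∷ xs) (e ∷ l) = let a , b = linked-++⁻ (y ∷ xs) l in e ∷ a , b

    unique-++⁻ : ∀ (xs : List Vertex) {ys} → Unique (xs ++ ys) → Unique xs × Unique ys × (∀ {v} → v ∈ xs → v ∉ ys)
    unique-++⁻ []       u        = [] , u , λ ()
    unique-++⁻ (x ∷ xs) (x∉ ∷ u) = let a , b , d = unique-++⁻ xs u in
      All.tabulate (λ v∈ → All.lookup x∉ (∈-++⁺ˡ v∈)) ∷ a , b ,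
      λ { (here refl) v∈ → All.lookup x∉ (∈-++⁺ʳ xs v∈) refl ; (there v∈) → d v∈ }

    module WithBramble (β : Bramble G) where

      open Bramble β

      Meet : List Vertex → Subset n → Set
      Meet xs B = ∃[ x ] (x ∈ xs × x ∈ₛ B)

      meet? : ∀ xs B → Dec (Meet xs B)
      meet? xs B with Any.any? (λ x → x Subsetₚ.∈? B) xs
      ... | yes a = yes (find a)
      ... | no ¬a = no λ (x , x∈ , x∈B) → ¬a (lose x∈ x∈B)

      -- The first vertex of the path is the only one in some element of the bramble; whenever an element is missed,
      -- the path is extended backwards until it first reaches it.
      record Hitting (bs : List (Subset n)) : Set where
        field
          head   : Vertex
          tail   : List Vertex
          unique : Unique (head ∷ tail)
          linked : Linked (Edge G) (head ∷ tail)
          B      : Subset n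
          B∈     : B ∈ elems
          head∈  : head ∈ₛ B
          tail∉  : ∀ {v} → v ∈ tail → ¬ v ∈ₛ B
          hits   : ∀ {B′} → B′ ∈ bs → Meet (head ∷ tail) B′

      inside-walk : ∀ {B x y} → B ∈ elems → x ∈ₛ B → y ∈ₛ B → Walk (Edge G) (_∈ₛ B) x y
      inside-walk {B} B∈ x∈ y∈ with All.lookup strong B∈ _ _ x∈ y∈
      ... | P , refl , refl , (inside , _) = walk-map (λ _ _ e → e) (All.lookup inside) (pathWalk {P = P} (Path.linked P))

      extend : ∀ {bs B′} → B′ ∈ elems → Hitting bs → Hitting (B′ ∷ bs)
      extend {bs} {B′} B′∈ h with meet? (Hitting.head h ∷ Hitting.tail h) B′
      ... | yes m = record { Hitting h ; hits = λ { (here refl) → m ; (there b∈) → Hitting.hits h b∈ } }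
      ... | no ¬m = built
        where
        open Hitting h
        bridge : ∃[ y ] (y ∈ₛ B′ × Walk (Edge G) (λ v → v ∈ₛ B ⊎ v ∈ₛ B′) y head)
        bridge with touch B′ B B′∈ B∈
        ... | inj₁ (y , y∈′ , y∈) = y , y∈′ , walk-map (λ _ _ e → e) inj₁ (inside-walk B∈ y∈ head∈)
        ... | inj₂ ((w , u , w∈ , u∈ , e) , _) = w , w∈ , (inj₂ w∈ , e ▸ walk-map (λ _ _ e → e) inj₁ (inside-walk B∈ u∈ head∈))
        last-part : ∃[ s ] (s ∈ₛ B′ × Walk (Edge G) (λ v → v ≡ s ⊎ (v ∈ₛ B × ¬ v ∈ₛ B′)) s head)
        last-part with lastHit (Subsetₚ._∈? B′) (proj₂ (proj₂ bridge))
        ... | inj₂ w = ⊥-elim (proj₂ (walk-first w) (proj₁ (proj₂ bridge)))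
        ... | inj₁ (s , s∈ , w) = s , s∈ , walk-map (λ _ _ e → e)
              (λ { (inj₁ eq) → inj₁ eq ; (inj₂ (inj₁ b , ¬b′)) → inj₂ (b , ¬b′) ; (inj₂ (inj₂ b′ , ¬b′)) → ⊥-elim (¬b′ b′) })
              (after-lastHit w)
        s = proj₁ last-part
        s∈ = proj₁ (proj₂ last-part)
        s∉ : s ∉ head ∷ tail
        s∉ q = ¬m (s , q , s∈)
        open InPath (toPath id (proj₂ (proj₂ last-part))) renaming (path to P)
        -- Apart from its first vertex `s`, the extension runs inside `B`, which the old tail
        -- avoids; and `s` lies in `B′`, which the whole old path misses.
        off-tail : ∀ {v} → v ∈ vts P → v ∉ tail
        off-tail v∈ v∈t with inside v∈
        ... | inj₁ refl    = s∉ (there v∈t)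
        ... | inj₂ (b , _) = tail∉ v∈t b
        missed′ : ∀ {v} → v ∈ vts P → v ∈ₛ B′ → v ≡ s
        missed′ v∈ b′ with inside v∈
        ... | inj₁ eq       = eq
        ... | inj₂ (_ , ¬b) = ⊥-elim (¬b b′)
        keep : ∀ {v} → v ∈ head ∷ tail → v ∈ vts P ++ tail
        keep (here refl) = ∈-++⁺ˡ (subst (_∈ vts P) ends (en∈ P))
        keep (there v∈)  = ∈-++⁺ʳ (vts P) v∈
        built : Hitting (B′ ∷ bs)
        built = record
          { head = st P ; tail = Path.rest P ++ tail
          ; unique = AllPairsₚ.++⁺ (Path.unique P) (AllPairs.tail unique)
              (All.tabulate λ v∈ → All.tabulate λ {w} w∈ eq → off-tail v∈ (subst (_∈ tail) (sym eq) w∈))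
          ; linked = linked-join (Path.linked P) (subst (λ z → Linked (Edge G) (z ∷ tail)) (sym ends) linked)
          ; B = B′ ; B∈ = B′∈
          ; head∈ = subst (_∈ₛ B′) (sym starts) s∈
          ; tail∉ = λ v∈ b′ → case ∈-++⁻ (Path.rest P) v∈ of λ
              { (inj₁ q) → All.lookup (AllPairs.head (Path.unique P)) q (trans starts (sym (missed′ (there q) b′)))
              ; (inj₂ q) → ¬m (_ , there q , b′) }
          ; hits = λ { (here refl) → st P , here refl , subst (_∈ₛ B′) (sym starts) s∈
                     ; (there b∈) → let v , v∈ , q = hits b∈ in v , keep v∈ , q } }

      hitting : ∀ bs → (∀ {B} → B ∈ bs → B ∈ elems) → ∀ {B} → B ∈ elems → Hitting bs
      hitting [] _ {B} B∈ = record
        { head = proj₁ ne ; tail = [] ; unique = [] ∷ [] ; linked = [-] ; B = B ; B∈ = B∈ ; head∈ = proj₂ ne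
        ; tail∉ = λ () ; hits = λ () }
        where ne = All.lookup nonempt B∈
      hitting (B′ ∷ bs) sub B∈ = extend (sub (here refl)) (hitting bs (sub ∘ there) B∈)

      -- The bramble elements met by `xs` have order at least `N`. In this form the element missed
      -- by a small separator can be read off directly.
      Rich : ℕ → List Vertex → Set
      Rich N xs = ∀ (S : Subset n) → ∣ S ∣ < N →
        ∃[ B ] (B ∈ elems × (∀ {v} → v ∈ₛ S → ¬ v ∈ₛ B) × Meet xs B)

      Order : List (Subset n) → ℕ → Set
      Order bs m = ∀ (S : Subset n) → (∀ {B} → B ∈ bs → ∃[ v ] (v ∈ₛ S × v ∈ₛ B)) → m ≤ ∣ S ∣

      Cover : List (Subset n) → List Vertex → Subset n → Set
      Cover bs xs S = All (λ B → Meet xs B → ∃[ v ] (v ∈ₛ S × v ∈ₛ B)) bs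

      rich-or-cover : ∀ N bs → (∀ {B} → B ∈ bs → B ∈ elems) → ∀ xs → Rich N xs ⊎ (∃[ S ] (∣ S ∣ < N × Cover bs xs S))
      rich-or-cover N bs bs⊆ xs
        with Subsetₚ.anySubset? (λ S → (∣ S ∣ <? N) ×-dec All.all? (cover? S) bs)
        where
        common? : ∀ (S B : Subset n) → Dec (∃[ v ] (v ∈ₛ S × v ∈ₛ B))
        common? S B = Finₚ.any? (λ v → (v Subsetₚ.∈? S) ×-dec (v Subsetₚ.∈? B))
        cover? : ∀ S B → Dec (Meet xs B → ∃[ v ] (v ∈ₛ S × v ∈ₛ B))
        cover? S B = meet? xs B →-dec common? S B
      ... | yes (S , lt , cov) = inj₂ (S , lt , cov)
      ... | no none = inj₁ λ S lt → rich S lt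
        where
        common? : ∀ (S B : Subset n) → Dec (∃[ v ] (v ∈ₛ S × v ∈ₛ B))
        common? S B = Finₚ.any? (λ v → (v Subsetₚ.∈? S) ×-dec (v Subsetₚ.∈? B))
        search : ∀ S cs → (∀ {B} → B ∈ cs → B ∈ elems) → Cover cs xs S ⊎ (∃[ B ] (B ∈ elems × (∀ {v} → v ∈ₛ S → ¬ v ∈ₛ B) × Meet xs B))
        search S [] _ = inj₁ []
        search S (B ∷ cs) cs⊆ with search S cs (cs⊆ ∘ there) | meet? xs B | common? S B
        ... | inj₂ r | _ | _ = inj₂ r
        ... | inj₁ cov | no ¬m | _ = inj₁ ((⊥-elim ∘ ¬m) ∷ cov)
        ... | inj₁ cov | yes _ | yes q = inj₁ ((λ _ → q) ∷ cov)
        ... | inj₁ _ | yes m | no ¬q = inj₂ (B , cs⊆ (here refl) , (λ v∈ v∈B → ¬q (_ , v∈ , v∈B)) , m)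
        rich : ∀ S → ∣ S ∣ < N → ∃[ B ] (B ∈ elems × (∀ {v} → v ∈ₛ S → ¬ v ∈ₛ B) × Meet xs B)
        rich S lt with search S bs bs⊆
        ... | inj₂ r = r
        ... | inj₁ cov = ⊥-elim (none (S , lt , cov))

      -- A shortest rich prefix is covered by at most N vertices.
      scan : ∀ N bs → (∀ {B} → B ∈ bs → B ∈ elems) → Order bs (suc N) → ∀ xs → (∀ {B} → B ∈ bs → Meet xs B) →
        ∀ pre post → pre ++ post ≡ xs → (∃[ S ] (∣ S ∣ < N × Cover bs pre S)) →
        ∃[ ρ ] ∃[ z ] ∃[ rest ] ∃[ S ] (ρ ++ z ∷ rest ≡ xs × Rich N ρ × ∣ S ∣ ≤ N × Cover bs ρ S)
      scan N bs bs⊆ ord xs hit pre [] eq (S , lt , cov) = ⊥-elim (<⇒≱ (m<n⇒m<1+n lt)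
        (ord S λ b∈ → All.lookup cov b∈ (subst (λ z → Meet z _) (trans (sym eq) (Listₚ.++-identityʳ pre)) (hit b∈))))
      scan N bs bs⊆ ord xs hit pre (y ∷ post) eq (S , lt , cov) with rich-or-cover N bs bs⊆ (pre ++ y ∷ [])
      ... | inj₂ c = scan N bs bs⊆ ord xs hit (pre ++ y ∷ []) post (trans (Listₚ.++-assoc pre (y ∷ []) post) eq) c
      ... | inj₁ rich = finish post (trans (Listₚ.++-assoc pre (y ∷ []) post) eq)
        where
        S′ = ⁅ y ⁆ ∪ₛ S
        cov′ : Cover bs (pre ++ y ∷ []) S′
        cov′ = All.map (λ f (v , v∈ , v∈B) → case ∈-++⁻ pre v∈ of λ
          { (inj₁ q) → let w , w∈ , r = f (v , q , v∈B) in w , Subsetₚ.x∈p∪q⁺ {p = ⁅ y ⁆} (inj₂ w∈) , r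
          ; (inj₂ (here refl)) → y , Subsetₚ.x∈p∪q⁺ (inj₁ (Subsetₚ.x∈⁅x⁆ y)) , v∈B }) cov
        size′ : ∣ S′ ∣ ≤ N
        size′ = ≤-trans (∣⁅⁆∪∣≤ y S) lt
        finish : ∀ post → (pre ++ y ∷ []) ++ post ≡ xs →
          ∃[ ρ ] ∃[ z ] ∃[ rest ] ∃[ S ] (ρ ++ z ∷ rest ≡ xs × Rich N ρ × ∣ S ∣ ≤ N × Cover bs ρ S)
        finish [] eq = ⊥-elim (<⇒≱ (s≤s size′)
          (ord S′ λ b∈ → All.lookup cov′ b∈ (subst (λ z → Meet z _) (trans (sym eq) (Listₚ.++-identityʳ _)) (hit b∈))))
        finish (z ∷ rest) eq = pre ++ y ∷ [] , z , rest , S′ , eq , rich , size′ , cov′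

      record Cells (N t : ℕ) (xs : List Vertex) : Set where
        field
          blk     : ℕ → List Vertex
          stn     : ℕ → Vertex
          rest    : List Vertex
          whole   : span blk 0 (dbl t) ++ rest ≡ xs
          rich    : ∀ {i} → i < t → Rich N (blk (dbl i))
          station : ∀ {i} → i < t → blk (suc (dbl i)) ≡ stn i ∷ []

      -- Each round costs `suc N` of the order: at most `N` vertices cover the elements met by the
      -- new cell, and one more is the station. The elements met by neither keep the remaining order
      -- and are all met by the rest of the path.
      cells : ∀ N → 1 ≤ N → ∀ t bs → (∀ {B} → B ∈ bs → B ∈ elems) → Order bs (t * suc N) →
        ∀ xs → (∀ {B} → B ∈ bs → Meet xs B) → Vertex → Cells N t xs
      cells N 1≤N zero bs bs⊆ ord xs hit v = record
        { blk = λ _ → [] ; stn = λ _ → v ; rest = xs ; whole = refl ; rich = λ () ; station = λ () }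
      cells N 1≤N (suc t) bs bs⊆ ord xs hit v
        with scan N bs bs⊆ (λ S cov → ≤-trans (m≤m+n (suc N) (t * suc N)) (ord S cov)) xs hit [] xs refl
               (⊥ₛ , subst (_< N) (sym (Subsetₚ.∣⊥∣≡0 n)) 1≤N , All.tabulate (λ _ → λ ()))
      ... | ρ , z , rest , S , eq , rich , size , cov = record
        { blk = blk′ ; stn = λ { zero → z ; (suc i) → C.stn i } ; rest = C.rest
        ; whole = trans (Listₚ.++-assoc ρ (z ∷ span blk′ 2 (dbl t)) C.rest)
            (trans (cong (λ w → ρ ++ z ∷ w) (trans (cong (_++ C.rest) (span-cong {blk′} {C.blk} 2 0 (dbl t) (λ i → refl))) C.whole)) eq)
        ; rich = λ { {zero} _ → rich ; {suc i} (s≤s i<) → C.rich i< }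
        ; station = λ { {zero} _ → refl ; {suc i} (s≤s i<) → C.station i< } }
        where
        Left : Subset n → Set
        Left B = ¬ Meet ρ B × ¬ z ∈ₛ B
        left? : Decidable Left
        left? B = ¬? (meet? ρ B) ×-dec ¬? (z Subsetₚ.∈? B)
        bs′ = filter left? bs
        ord′ : Order bs′ (t * suc N)
        ord′ S′ cov′ = +-cancelˡ-≤ (suc N) _ _ (≤-trans (ord U covers) (≤-trans (∣⁅⁆∪∣≤ z (S ∪ₛ S′))
          (s≤s (≤-trans (∣∪∣≤ S S′) (+-monoˡ-≤ ∣ S′ ∣ size)))))
          where
          U = ⁅ z ⁆ ∪ₛ (S ∪ₛ S′)
          covers : ∀ {B} → B ∈ bs → ∃[ v ] (v ∈ₛ U × v ∈ₛ B)
          covers {B} B∈ with z Subsetₚ.∈? B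
          ... | yes z∈ = z , Subsetₚ.x∈p∪q⁺ (inj₁ (Subsetₚ.x∈⁅x⁆ z)) , z∈
          ... | no z∉ with meet? ρ B
          ... | yes m = let v , v∈ , q = All.lookup cov B∈ m in
                  v , Subsetₚ.x∈p∪q⁺ {p = ⁅ z ⁆} (inj₂ (Subsetₚ.x∈p∪q⁺ (inj₁ v∈))) , q
          ... | no ¬m = let v , v∈ , q = cov′ (∈-filter⁺ left? B∈ (¬m , z∉)) in
                  v , Subsetₚ.x∈p∪q⁺ {p = ⁅ z ⁆} (inj₂ (Subsetₚ.x∈p∪q⁺ {p = S} (inj₂ v∈))) , q
        hit′ : ∀ {B} → B ∈ bs′ → Meet rest B
        hit′ {B} B∈ with ∈-filter⁻ left? {xs = bs} B∈
        ... | B∈bs , ¬m , z∉ with subst (λ w → Meet w B) (sym eq) (hit B∈bs)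
        ... | v , v∈ , v∈B with ∈-++⁻ ρ v∈
        ... | inj₁ q = ⊥-elim (¬m (v , q , v∈B))
        ... | inj₂ (here refl) = ⊥-elim (z∉ v∈B)
        ... | inj₂ (there q) = v , q , v∈B
        module C = Cells (cells N 1≤N t bs′ (λ B∈ → bs⊆ (proj₁ (∈-filter⁻ left? {xs = bs} B∈))) ord′ rest hit′ v)
        blk′ : ℕ → List Vertex
        blk′ zero          = ρ
        blk′ (suc zero)    = z ∷ []
        blk′ (suc (suc i)) = C.blk i

  open Spine public

  -- The backbone: segments, well linked stations, linkages between cells

  module Backbones where

    sdbl : ℕ → ℕ
    sdbl i = suc (dbl i)

    dbl-mono : ∀ {a b} → a ≤ b → dbl a ≤ dbl b
    dbl-mono z≤n     = z≤n
    dbl-mono (s≤s h) = s≤s (s≤s (dbl-mono h))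

    dbl-injective : ∀ {a b} → dbl a ≡ dbl b → a ≡ b
    dbl-injective {zero}  {zero}  _ = refl
    dbl-injective {suc a} {suc b} e = cong suc (dbl-injective (suc-injective (suc-injective e)))

    dbl≢sdbl : ∀ a b → dbl a ≢ sdbl b
    dbl≢sdbl (suc a) zero    ()
    dbl≢sdbl (suc a) (suc b) e = dbl≢sdbl a b (suc-injective (suc-injective e))

    -- Coordinates along a path: cells at even positions 0, …, 2K, stations at odd positions.
    record Backbone (K n₀ : ℕ) : Set where
      field
        blk        : ℕ → List Vertex
      Co : ℕ → Vertex → Set
      Co κ v = v ∈ blk κ
      field
        Co-unique  : ∀ {κ κ′ v} → κ ≤ dbl K → κ′ ≤ dbl K → Co κ v → Co κ′ v → κ ≡ κ′
        stn        : ℕ → Vertex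
        stn-Co     : ∀ {i} → i < K → Co (sdbl i) (stn i)
        seg        : ℕ → ℕ → Pth
        seg-st     : ∀ {a b} → a ≤ b → b < K → st (seg a b) ≡ stn a
        seg-en     : ∀ {a b} → a ≤ b → b < K → en (seg a b) ≡ stn b
        seg-∈⁻     : ∀ {a b v} → a ≤ b → b < K → v ∈ vts (seg a b) → ∃[ κ ] (sdbl a ≤ κ × κ ≤ sdbl b × Co κ v)
        seg-∈⁺     : ∀ {a b v κ} → a ≤ b → b < K → sdbl a ≤ κ → κ ≤ sdbl b → Co κ v → v ∈ vts (seg a b)
        A          : Subset n
        stn∈A      : ∀ {i} → i < K → stn i ∈ₛ A
        wellLinked : WellLinked G A
        join       : ∀ {i j} → i ≤ K → j ≤ K → i ≢ j → ∃[ L ] (Linkage L × length L ≡ n₀ ×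
                       (∀ {P} → P ∈ L → Co (dbl i) (st P)) × (∀ {P} → P ∈ L → Co (dbl j) (en P)))

    module _ (blk : ℕ → List Vertex) where

      ∈-span⁻ : ∀ a m {v} → v ∈ span blk a m → ∃[ κ ] (a ≤ κ × κ < a + m × v ∈ blk κ)
      ∈-span⁻ a (suc m) v∈ with ∈-++⁻ (blk a) v∈
      ... | inj₁ q = a , ≤-refl , m<m+n a (s≤s z≤n) , q
      ... | inj₂ q = let κ , le , lt , r = ∈-span⁻ (suc a) m q in
              κ , <⇒≤ le , ≤-trans lt (≤-reflexive (sym (+-suc a m))) , r

      ∈-span⁺ : ∀ a m {κ v} → a ≤ κ → κ < a + m → v ∈ blk κ → v ∈ span blk a m
      ∈-span⁺ a zero    a≤ κ< v∈ = ⊥-elim (<⇒≱ (≤-trans κ< (≤-reflexive (+-identityʳ a))) a≤)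
      ∈-span⁺ a (suc m) a≤ κ< v∈ with m≤n⇒m<n∨m≡n a≤
      ... | inj₁ lt   = ∈-++⁺ʳ (blk a) (∈-span⁺ (suc a) m lt (≤-trans κ< (≤-reflexive (+-suc a m))) v∈)
      ... | inj₂ refl = ∈-++⁺ˡ v∈

      span-++ : ∀ a m k → span blk a (m + k) ≡ span blk a m ++ span blk (a + m) k
      span-++ a zero    k = cong (λ z → span blk z k) (sym (+-identityʳ a))
      span-++ a (suc m) k = trans (cong (blk a ++_) (trans (span-++ (suc a) m k) (cong (λ z → span blk (suc a) m ++ span blk z k) (sym (+-suc a m)))))
        (sym (Listₚ.++-assoc (blk a) (span blk (suc a) m) _))

      span-part : ∀ {M} a m → a + m ≤ M → span blk 0 M ≡ span blk 0 a ++ (span blk a m ++ span blk (a + m) (M ∸ (a + m)))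
      span-part {M} a m le = trans (cong (span blk 0) (sym (trans (sym (+-assoc a m _)) (m+[n∸m]≡n le))))
        (trans (span-++ 0 a _) (cong (span blk 0 a ++_) (span-++ a m _)))

      span-unique : ∀ {M} → Unique (span blk 0 M) → ∀ a m → a + m ≤ M → Unique (span blk a m)
      span-unique u a m le = proj₁ (unique-++⁻ (span blk a m) (proj₁ (proj₂ (unique-++⁻ (span blk 0 a) (subst Unique (span-part a m le) u)))))

      span-linked : ∀ {E : Rel} {M} → Linked E (span blk 0 M) → ∀ a m → a + m ≤ M → Linked E (span blk a m)
      span-linked l a m le = proj₁ (linked-++⁻ (span blk a m) (proj₂ (linked-++⁻ (span blk 0 a) (subst (Linked _) (span-part a m le) l))))

      span-disjoint : ∀ a m → Unique (span blk a m) → ∀ {κ κ′ v} → a ≤ κ → κ < κ′ → κ′ < a + m → v ∈ blk κ → v ∉ blk κ′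
      span-disjoint a zero    u a≤ κ< κ′< v∈ v∈′ = <⇒≱ (≤-trans κ′< (≤-reflexive (+-identityʳ a))) (≤-trans a≤ (<⇒≤ κ<))
      span-disjoint a (suc m) u a≤ κ< κ′< v∈ v∈′ with m≤n⇒m<n∨m≡n a≤ | unique-++⁻ (blk a) u
      ... | inj₁ lt   | _ , u′ , _ = span-disjoint (suc a) m u′ lt κ< (≤-trans κ′< (≤-reflexive (+-suc a m))) v∈ v∈′
      ... | inj₂ refl | _ , _ , d = d v∈ (∈-span⁺ (suc a) m κ< (≤-trans κ′< (≤-reflexive (+-suc a m))) v∈′)

    walkTo : ∀ {E : Rel} {a as v} → Linked E (a ∷ as) → v ∈ a ∷ as → Walk E (_∈ a ∷ as) a v
    walkTo l       (here refl) = stop (here refl)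
    walkTo (e ∷ l) (there v∈)  = here refl , e ▸ walk-map (λ _ _ e → e) there (walkTo l v∈)

    walkFrom : ∀ {E : Rel} as {z v} → Linked E (as ++ z ∷ []) → v ∈ as → Walk E (_∈ as ++ z ∷ []) v z
    walkFrom (a ∷ as) {z} l (there v∈) = walk-map (λ _ _ e → e) there (walkFrom as (tail l) v∈)
      where
      tail : ∀ {E : Rel} {x xs} → Linked E (x ∷ xs) → Linked E xs
      tail [-]     = []
      tail (_ ∷ l) = l
    walkFrom (a ∷ [])     (e ∷ l) (here refl) = here refl , e ▸ stop (there (here refl))
    walkFrom (a ∷ b ∷ as) (e ∷ l) (here refl) = here refl , e ▸ walk-map (λ _ _ e → e) there (walkFrom (b ∷ as) l (here refl))

    lastOf-snoc : ∀ x xs z → lastOf G x (xs ++ z ∷ []) ≡ z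
    lastOf-snoc x []       z = refl
    lastOf-snoc x (y ∷ xs) z = lastOf-snoc y xs z

    elements : Subset n → List Vertex
    elements X = filter (Subsetₚ._∈? X) (allFin n)

    ∈-elements⁺ : ∀ {X x} → x ∈ₛ X → x ∈ elements X
    ∈-elements⁺ {X} x∈ = ∈-filter⁺ (Subsetₚ._∈? X) (∈-allFin _) x∈

    ∈-elements⁻ : ∀ {X x} → x ∈ elements X → x ∈ₛ X
    ∈-elements⁻ {X} x∈ = proj₂ (∈-filter⁻ (Subsetₚ._∈? X) {xs = allFin n} x∈)

    -- `suc K` cells give each of the stations below `K` a cell on either side, as the proof of
    -- `wellLinked` requires. The bound `N` controls both the number of stations and the order of
    -- the linkages between cells.
    module Build (β : Bramble G) (N K n₀ : ℕ) (K≤N : K ≤ N) (n₀≤N : n₀ ≤ N)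
                 {head : Vertex} {tail : List Vertex} (unique : Unique (head ∷ tail)) (linked : Linked (Edge G) (head ∷ tail))
                 (cs : WithBramble.Cells β N (suc K) (head ∷ tail)) where

      open WithBramble β
      open Bramble β
      open Cells cs

      M = dbl (suc K)

      uniqueM : Unique (span blk 0 M)
      uniqueM = proj₁ (unique-++⁻ (span blk 0 M) (subst Unique (sym whole) unique))

      linkedM : Linked (Edge G) (span blk 0 M)
      linkedM = proj₁ (linked-++⁻ (span blk 0 M) (subst (Linked (Edge G)) (sym whole) linked))

      Co-unique : ∀ {κ κ′ v} → κ < M → κ′ < M → v ∈ blk κ → v ∈ blk κ′ → κ ≡ κ′
      Co-unique {κ} {κ′} κ< κ′< v∈ v∈′ with <-cmp κ κ′
      ... | tri< lt _ _ = ⊥-elim (span-disjoint blk 0 M uniqueM z≤n lt κ′< v∈ v∈′)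
      ... | tri≈ _ eq _ = eq
      ... | tri> _ _ gt = ⊥-elim (span-disjoint blk 0 M uniqueM z≤n gt κ< v∈′ v∈)

      stn-Co : ∀ {i} → i < K → stn i ∈ blk (sdbl i)
      stn-Co i< = subst (_ ∈_) (sym (station (m<n⇒m<1+n i<))) (here refl)

      segVertices : ∀ {a b} → a ≤ b → b < K → stn a ∷ span blk (suc (sdbl a)) (dbl b ∸ dbl a) ≡ span blk (sdbl a) (suc (dbl b ∸ dbl a))
      segVertices {a} {b} a≤b b<K = cong (_++ span blk (suc (sdbl a)) (dbl b ∸ dbl a)) (sym (station (m<n⇒m<1+n (≤-<-trans a≤b b<K))))

      inRange : ∀ {a b} → a ≤ b → b < K → sdbl a + suc (dbl b ∸ dbl a) ≤ M
      inRange {a} {b} a≤b b<K = ≤-trans (≤-reflexive (trans (+-suc (sdbl a) _) (cong (λ z → suc (suc z)) (m+[n∸m]≡n (dbl-mono a≤b)))))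
        (≤-trans (dbl-mono {suc b} {K} b<K) (≤-trans (n≤1+n _) (n≤1+n _)))

      segPath : ∀ {a b} → a ≤ b → b < K → Pth
      segPath {a} {b} a≤b b<K = record
        { first = stn a ; rest = span blk (suc (sdbl a)) (dbl b ∸ dbl a)
        ; unique = subst Unique (sym (segVertices a≤b b<K)) (span-unique blk uniqueM _ _ (inRange a≤b b<K))
        ; linked = subst (Linked (Edge G)) (sym (segVertices a≤b b<K)) (span-linked blk linkedM _ _ (inRange a≤b b<K)) }

      seg : ℕ → ℕ → Pth
      seg a b with a ≤? b | b <? K
      ... | yes a≤b | yes b<K = segPath a≤b b<K
      -- Default value outside the range `a ≤ b < K`.
      ... | _       | _       = record { first = head ; rest = [] ; unique = [] ∷ [] ; linked = [-] }

      seg-vts : ∀ {a b} → a ≤ b → b < K → vts (seg a b) ≡ span blk (sdbl a) (suc (dbl b ∸ dbl a))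
      seg-vts {a} {b} a≤b b<K with a ≤? b | b <? K
      ... | yes a≤b′ | yes b<K′ = segVertices a≤b′ b<K′
      ... | no ¬p | _ = ⊥-elim (¬p a≤b)
      ... | yes _ | no ¬q = ⊥-elim (¬q b<K)

      seg-st : ∀ {a b} → a ≤ b → b < K → st (seg a b) ≡ stn a
      seg-st {a} {b} a≤b b<K with a ≤? b | b <? K
      ... | yes _ | yes _ = refl
      ... | no ¬p | _ = ⊥-elim (¬p a≤b)
      ... | yes _ | no ¬q = ⊥-elim (¬q b<K)

      last-span : ∀ x a m {z} → blk (a + m) ≡ z ∷ [] → lastOf G x (span blk a (suc m)) ≡ z
      last-span x a m {z} eq = trans (cong (lastOf G x) (trans (cong (span blk a) (sym (+-comm m 1)))
        (trans (span-++ blk a m 1) (cong (span blk a m ++_) (trans (Listₚ.++-identityʳ _) eq))))) (lastOf-snoc x (span blk a m) z)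

      seg-en : ∀ {a b} → a ≤ b → b < K → en (seg a b) ≡ stn b
      seg-en {a} {b} a≤b b<K with a ≤? b | b <? K
      ... | no ¬p | _ = ⊥-elim (¬p a≤b)
      ... | yes _ | no ¬q = ⊥-elim (¬q b<K)
      ... | yes _ | yes _ with m≤n⇒m<n∨m≡n a≤b
      ... | inj₂ refl = cong (λ z → lastOf G (stn a) (span blk (suc (sdbl a)) z)) (n∸n≡0 (dbl a))
      ... | inj₁ a<b = trans (cong (λ z → lastOf G (stn a) (span blk (suc (sdbl a)) z)) eq)
          (last-span (stn a) (suc (sdbl a)) d (trans (cong blk eq′) (station (m<n⇒m<1+n b<K))))
        where
        d = ℕ.pred (dbl b ∸ dbl a)
        pos : dbl a < dbl b
        pos = ≤-trans (n≤1+n _) (dbl-mono a<b)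
        eq : dbl b ∸ dbl a ≡ suc d
        eq = sym (suc-pred (dbl b ∸ dbl a) {{ℕ.>-nonZero (m<n⇒0<n∸m pos)}})
        eq′ : suc (sdbl a) + d ≡ sdbl b
        eq′ = cong suc (trans (sym (+-suc (dbl a) d)) (trans (cong (dbl a +_) (sym eq)) (m+[n∸m]≡n (<⇒≤ pos))))

      seg-end : ∀ {a b} → a ≤ b → sdbl a + suc (dbl b ∸ dbl a) ≡ suc (sdbl b)
      seg-end {a} a≤b = trans (+-suc (sdbl a) _) (cong (λ z → suc (suc z)) (m+[n∸m]≡n (dbl-mono a≤b)))

      seg-∈⁻ : ∀ {a b v} → a ≤ b → b < K → v ∈ vts (seg a b) → ∃[ κ ] (sdbl a ≤ κ × κ ≤ sdbl b × v ∈ blk κ)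
      seg-∈⁻ {a} {b} a≤b b<K v∈ with ∈-span⁻ blk (sdbl a) (suc (dbl b ∸ dbl a)) (subst (_ ∈_) (seg-vts a≤b b<K) v∈)
      ... | κ , le , lt , q = κ , le , s≤s⁻¹ (≤-trans lt (≤-reflexive (seg-end a≤b))) , q

      seg-∈⁺ : ∀ {a b v κ} → a ≤ b → b < K → sdbl a ≤ κ → κ ≤ sdbl b → v ∈ blk κ → v ∈ vts (seg a b)
      seg-∈⁺ {a} {b} a≤b b<K le le′ v∈ = subst (_ ∈_) (sym (seg-vts a≤b b<K))
        (∈-span⁺ blk (sdbl a) _ le (≤-trans (s≤s le′) (≤-reflexive (sym (seg-end a≤b)))) v∈)

      A : Subset n
      A = toSubset (map stn (upTo K))

      stn∈A : ∀ {i} → i < K → stn i ∈ₛ A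
      stn∈A i< = ∈-toSubset⁺ (∈-map⁺ stn (∈-upTo⁺ i<))

      rich′ : ∀ {i S} → i ≤ K → length S < N → ∃[ B ] (B ∈ elems × (∀ {v} → v ∈ₛ B → v ∉ S) × Meet (blk (dbl i)) B)
      rich′ {i} {S} i≤K lt with rich (s≤s i≤K) (toSubset S) (≤-<-trans (∣toSubset∣≤ S) lt)
      ... | B , B∈ , off , m = B , B∈ , (λ v∈B v∈S → off (∈-toSubset⁺ v∈S) v∈B) , m

      bramble-walk : ∀ {S B B′ x y} → B ∈ elems → B′ ∈ elems → (∀ {v} → v ∈ₛ B → v ∉ S) → (∀ {v} → v ∈ₛ B′ → v ∉ S) →
        x ∈ₛ B → y ∈ₛ B′ → Walk (Edge G) (_∉ S) x y
      bramble-walk {S} {B} {B′} B∈ B′∈ off off′ x∈ y∈ with touch B B′ B∈ B′∈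
      ... | inj₁ (w , w∈ , w∈′) = walk-map (λ _ _ e → e) off (inside-walk B∈ x∈ w∈) ⧺ walk-map (λ _ _ e → e) off′ (inside-walk B′∈ w∈′ y∈)
      ... | inj₂ ((u , w , u∈ , w∈ , e) , _) = walk-map (λ _ _ e → e) off (inside-walk B∈ x∈ u∈) ⧺
              (off u∈ , e ▸ walk-map (λ _ _ e → e) off′ (inside-walk B′∈ w∈ y∈))

      toList : ∀ {S x y} → Walk (Edge G) (_∉ S) x y → Walk (OnList allEdges) (_∉ S) x y
      toList = walk-map (λ _ _ → ⇒allEdges) id

      -- A separator of fewer than `N` vertices misses a bramble element at each of the two cells,
      -- and these elements touch. Paths are nontrivial because different cells are disjoint.
      join : ∀ {i j} → i ≤ K → j ≤ K → i ≢ j → ∃[ L ] (Linkage L × length L ≡ n₀ ×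
        (∀ {P} → P ∈ L → st P ∈ blk (dbl i)) × (∀ {P} → P ∈ L → en P ∈ blk (dbl j)))
      join {i} {j} i≤K j≤K i≢j with menger allEdges allEdges⇒ (blk (dbl i)) (blk (dbl j)) n₀
      ... | inj₁ l = Link.paths l , record { disj = Link.disj l ; nontriv = λ P∈ eq →
              i≢j (dbl-injective (Co-unique (<M i≤K) (<M j≤K) (Link.starts l P∈) (subst (_∈ _) (sym eq) (Link.ends l P∈)))) } ,
              Link.size l , Link.starts l , Link.ends l
        where
        <M : ∀ {i} → i ≤ K → dbl i < M
        <M i≤ = s≤s (≤-trans (dbl-mono i≤) (n≤1+n _))
      ... | inj₂ (S , lt , sep) with rich′ i≤K (<-≤-trans lt n₀≤N) | rich′ j≤K (<-≤-trans lt n₀≤N)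
      ... | B , B∈ , off , (x , x∈ , x∈B) | B′ , B′∈ , off′ , (y , y∈ , y∈B′) =
              ⊥-elim (sep x∈ y∈ (toList (bramble-walk B∈ B′∈ off off′ x∈B y∈B′)))

      -- The backbone leads from a station into the cell after it, and from the cell before it to
      -- the station. Among the out-sets, as among the in-sets, those of different stations are
      -- disjoint, so that `misses-one` applies to them.
      OutSet InSet : ℕ → List Vertex
      OutSet i = stn i ∷ blk (dbl (suc i))
      InSet i  = blk (dbl i) ++ stn i ∷ []

      private
        toStation : ∀ {i v} → i < K → v ≡ stn i → v ∈ blk (sdbl i)
        toStation i< refl = stn-Co i<

        bound : ∀ {i} → i < K → suc (sdbl i) < M
        bound i< = s≤s (≤-trans (dbl-mono i<) (n≤1+n _))

      outDisjoint : ∀ {i j} → i < K → j < K → i ≢ j → ∀ v → v ∈ OutSet i → v ∈ OutSet j → ⊥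
      outDisjoint {i} {j} i< j< i≢j v (here e) (here e′) =
        i≢j (dbl-injective (suc-injective (Co-unique (<⇒≤ (bound i<)) (<⇒≤ (bound j<)) (toStation i< e) (toStation j< e′))))
      outDisjoint {i} {j} i< j< i≢j v (here e) (there q) =
        dbl≢sdbl (suc j) i (sym (Co-unique (<⇒≤ (bound i<)) (bound j<) (toStation i< e) q))
      outDisjoint {i} {j} i< j< i≢j v (there q) (here e′) =
        dbl≢sdbl (suc i) j (Co-unique (bound i<) (<⇒≤ (bound j<)) q (toStation j< e′))
      outDisjoint {i} {j} i< j< i≢j v (there q) (there r) =
        i≢j (suc-injective (dbl-injective {suc i} {suc j} (Co-unique (bound i<) (bound j<) q r)))

      inDisjoint : ∀ {i j} → i < K → j < K → i ≢ j → ∀ v → v ∈ InSet i → v ∈ InSet j → ⊥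
      inDisjoint {i} {j} i< j< i≢j v v∈ v∈′ with ∈-++⁻ (blk (dbl i)) v∈ | ∈-++⁻ (blk (dbl j)) v∈′
      ... | inj₁ q | inj₁ r = i≢j (dbl-injective (Co-unique (<⇒≤ (<⇒≤ (bound i<))) (<⇒≤ (<⇒≤ (bound j<))) q r))
      ... | inj₁ q | inj₂ (here e) = dbl≢sdbl i j (Co-unique (<⇒≤ (<⇒≤ (bound i<))) (<⇒≤ (bound j<)) q (toStation j< e))
      ... | inj₂ (here e) | inj₁ r = dbl≢sdbl j i (Co-unique (<⇒≤ (<⇒≤ (bound j<))) (<⇒≤ (bound i<)) r (toStation i< e))
      ... | inj₂ (here e) | inj₂ (here e′) =
        i≢j (dbl-injective (suc-injective (Co-unique (<⇒≤ (bound i<)) (<⇒≤ (bound j<)) (toStation i< e) (toStation j< e′))))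

      -- A set of stations larger than S contains one whose adjacent cell avoids S.
      free-station : ∀ (W : ℕ → List Vertex) → (∀ {i j} → i < K → j < K → i ≢ j → ∀ v → v ∈ W i → v ∈ W j → ⊥) →
        ∀ {X : Subset n} → (∀ {x} → x ∈ₛ X → x ∈ₛ A) → ∀ S → length S < ∣ X ∣ →
        ∃[ i ] (i < K × stn i ∈ₛ X × (∀ {v} → v ∈ W i → v ∉ S))
      free-station W W-disjoint {X} X⊆A S lt with misses-one W S is
          (AllPairs-map∈ (λ i∈ j∈ → W-disjoint (proj₁ (is⁻ i∈)) (proj₁ (is⁻ j∈))) (Uniqueₚ.filter⁺ in? (Uniqueₚ.upTo⁺ K)))
          (<-≤-trans lt (≤-trans (Subsetₚ.p⊆q⇒∣p∣≤∣q∣ X⊆) (≤-trans (∣toSubset∣≤ (map stn is)) (≤-reflexive (length-map stn is)))))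
        where
        in? : Decidable (λ i → stn i ∈ₛ X)
        in? i = stn i Subsetₚ.∈? X
        is = filter in? (upTo K)
        is⁻ : ∀ {i} → i ∈ is → i < K × stn i ∈ₛ X
        is⁻ i∈ = let a , b = ∈-filter⁻ in? {xs = upTo K} i∈ in ∈-upTo⁻ a , b
        X⊆ : ∀ {x} → x ∈ₛ X → x ∈ₛ toSubset (map stn is)
        X⊆ x∈ with ∈-map⁻ stn (∈-toSubset⁻ (map stn (upTo K)) (X⊆A x∈))
        ... | i , i∈ , refl = ∈-toSubset⁺ (∈-map⁺ stn (∈-filter⁺ in? i∈ x∈))
      ... | i , i∈ , off = let a , b = ∈-filter⁻ (λ i → stn i Subsetₚ.∈? X) {xs = upTo K} i∈ in i , ∈-upTo⁻ a , b , off

      out-walk : ∀ {i x} → i < K → x ∈ blk (dbl (suc i)) → Walk (Edge G) (_∈ OutSet i) (stn i) x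
      out-walk {i} i< x∈ = walkTo (subst (Linked (Edge G)) eq (span-linked blk linkedM (sdbl i) 2 (≤-trans (≤-reflexive (+-comm (sdbl i) 2)) (bound i<)))) (there x∈)
        where
        eq : span blk (sdbl i) 2 ≡ OutSet i
        eq = trans (cong (_++ span blk (suc (sdbl i)) 1) (station (m<n⇒m<1+n i<))) (cong (stn i ∷_) (Listₚ.++-identityʳ _))

      in-walk : ∀ {i x} → i < K → x ∈ blk (dbl i) → Walk (Edge G) (_∈ InSet i) x (stn i)
      in-walk {i} i< x∈ = walkFrom (blk (dbl i)) (subst (Linked (Edge G)) eq (span-linked blk linkedM (dbl i) 2 (≤-trans (≤-reflexive (+-comm (dbl i) 2)) (<⇒≤ (bound i<))))) x∈
        where
        eq : span blk (dbl i) 2 ≡ InSet i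
        eq = cong (blk (dbl i) ++_) (trans (Listₚ.++-identityʳ _) (station (m<n⇒m<1+n i<)))

      -- A separator smaller than `X` and `Y` misses the out-set of a station of `X` and the in-set
      -- of a station of `Y`. Being smaller than `N` too, it misses bramble elements meeting the two
      -- adjacent cells, and these connect the stations.
      wellLinked : WellLinked G A
      wellLinked X Y X⊆ Y⊆ eq with menger allEdges allEdges⇒ (elements X) (elements Y) ∣ X ∣
      ... | inj₁ l = Link.paths l , Link.disj l , Link.size l ,
              All.tabulate (λ P∈ → ∈-elements⁻ (Link.starts l P∈) , ∈-elements⁻ (Link.ends l P∈))
      ... | inj₂ (S , lt , sep)
        with free-station OutSet outDisjoint X⊆ S lt | free-station InSet inDisjoint Y⊆ S (subst (length S <_) eq lt)
      ... | i , i< , i∈X , offᵢ | j , j< , j∈Y , offⱼ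
        with rich′ i< (<-≤-trans lt (X≤N X⊆)) | rich′ (<⇒≤ j<) (<-≤-trans lt (X≤N X⊆))
        where
        X≤N : ∀ {X : Subset n} → (∀ {x} → x ∈ₛ X → x ∈ₛ A) → ∣ X ∣ ≤ N
        X≤N X⊆ = ≤-trans (Subsetₚ.p⊆q⇒∣p∣≤∣q∣ X⊆) (≤-trans (∣toSubset∣≤ (map stn (upTo K)))
          (≤-trans (≤-reflexive (trans (length-map stn (upTo K)) (Listₚ.length-upTo K))) K≤N))
      ... | B , B∈ , off , (x , x∈ , x∈B) | B′ , B′∈ , off′ , (y , y∈ , y∈B′) =
        ⊥-elim (sep (∈-elements⁺ i∈X) (∈-elements⁺ j∈Y) (toList
          (walk-map (λ _ _ e → e) offᵢ (out-walk i< x∈) ⧺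
           (bramble-walk B∈ B′∈ off off′ x∈B y∈B′ ⧺ walk-map (λ _ _ e → e) offⱼ (in-walk j< y∈)))))

      built : Backbone K n₀
      built = record
        { blk = blk
        ; Co-unique = λ κ≤ κ′≤ → Co-unique (s≤s (≤-trans κ≤ (n≤1+n _))) (s≤s (≤-trans κ′≤ (n≤1+n _)))
        ; stn = stn ; stn-Co = stn-Co ; seg = seg ; seg-st = seg-st ; seg-en = seg-en ; seg-∈⁻ = seg-∈⁻ ; seg-∈⁺ = seg-∈⁺
        ; A = A ; stn∈A = stn∈A ; wellLinked = wellLinked ; join = join }

    backbone : ∀ (β : Bramble G) N K n₀ → 1 ≤ N → K ≤ N → n₀ ≤ N → OrderAtLeast G β (suc K * suc N) → Backbone K n₀
    backbone β N K n₀ 1≤N K≤N n₀≤N order =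
      Build.built β N K n₀ K≤N n₀≤N (Hitting.unique h) (Hitting.linked h)
        (cells N 1≤N (suc K) elems id order′ _ (Hitting.hits h) (Hitting.head h))
      where
      open WithBramble β
      open Bramble β
      order′ : Order elems (suc K * suc N)
      order′ S cov = order S (All.tabulate (λ B∈ → let v , v∈ , q = cov B∈ in v , v∈ , q))
      some : ∃[ B ] B ∈ elems
      some with elems | order′
      ... | B ∷ _ | _ = B , here refl
      ... | []    | o = ⊥-elim (<⇒≱ {0} (s≤s z≤n) (subst (suc K * suc N ≤_) (Subsetₚ.∣⊥∣≡0 n) (o ⊥ₛ λ ())))
      h = hitting elems id (proj₂ some)

  open Backbones public

  module OnBackbone (p l c : ℕ) (1≤p : 1 ≤ p) (1≤l : 1 ≤ l) (1≤c : 1 ≤ c) {K n₀ : ℕ} (bb : Backbone K n₀) where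

    open Backbone bb
    open Sizes l c

    -- Webs or avoidance

    module Webs where

      AnchoredWeb : Set₁
      AnchoredWeb = ∃[ p′ ] (p ≤ p′ × Σ (Web G p′ (l * p′) c) λ W →
        (∀ x → top G W x → x ∈ₛ A) × (∀ x → bottom G W x → x ∈ₛ A))

      starts≢ends : ∀ {L} → Linkage L → 1 ≤ length L → toSubset (map st L) ≢ toSubset (map en L)
      starts≢ends {P ∷ L} lk _ eq
        with ∈-map⁻ en (∈-toSubset⁻ (map en (P ∷ L)) (subst (st P ∈ₛ_) eq (∈-toSubset⁺ {xs = map st (P ∷ L)} (here refl))))
      ... | Q , Q∈ , st≡en with same-path (Linkage.disj lk) (here refl) Q∈ (st∈ P) (subst (_∈ vts Q) (sym st≡en) (en∈ Q))
      ... | refl = Linkage.nontriv lk (here refl) st≡en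

      isLinkageOf : ∀ {L} → Linkage L → IsLinkageOf G (toSubset (map st L)) (toSubset (map en L)) (length L) L
      isLinkageOf lk = Linkage.disj lk , refl ,
        All.tabulate (λ P∈ → ∈-toSubset⁺ (∈-map⁺ st P∈) , ∈-toSubset⁺ (∈-map⁺ en P∈))

      minimal : ∀ {L 𝒬} → Min L 𝒬 → Minimal G (toSubset (map st L)) (toSubset (map en L)) (⟦_⟧ G 𝒬) L
      minimal {L} {𝒬} min u v uv∈ uv∉ (L′ , (disj , size , ends) , inside) =
        min (find uv∈) (λ (Q , Q∈ , q) → uv∉ (lose Q∈ q)) record
          { paths = L′ ; disj = disj ; size = size
          ; starts = λ P∈ → ∈-toSubset⁻ (map st L) (proj₁ (All.lookup ends P∈))
          ; ends = λ P∈ → ∈-toSubset⁻ (map en L) (proj₂ (All.lookup ends P∈))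
          ; uses = λ P∈ → ⇒linked λ e∈ → case All.lookup (proj₂ (All.lookup inside P∈)) e∈ of
              λ { (inj₁ a , ne) → inj₁ (find a) , ne ; (inj₂ a , ne) → inj₂ (find a) , ne } }

      Anchored : List Pth → Set
      Anchored 𝒬 = ∀ {Q} → Q ∈ 𝒬 → st Q ∈ₛ A × en Q ∈ₛ A

      web : ∀ {L 𝒬} → Linkage L → Linkage 𝒬 → Anchored 𝒬 → p ≤ length L → length 𝒬 ≡ l * length L →
        Min L 𝒬 → (∀ {Q} → Q ∈ 𝒬 → c * missed G L Q ≤ length L) → AnchoredWeb
      web {L} {𝒬} lkL lk𝒬 anch p≤ size min bad = length L , p≤ , W ,
        (λ x (x∈ , _) → case ∈-map⁻ st (∈-toSubset⁻ (map st 𝒬) x∈) of λ { (Q , Q∈ , refl) → proj₁ (anch Q∈) }) ,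
        (λ x (x∈ , _) → case ∈-map⁻ en (∈-toSubset⁻ (map en 𝒬) x∈) of λ { (Q , Q∈ , refl) → proj₂ (anch Q∈) })
        where
        1≤L = ≤-trans 1≤p p≤
        W : Web G (length L) (l * length L) c
        W = record
          { A = toSubset (map st L) ; B = toSubset (map en L)
          ; C = toSubset (map st 𝒬) ; D = toSubset (map en 𝒬)
          ; A≢B = starts≢ends lkL 1≤L
          ; C≢D = starts≢ends lk𝒬 (subst (1 ≤_) (sym size) (*-mono-≤ 1≤l 1≤L))
          ; 𝒫 = L ; 𝒬 = 𝒬
          ; 𝒫-link = isLinkageOf lkL
          ; 𝒬-link = subst (λ k → IsLinkageOf G (toSubset (map st 𝒬)) (toSubset (map en 𝒬)) k 𝒬) size (isLinkageOf lk𝒬)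
          ; avoid = All.tabulate (λ Q∈ → (λ c≡0 → ⊥-elim (<-irrefl (sym c≡0) 1≤c)) , bad Q∈)
          ; minimal = minimal min }

      Linkage-⊆ : ∀ {L L′} → L′ ⊆ L → AllPairs Disj L′ → Linkage L → Linkage L′
      Linkage-⊆ s d lk = record { disj = d ; nontriv = Linkage.nontriv lk ∘ s }

      take⊆ : ∀ {A : Set} k (xs : List A) → take k xs ⊆ xs
      take⊆ (suc k) (x ∷ xs) (here eq) = here eq
      take⊆ (suc k) (x ∷ xs) (there p) = there (take⊆ k xs p)

      length-take≡ : ∀ {A : Set} k (xs : List A) → k ≤ length xs → length (take k xs) ≡ k
      length-take≡ k xs le = trans (length-take k xs) (m≤n⇒m⊓n≡m le)

      Linkage-take : ∀ {L} k → Linkage L → Linkage (take k L)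
      Linkage-take {L} k lk = Linkage-⊆ (take⊆ k L) (AllPairsₚ.take⁺ k (Linkage.disj lk)) lk

      Avoids : List Pth → Pth → Set
      Avoids L Q = ∀ {P} → P ∈ L → Disj P Q

      record Reduct (𝒬 : List Pth) (m : ℕ) (L S : List Pth) : Set where
        field
          paths   : List Pth
          linkage : Linkage paths
          size    : length paths ≡ m
          ref     : Ref 𝒬 paths L
          avoids  : ∀ {Q} → Q ∈ S → Avoids paths Q

      length-split : ∀ {A : Set} {Q : A → Set} (Q? : Decidable Q) xs →
        length xs ≡ length (filter Q? xs) + length (filter (¬? ∘ Q?) xs)
      length-split Q? [] = refl
      length-split Q? (x ∷ xs) with Q? x
      ... | yes _ = cong suc (length-split Q? xs)
      ... | no _ = trans (cong suc (length-split Q? xs)) (sym (+-suc (length (filter Q? xs)) _))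

      reduct-take : ∀ {𝒬 m L} → Linkage L → m ≤ length L → Reduct 𝒬 m L []
      reduct-take {m = m} {L} lk le = record
        { paths = take m L ; linkage = Linkage-take m lk ; size = length-take≡ m L le
        ; ref = sublinkage (take⊆ m L) ; avoids = λ () }

      -- Either many paths of 𝒬 meet almost all of L once L is 𝒬-minimal, which is a web, or most paths of 𝒬 can
      -- each be avoided by a rerouted linkage of order m.
      module Avoid {X Y : Set} (pth : X → Pth) (m : ℕ) (p≤cm : p ≤ c * m) where

        module _ (qs : List X) (lk𝒬 : Linkage (map pth qs)) (anch : Anchored (map pth qs)) where

          private
            𝒬 = map pth qs
            t = l * (c * m)

          Avoidable : List Pth → X → Set
          Avoidable L q = Reduct 𝒬 m L (pth q ∷ [])

          Survivors : List Pth → List X → Set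
          Survivors L rs = ∃[ rs′ ] (rs′ ⊆ rs × AllPairs (λ q r → Disj (pth q) (pth r)) rs′ ×
            length rs ≤ length rs′ + t × (∀ {q} → q ∈ rs′ → Avoidable L q))

          -- By `min-sub` the minimised linkage remains minimal for any `l * (c * m)` of the bad
          -- paths, which is exactly the number a web needs. A path that is not bad misses more than
          -- `m` of the `c * m` minimised paths, and `m` of those serve as the rerouted linkage.
          survivors-one : ∀ {L} → Linkage L → length L ≡ c * m → ∀ rs → rs ⊆ qs → AllPairs (λ q r → Disj (pth q) (pth r)) rs →
            AnchoredWeb ⊎ Survivors L rs
          survivors-one {L} lk sizeL rs rs⊆ d with minimise lk 𝒬
          ... | L~ , lk~ , ref~ , size~ , min~ = decide (t ≤? length bads)
            where
            size~≡ : length L~ ≡ c * m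
            size~≡ = trans size~ sizeL
            Bad : X → Set
            Bad q = c * missed G L~ (pth q) ≤ length L~
            bad? : Decidable Bad
            bad? q = c * missed G L~ (pth q) ≤? length L~
            bads = filter bad? rs
            𝒬′ = map pth (take t bads)
            bads⊆ : take t bads ⊆ rs
            bads⊆ q∈ = proj₁ (∈-filter⁻ bad? (take⊆ t bads q∈))
            𝒬′⊆ : 𝒬′ ⊆ 𝒬
            𝒬′⊆ Q∈ = case ∈-map⁻ pth Q∈ of λ { (q , q∈ , refl) → ∈-map⁺ pth (rs⊆ (bads⊆ q∈)) }
            avoidable : ∀ {q} → ¬ Bad q → Avoidable L q
            avoidable {q} ¬bad = record
              { paths = take m av
              ; linkage = Linkage-⊆ (av⊆ ∘ take⊆ m av)
                  (AllPairsₚ.take⁺ m (AllPairsₚ.filter⁺ (λ P → ¬? (meets? G P (pth q))) (Linkage.disj lk~))) lk~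
              ; size = length-take≡ m av (<⇒≤ (*-cancelˡ-< c m (length av)
                  (subst (_< c * length av) size~≡ (≰⇒> ¬bad))))
              ; ref = Ref-trans id (sublinkage (av⊆ ∘ take⊆ m av)) ref~
              ; avoids = λ { (here refl) P∈ x x∈P x∈Q →
                  proj₂ (∈-filter⁻ (λ P → ¬? (meets? G P (pth q))) {xs = L~} (take⊆ m av P∈)) (lose x∈P x∈Q) } }
              where
              av = filter (λ P → ¬? (meets? G P (pth q))) L~
              av⊆ : av ⊆ L~
              av⊆ P∈ = proj₁ (∈-filter⁻ (λ P → ¬? (meets? G P (pth q))) P∈)
            decide : Dec (t ≤ length bads) → AnchoredWeb ⊎ Survivors L rs
            decide (yes t≤) = inj₁ (web lk~
              (Linkage-⊆ 𝒬′⊆ (AllPairsₚ.map⁺ (AllPairsₚ.take⁺ t (AllPairsₚ.filter⁺ bad? d))) lk𝒬) (anch ∘ 𝒬′⊆)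
              (subst (p ≤_) (sym size~≡) p≤cm)
              (trans (length-map pth (take t bads)) (trans (length-take≡ t bads t≤) (cong (l *_) (sym size~≡))))
              (min-sub (Linkage.disj lk~) (Linkage.disj lk𝒬) 𝒬′⊆ min~)
              λ Q∈ → case ∈-map⁻ pth Q∈ of λ { (q , q∈ , refl) → proj₂ (∈-filter⁻ bad? {xs = rs} (take⊆ t bads q∈)) })
            decide (no t≰) = inj₂ (filter (¬? ∘ bad?) rs , (λ q∈ → proj₁ (∈-filter⁻ (¬? ∘ bad?) q∈)) , AllPairsₚ.filter⁺ (¬? ∘ bad?) d ,
              le ,
              λ q∈ → avoidable (proj₂ (∈-filter⁻ (¬? ∘ bad?) {xs = rs} q∈)))
              where
              le : length rs ≤ length (filter (¬? ∘ bad?) rs) + t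
              le = ≤-trans (≤-reflexive (trans (length-split bad? rs) (+-comm (length bads) _)))
                (+-monoʳ-≤ (length (filter (¬? ∘ bad?) rs)) (<⇒≤ (≰⇒> t≰)))

          -- Each linkage is minimised separately, always against the whole of `𝒬`, and strikes out
          -- at most `t` of the candidates left by the previous ones. What remains is avoidable for
          -- all linkages.
          survivors : ∀ (N : Y → List Pth) ys → (∀ {y} → y ∈ ys → Linkage (N y) × length (N y) ≡ c * m) →
            ∀ rs → rs ⊆ qs → AllPairs (λ q r → Disj (pth q) (pth r)) rs →
            AnchoredWeb ⊎ (∃[ rs′ ] (rs′ ⊆ rs × length rs ≤ length rs′ + length ys * t ×
              (∀ {y q} → y ∈ ys → q ∈ rs′ → Avoidable (N y) q)))
          survivors N [] _ rs rs⊆ d = inj₂ (rs , id , m≤m+n _ 0 , λ ())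
          survivors N (y ∷ ys) lk rs rs⊆ d with survivors-one (proj₁ (lk (here refl))) (proj₂ (lk (here refl))) rs rs⊆ d
          ... | inj₁ w = inj₁ w
          ... | inj₂ (rs₁ , s₁ , d₁ , le₁ , f₁) with survivors N ys (lk ∘ there) rs₁ (rs⊆ ∘ s₁) d₁
          ... | inj₁ w = inj₁ w
          ... | inj₂ (rs₂ , s₂ , le₂ , f₂) = inj₂ (rs₂ , s₁ ∘ s₂ , le ,
              λ { (here refl) q∈ → f₁ (s₂ q∈) ; (there y∈) q∈ → f₂ y∈ q∈ })
            where
            le : length rs ≤ length rs₂ + (t + length ys * t)
            le = ≤-trans le₁ (≤-trans (+-monoˡ-≤ t le₂) (≤-reflexive
              (trans (+-assoc (length rs₂) _ t) (cong (length rs₂ +_) (+-comm _ t)))))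

        avoid-one : ∀ qs → Linkage (map pth qs) → Anchored (map pth qs) →
          ∀ (N : Y → List Pth) ys → (∀ {y} → y ∈ ys → Linkage (N y) × c * m ≤ length (N y)) →
          length ys * (l * (c * m)) < length qs →
          AnchoredWeb ⊎ (∃[ q ] (q ∈ qs × (∀ {y} → y ∈ ys → Reduct (map pth qs) m (N y) (pth q ∷ []))))
        avoid-one qs lk𝒬 anch N ys lk big
          with survivors qs lk𝒬 anch (take (c * m) ∘ N) ys
            (λ y∈ → Linkage-take (c * m) (proj₁ (lk y∈)) , length-take≡ (c * m) _ (proj₂ (lk y∈)))
            qs id (AllPairsₚ.map⁻ (Linkage.disj lk𝒬))
        ... | inj₁ w = inj₁ w
        ... | inj₂ ([] , _ , le , _) = ⊥-elim (<⇒≱ big le)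
        ... | inj₂ (q ∷ _ , s , _ , f) = inj₂ (q , s (here refl) , λ {y} y∈ →
            let r = f y∈ (here refl) in record
              { Reduct r ; ref = Ref-trans id (Reduct.ref r) (sublinkage (take⊆ (c * m) (N y))) })

      AvoidMany : ∀ {X Y : Set} → (X → Pth) → ℕ → ℕ → List X → (Y → List Pth) → List Y → Set
      AvoidMany pth k m qs N ys = ∃[ xs ] (length xs ≡ k × xs ⊆ qs × AllPairs (λ q r → Disj (pth q) (pth r)) xs ×
        (∀ {y} → y ∈ ys → Reduct (map pth qs) m (N y) (map pth xs)))

      -- Iterating: k paths of 𝒬 are avoided simultaneously, at the price of a factor c ^ k.
      avoid-many : ∀ {X Y : Set} (pth : X → Pth) k m → p ≤ m → ∀ qs → Linkage (map pth qs) → Anchored (map pth qs) →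
        ∀ (N : Y → List Pth) ys → (∀ {y} → y ∈ ys → Linkage (N y) × c ^ k * m ≤ length (N y)) →
        k + length ys * (l * (c ^ k * m)) ≤ length qs →
        AnchoredWeb ⊎ AvoidMany pth k m qs N ys
      avoid-many pth zero m p≤m qs lk𝒬 anch N ys lk big =
        inj₂ ([] , refl , (λ ()) , [] , λ y∈ → reduct-take (proj₁ (lk y∈)) (≤-trans (≤-reflexive (sym (+-identityʳ m))) (proj₂ (lk y∈))))
      avoid-many {X} {Y} pth (suc k) m p≤m qs lk𝒬 anch N ys lk big
        with Avoid.avoid-one {Y = Y} pth (c ^ k * m) p≤₁ qs lk𝒬 anch N ys
            (λ y∈ → proj₁ (lk y∈) , ≤-trans (≤-reflexive (sym (*-assoc c (c ^ k) m))) (proj₂ (lk y∈)))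
            (<-≤-trans (s≤s (≤-trans (≤-reflexive (cong (λ z → length ys * (l * z)) (sym (*-assoc c (c ^ k) m)))) (m≤n+m _ k))) big)
        where
        1≤ck : ∀ k → 1 ≤ c ^ k
        1≤ck zero    = ≤-refl
        1≤ck (suc k) = *-mono-≤ 1≤c (1≤ck k)
        p≤₁ : p ≤ c * (c ^ k * m)
        p≤₁ = subst (p ≤_) (*-assoc c (c ^ k) m) (≤-trans p≤m (m≤n*m m (c ^ suc k) {{ℕ.>-nonZero (1≤ck (suc k))}}))
      ... | inj₁ w = inj₁ w
      ... | inj₂ (q , q∈ , red) = again
        (avoid-many pth k m p≤m (qs ∖ q∈)
          (Linkage-⊆ rest⊆ (AllPairsₚ.map⁺ (AllPairs-∖ q∈ dqs)) lk𝒬) (anch ∘ rest⊆)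
          -- The reduced linkages depend on the membership proofs, so they are indexed by
          -- `attach ys`.
          (λ (_ , y∈) → Reduct.paths (red y∈)) (attach ys)
          (λ {(_ , y∈)} _ → Reduct.linkage (red y∈) , ≤-reflexive (sym (Reduct.size (red y∈))))
          (s≤s⁻¹ (subst (_≤ suc (length (qs ∖ q∈))) (cong (λ z → suc (k + z * (l * (c ^ k * m)))) (sym (length-mapWith∈ ys _)))
            (≤-trans (≤-trans (s≤s (+-monoʳ-≤ k (*-monoʳ-≤ (length ys) (*-monoʳ-≤ l shrink)))) big) (≤-reflexive (length-∖ q∈))))))
        where
        shrink : c ^ k * m ≤ c ^ suc k * m
        shrink = ≤-trans (m≤n*m (c ^ k * m) c {{ℕ.>-nonZero 1≤c}}) (≤-reflexive (sym (*-assoc c (c ^ k) m)))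
        dqs = AllPairsₚ.map⁻ (Linkage.disj lk𝒬)
        rest⊆ : map pth (qs ∖ q∈) ⊆ map pth qs
        rest⊆ Q∈ = case ∈-map⁻ pth Q∈ of λ { (r , r∈ , refl) → ∈-map⁺ pth (∖⊆ q∈ r∈) }
        again : AnchoredWeb ⊎ AvoidMany pth k m (qs ∖ q∈) (λ (_ , y∈) → Reduct.paths (red y∈)) (attach ys) →
          AnchoredWeb ⊎ AvoidMany pth (suc k) m qs N ys
        again (inj₁ w) = inj₁ w
        again (inj₂ (xs , size , xs⊆ , dxs , red′)) = inj₂ (q ∷ xs , cong suc size ,
          (λ { (here refl) → q∈ ; (there x∈) → ∖⊆ q∈ (xs⊆ x∈) }) ,
          All.tabulate (λ x∈ → AllPairs-removed (λ {q} {r} → Disj-sym {pth q} {pth r}) q∈ dqs (xs⊆ x∈)) ∷ dxs ,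
          λ y∈ → let r = red y∈ ; r′ = red′ (mapWith∈⁺ _ y∈) in record
            { Reduct r′
            ; ref = Ref-trans rest⊆ (Reduct.ref r′) (Reduct.ref r)
            ; avoids = λ
              -- Later reroutings run along the paths of `qs ∖ q∈`, which are disjoint from that of
              -- `q`, so `q` stays avoided.
              { (here refl) P∈ x x∈P x∈q → case Ref.vert (Reduct.ref r′) (_ , P∈ , x∈P) of λ
                { (inj₁ (P₁ , P₁∈ , x∈P₁)) → Reduct.avoids r (here refl) P₁∈ x x∈P₁ x∈q
                ; (inj₂ (R , R∈ , x∈R)) → case ∈-map⁻ pth R∈ of λ { (s , s∈ , refl) →
                    AllPairs-removed (λ {q} {r} → Disj-sym {pth q} {pth r}) q∈ dqs s∈ x x∈q x∈R } }
              ; (there Q∈) → Reduct.avoids r′ Q∈ } })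

    open Webs public

    -- Segments of the backbone and clearing of nested shells

    module Select where

      sdbl-mono : ∀ {a b} → a ≤ b → sdbl a ≤ sdbl b
      sdbl-mono h = s≤s (dbl-mono h)

      sdbl-mono-< : ∀ {a b} → a < b → sdbl a < sdbl b
      sdbl-mono-< h = s≤s (≤-trans (n≤1+n _) (dbl-mono h))

      sdbl≤dblK : ∀ {b} → b < K → sdbl b ≤ dbl K
      sdbl≤dblK h = ≤-trans (n≤1+n _) (dbl-mono h)

      InRange : ℕ → ℕ → Pr
      InRange a b v = ∃[ κ ] (sdbl a ≤ κ × κ ≤ sdbl b × Co κ v)

      Interval : Set
      Interval = ℕ × ℕ

      segOf : Interval → Pth
      segOf (a , b) = seg a b

      Valid : ℕ → ℕ → Interval → Set
      Valid lo hi (a , b) = lo ≤ a × a < b × b ≤ hi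

      Apart : Interval → Interval → Set
      Apart (a , b) (a′ , b′) = b < a′ ⊎ b′ < a

      module _ {lo hi : ℕ} (hi<K : hi < K) where

        segOf-range : ∀ {i v} → Valid lo hi i → v ∈ vts (segOf i) → InRange (proj₁ i) (proj₂ i) v
        segOf-range (_ , lt , le) v∈ = seg-∈⁻ (<⇒≤ lt) (≤-<-trans le hi<K) v∈

        range-segOf : ∀ {i v} → Valid lo hi i → InRange (proj₁ i) (proj₂ i) v → v ∈ vts (segOf i)
        range-segOf (_ , lt , le) (κ , a , b , q) = seg-∈⁺ (<⇒≤ lt) (≤-<-trans le hi<K) a b q

        range-apart : ∀ {i j v} → Valid lo hi i → Valid lo hi j → Apart i j →
          InRange (proj₁ i) (proj₂ i) v → InRange (proj₁ j) (proj₂ j) v → ⊥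
        range-apart (_ , _ , i≤) (_ , _ , j≤) ap (κ , a , b , q) (κ′ , a′ , b′ , q′)
          with Co-unique (≤-trans b (sdbl≤dblK (≤-<-trans i≤ hi<K))) (≤-trans b′ (sdbl≤dblK (≤-<-trans j≤ hi<K))) q q′ | ap
        ... | refl | inj₁ lt = <⇒≱ (sdbl-mono-< lt) (≤-trans a′ b)
        ... | refl | inj₂ lt = <⇒≱ (sdbl-mono-< lt) (≤-trans a b′)

        segOf-apart : ∀ {i j} → Valid lo hi i → Valid lo hi j → Apart i j → Disj (segOf i) (segOf j)
        segOf-apart vi vj ap v v∈ v∈′ = range-apart vi vj ap (segOf-range vi v∈) (segOf-range vj v∈′)

        segOf-nontrivial : ∀ {i} → Valid lo hi i → Nontrivial (segOf i)
        segOf-nontrivial {a , b} (_ , lt , le) eq =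
          <-irrefl (Co-unique (sdbl≤dblK (<-trans lt b<K)) (sdbl≤dblK b<K) (stn-Co (<-trans lt b<K))
            (subst (Co (sdbl b)) (trans (sym (seg-en (<⇒≤ lt) b<K)) (trans (sym eq) (seg-st (<⇒≤ lt) b<K))) (stn-Co b<K))) (sdbl-mono-< lt)
          where b<K = ≤-<-trans le hi<K

        segs-linkage : ∀ {X : Set} (f : X → Interval) xs → (∀ {x} → x ∈ xs → Valid lo hi (f x)) →
          AllPairs (λ x y → Apart (f x) (f y)) xs → Linkage (map (segOf ∘ f) xs)
        segs-linkage f xs valid apart = record
          { disj = AllPairsₚ.map⁺ (AllPairs-map∈ (λ x∈ y∈ → segOf-apart (valid x∈) (valid y∈)) apart)
          ; nontriv = λ Q∈ → case ∈-map⁻ (segOf ∘ f) Q∈ of λ { (x , x∈ , refl) → segOf-nontrivial (valid x∈) } }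

        segs-anchored : ∀ {X : Set} (f : X → Interval) xs → (∀ {x} → x ∈ xs → Valid lo hi (f x)) → Anchored (map (segOf ∘ f) xs)
        segs-anchored f xs valid Q∈ with ∈-map⁻ (segOf ∘ f) Q∈
        ... | x , x∈ , refl = let (_ , lt , le) = valid x∈ ; b<K = ≤-<-trans le hi<K in
              subst (_∈ₛ A) (sym (seg-st (<⇒≤ lt) b<K)) (stn∈A (<-trans lt b<K)) ,
              subst (_∈ₛ A) (sym (seg-en (<⇒≤ lt) b<K)) (stn∈A b<K)

      -- A weakened `Reduct`: of the paths used for rerouting, only the range of the backbone
      -- containing them is remembered. This makes reroutings of different slots comparable.
      record Cleared (lo hi m : ℕ) (L : List Pth) (Bad : Pr) : Set where
        field
          paths   : List Pth
          linkage : Linkage paths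
          size    : length paths ≡ m
          starts  : ∀ {P} → P ∈ paths → st P ∈ map st L
          ends    : ∀ {P} → P ∈ paths → en P ∈ map en L
          vert    : ∀ {v} → v ∈ᵥ paths → v ∈ᵥ L ⊎ InRange lo hi v
          clear   : ∀ {v} → v ∈ᵥ paths → ¬ Bad v

      range-widen : ∀ {a b lo hi v} → lo ≤ a → b ≤ hi → InRange a b v → InRange lo hi v
      range-widen lo≤ ≤hi (κ , x , y , q) = κ , ≤-trans (sdbl-mono lo≤) x , ≤-trans y (sdbl-mono ≤hi) , q

      -- The shells around nested intervals: left (A , x) and right (y , B), where the next interval lies in ]x , y[.
      Shell : Set
      Shell = Interval × Interval

      data Nest (lo hi : ℕ) : ℕ → ℕ → List Shell → Set where
        [] : ∀ {a b} → lo ≤ a → b ≤ hi → Nest lo hi a b []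
        _∷_ : ∀ {a b A x y B ss} → A < x × x < a × b < y × y < B → Nest lo hi A B ss →
              Nest lo hi a b (((A , x) , (y , B)) ∷ ss)

      module _ {lo hi : ℕ} where

        nest-bounds : ∀ {a b ss} → a ≤ b → Nest lo hi a b ss → lo ≤ a × b ≤ hi
        nest-bounds a≤b ([] p q) = p , q
        nest-bounds a≤b ((p , q , r , s) ∷ ns) = let u , v = nest-bounds (<⇒≤ (<-trans (<-trans p q) (≤-<-trans a≤b (<-trans r s)))) ns in
          ≤-trans u (<⇒≤ (<-trans p q)) , ≤-trans (<⇒≤ (<-trans r s)) v

        Around : ℕ → ℕ → Shell → Set
        Around a b (le , ri) = Valid lo hi le × Valid lo hi ri × proj₂ le < a × b < proj₁ ri

        nest-around : ∀ {a b ss} → a ≤ b → Nest lo hi a b ss → All (Around a b) ss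
        nest-around a≤b ([] _ _) = []
        nest-around a≤b ((p , q , r , s) ∷ ns) =
          ((proj₁ bs , p , ≤-trans (<⇒≤ (<-trans q (≤-<-trans a≤b (<-trans r s)))) (proj₂ bs)) ,
           (≤-trans (proj₁ bs) (<⇒≤ (<-trans p (<-trans q (≤-<-trans a≤b r)))) , s , proj₂ bs) , q , r) ∷
          All.map (λ (v , v′ , x< , <y) → v , v′ , <-trans x< (<-trans p q) , <-trans (<-trans r s) <y) (nest-around A≤B ns)
          where
          A≤B = <⇒≤ (<-trans (<-trans p q) (≤-<-trans a≤b (<-trans r s)))
          bs = nest-bounds A≤B ns

        ApartShells : Shell → Shell → Set
        ApartShells (le , ri) (le′ , ri′) = Apart le le′ × Apart ri ri′

        nest-apart : ∀ {a b ss} → a ≤ b → Nest lo hi a b ss → AllPairs ApartShells ss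
        nest-apart a≤b ([] _ _) = []
        nest-apart a≤b ((p , q , r , s) ∷ ns) =
          All.map (λ (_ , _ , x< , <y) → inj₂ x< , inj₁ <y) (nest-around A≤B ns) ∷ nest-apart A≤B ns
          where A≤B = <⇒≤ (<-trans (<-trans p q) (≤-<-trans a≤b (<-trans r s)))

      InShell : Shell → Pr
      InShell (le , ri) v = InRange (proj₁ le) (proj₂ le) v ⊎ InRange (proj₁ ri) (proj₂ ri) v

      -- First many left shells are avoided at once, then one of the corresponding right shells.
      module CleanLevel {Y : Set} (m g : ℕ) (p≤m : p ≤ m) where

        m≤cm : m ≤ c * m
        m≤cm = m≤n*m m c {{ℕ.>-nonZero 1≤c}}

        module _ {lo hi : ℕ} (hi<K : hi < K) where

          clean-level : ∀ (N : Y → List Pth) ys → length ys ≤ g → (∀ {y} → y ∈ ys → Linkage (N y) × order m g ≤ length (N y)) →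
            ∀ {a b ss} → a ≤ b → Nest lo hi a b ss → height m g ≤ length ss →
            AnchoredWeb ⊎ (∃[ s ] (s ∈ ss × (∀ {y} → y ∈ ys → Cleared lo hi m (N y) (InShell s))))
          clean-level N ys ys≤ lk {a} {b} {ss} a≤b nest h≤
            with avoid-many (segOf ∘ proj₁) (many m g) (c * m) (≤-trans p≤m m≤cm) ss
                   (segs-linkage hi<K proj₁ ss (proj₁ ∘ around) (AllPairs.map proj₁ apart)) (segs-anchored hi<K proj₁ ss (proj₁ ∘ around))
                   N ys lk (≤-trans (+-monoʳ-≤ (many m g) (*-monoˡ-≤ (l * order m g) ys≤)) h≤)
            where
            around : ∀ {s} → s ∈ ss → Around a b s
            around = All.lookup (nest-around a≤b nest)
            apart = nest-apart a≤b nest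
          ... | inj₁ w = inj₁ w
          ... | inj₂ (xs , size , xs⊆ , dxs , red)
            with Avoid.avoid-one {Y = Σ Y (_∈ ys)} (segOf ∘ proj₂) m (≤-trans p≤m m≤cm) xs
                   (segs-linkage hi<K proj₂ xs (λ x∈ → proj₁ (proj₂ (around (xs⊆ x∈)))) rights)
                   (segs-anchored hi<K proj₂ xs (λ x∈ → proj₁ (proj₂ (around (xs⊆ x∈)))))
                   (λ (_ , y∈) → Reduct.paths (red y∈)) (attach ys)
                   (λ {(_ , y∈)} _ → Reduct.linkage (red y∈) , ≤-reflexive (sym (Reduct.size (red y∈))))
                   (subst₂ _<_ (cong (_* (l * (c * m))) (sym (length-mapWith∈ ys _))) (sym size)
                     (s≤s (*-monoˡ-≤ (l * (c * m)) ys≤)))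
            where
            around : ∀ {s} → s ∈ ss → Around a b s
            around = All.lookup (nest-around a≤b nest)
            apart = nest-apart a≤b nest
            rights : AllPairs (λ s t → Apart (proj₂ s) (proj₂ t)) xs
            rights = AllPairs-map∈ (λ {s} {t} s∈ t∈ d → case ∈-AllPairs₂ apart (xs⊆ s∈) (xs⊆ t∈) of λ
              { (inj₁ refl) → ⊥-elim (d _ (st∈ (segOf (proj₁ s))) (st∈ (segOf (proj₁ s))))
              ; (inj₂ (inj₁ r)) → proj₂ r
              ; (inj₂ (inj₂ r)) → [ inj₂ , inj₁ ]′ (proj₂ r) }) dxs
          ... | inj₁ w = inj₁ w
          ... | inj₂ (s , s∈ , red′) = inj₂ (s , xs⊆ s∈ , cleared)
            where
            around : ∀ {s} → s ∈ ss → Around a b s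
            around = All.lookup (nest-around a≤b nest)
            inArea : ∀ {v} i → Valid lo hi i → v ∈ vts (segOf i) → InRange lo hi v
            inArea i (lo≤ , lt , ≤hi) v∈ = range-widen lo≤ ≤hi (segOf-range hi<K (lo≤ , lt , ≤hi) v∈)
            cleared : ∀ {y} → y ∈ ys → Cleared lo hi m (N y) (InShell s)
            cleared {y} y∈ = record
              { paths = R′.paths ; linkage = R′.linkage ; size = R′.size
              ; starts = λ P∈ → case ∈-map⁻ st (Ref.starts R′.ref P∈) of λ (Q , Q∈ , eq) → subst (_∈ map st (N y)) (sym eq) (Ref.starts R.ref Q∈)
              ; ends = λ P∈ → case ∈-map⁻ en (Ref.ends R′.ref P∈) of λ (Q , Q∈ , eq) → subst (_∈ map en (N y)) (sym eq) (Ref.ends R.ref Q∈)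
              ; vert = vert ; clear = clear }
              where
              module R = Reduct (red y∈)
              module R′ = Reduct (red′ (mapWith∈⁺ _ y∈))
              vert : ∀ {v} → v ∈ᵥ R′.paths → v ∈ᵥ N y ⊎ InRange lo hi v
              vert v∈ with Ref.vert R′.ref v∈
              ... | inj₂ (Q , Q∈ , q) = case ∈-map⁻ (segOf ∘ proj₂) Q∈ of λ { (t , t∈ , refl) → inj₂ (inArea _ (proj₁ (proj₂ (around (xs⊆ t∈)))) q) }
              ... | inj₁ v∈′ with Ref.vert R.ref v∈′
              ... | inj₁ v∈″ = inj₁ v∈″
              ... | inj₂ (Q , Q∈ , q) = case ∈-map⁻ (segOf ∘ proj₁) Q∈ of λ { (t , t∈ , refl) → inj₂ (inArea _ (proj₁ (around t∈)) q) }
              clear : ∀ {v} → v ∈ᵥ R′.paths → ¬ InShell s v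
              clear (P , P∈ , v∈) (inj₂ ri) = R′.avoids (here refl) P∈ _ v∈ (range-segOf hi<K (proj₁ (proj₂ (around (xs⊆ s∈)))) ri)
              -- The second rerouting adds only vertices of right segments. These lie beyond `b`,
              -- while the left shell ends before `a`, so the left shell stays clear.
              clear v∈@(P , P∈ , _) (inj₁ le) with Ref.vert R′.ref v∈
              ... | inj₁ (P′ , P′∈ , v∈′) = R.avoids (∈-map⁺ (segOf ∘ proj₁) s∈) P′∈ _ v∈′ (range-segOf hi<K (proj₁ (around (xs⊆ s∈))) le)
              ... | inj₂ (Q , Q∈ , q) = case ∈-map⁻ (segOf ∘ proj₂) Q∈ of λ { (t , t∈ , refl) →
                    range-apart hi<K (proj₁ (around (xs⊆ s∈))) (proj₁ (proj₂ (around (xs⊆ t∈))))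
                      (inj₁ (<-trans (proj₁ (proj₂ (proj₂ (around (xs⊆ s∈))))) (≤-<-trans a≤b (proj₂ (proj₂ (proj₂ (around (xs⊆ t∈))))))))
                      le (segOf-range hi<K (proj₁ (proj₂ (around (xs⊆ t∈)))) q) }

    open Select public

    -- Tree search for an interval with `k` separate regions

    module Search where

      -- Cell `i` lies just before station `i` and after its predecessor, so these are the cells
      -- between the stations `lo` and `hi`.
      Cell : ℕ → ℕ → Set
      Cell lo hi = ∃[ i ] (lo < i × i ≤ hi)

      -- In an interval ]a , b[ of the backbone, k cells in separate subintervals such that the linkages at each of
      -- them meet the interval only inside its subinterval.
      record Selection {Y : Set} (lo hi m k : ℕ) (N : Cell lo hi → Y → List Pth) (ys : List Y) : Set where
        field
          a b      : ℕ
          lo≤a     : lo ≤ a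
          a<b      : a < b
          b≤hi     : b ≤ hi
          left     : ℕ → ℕ
          right    : ℕ → ℕ
          cell     : ∀ {r} → r < k → Cell lo hi
          a<left   : ∀ {r} → r < k → a < left r
          left<    : ∀ {r} (r< : r < k) → left r < proj₁ (cell r<)
          <right   : ∀ {r} (r< : r < k) → proj₁ (cell r<) ≤ right r
          right<b  : ∀ {r} → r < k → right r < b
          separate : ∀ {r} → suc r < k → right r < left (suc r)
          cleared  : ∀ {r} (r< : r < k) {y} → y ∈ ys →
                     Cleared lo hi m (N (cell r<) y) (InShell ((a , left r) , (right r , b)))

      module Tree {Y : Set} (m g k : ℕ) (p≤m : p ≤ m) {lo hi : ℕ} (hi<K : hi < K)
                  (N : Cell lo hi → Y → List Pth) (ys : List Y) (ys≤ : length ys ≤ g)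
                  (lk : ∀ i {y} → y ∈ ys → Linkage (N i y) × order m g ≤ length (N i y)) where

        private
          S = treeSize k
          W : ℕ → ℕ
          W t = 3 + S t

        record Leaf (a b : ℕ) (s : Shell) : Set where
          field
            cell    : Cell lo hi
            a<      : a < proj₁ cell
            ≤b      : proj₁ cell ≤ b
            cleared : ∀ {y} → y ∈ ys → Cleared lo hi m (N cell y) (InShell s)

        -- The j-th child of the interval [ a , a + S (suc t) ] is [ childL , childR ].
        module Child (a t : ℕ) where
          gapL childL childR gapR : ℕ → ℕ
          gapL j   = suc (a + j * W t)
          childL j = suc (gapL j)
          childR j = childL j + S t
          gapR j   = suc (childR j)

          -- Both parts extend to the ends of the parent interval and so cover all the other
          -- children: a linkage cleared of this shell meets the parent interval only strictly
          -- between `gapL j` and `gapR j`.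
          shell : ℕ → Shell
          shell j = ((a , gapL j) , (gapR j , a + S (suc t)))

          gapR≡ : ∀ j → gapR j ≡ a + suc j * W t
          gapR≡ j = solve 3 (λ a j s → con 1 :+ ((con 2 :+ (a :+ j :* (con 3 :+ s))) :+ s) :=
                      a :+ ((con 3 :+ s) :+ j :* (con 3 :+ s))) refl a j (S t)
            where open +-*-Solver

          gapR< : ∀ {j} → j < k → gapR j < a + S (suc t)
          gapR< {j} j< = ≤-trans (s≤s (≤-trans (≤-reflexive (gapR≡ j)) (+-monoʳ-≤ a (*-monoˡ-≤ (W t) j<)))) (≤-reflexive (sym (+-suc a _)))

          gapR<gapL : ∀ j → gapR j < gapL (suc j)
          gapR<gapL j = s≤s (≤-reflexive (gapR≡ j))

          nested : ∀ {ss j} → j < k → Nest lo hi a (a + S (suc t)) ss → Nest lo hi (childL j) (childL j + S t) (shell j ∷ ss)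
          nested j< ns = (s≤s (m≤m+n a _) , ≤-refl , ≤-refl , gapR< j<) ∷ ns

        Outcome : ℕ → ℕ → List Shell → Set
        Outcome a b ss = Selection lo hi m k N ys ⊎ (∃[ s ] (s ∈ ss × Leaf a b s))

        -- A leaf has collected one shell from every ancestor, enough for `clean-level` to clear one
        -- of them at its cell unless there is a web. A child that answers with a shell from above
        -- its parent answers for the parent too; otherwise all `k` children answer with shells of
        -- the parent, and these make it a `Selection`. At the root no shell lies above, so a
        -- `Selection` must have occurred.
        search : ∀ t a ss → Nest lo hi a (a + S t) ss → height m g ≤ t + length ss → AnchoredWeb ⊎ Outcome a (a + S t) ss
        search zero a ss ns h≤ with CleanLevel.clean-level m g p≤m hi<K (N i) ys ys≤ (lk i) (m≤m+n a 1) ns h≤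
          where
          i : Cell lo hi
          i = suc a , s≤s (proj₁ (nest-bounds (m≤m+n a 1) ns)) , subst (_≤ hi) (+-comm a 1) (proj₂ (nest-bounds (m≤m+n a 1) ns))
        ... | inj₁ w = inj₁ w
        ... | inj₂ (s , s∈ , cl) = inj₂ (inj₂ (s , s∈ , record { cell = _ ; a< = ≤-refl ; ≤b = ≤-reflexive (+-comm 1 a) ; cleared = cl }))
        search (suc t) a ss ns h≤ = finish (children k ≤-refl)
          where
          open Child a t
          Own : ℕ → Set
          Own j = ∀ {i} → i < j → Leaf (childL i) (childR i) (shell i)
          children : ∀ j → j ≤ k → AnchoredWeb ⊎ (Outcome a (a + S (suc t)) ss ⊎ Own j)
          children zero    _  = inj₂ (inj₂ λ ())
          children (suc j) j< with children j (<⇒≤ j<)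
          ... | inj₁ w = inj₁ w
          ... | inj₂ (inj₁ o) = inj₂ (inj₁ o)
          ... | inj₂ (inj₂ own) with search t (childL j) (shell j ∷ ss) (nested j< ns) (≤-trans h≤ (≤-reflexive (sym (+-suc t (length ss)))))
          ... | inj₁ w = inj₁ w
          ... | inj₂ (inj₁ sel) = inj₂ (inj₁ (inj₁ sel))
          ... | inj₂ (inj₂ (s , there s∈ , leaf)) = inj₂ (inj₁ (inj₂ (s , s∈ , record
                { Leaf leaf
                ; a< = ≤-<-trans (≤-trans (m≤m+n a (j * W t)) (≤-trans (n≤1+n _) (n≤1+n _))) (Leaf.a< leaf)
                ; ≤b = ≤-trans (Leaf.≤b leaf) (≤-trans (n≤1+n _) (<⇒≤ (gapR< j<))) })))
          ... | inj₂ (inj₂ (s , here refl , leaf)) = inj₂ (inj₂ λ i< → last (m≤n⇒m<n∨m≡n (s≤s⁻¹ i<)))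
            where
            last : ∀ {i} → i < j ⊎ i ≡ j → Leaf (childL i) (childR i) (shell i)
            last (inj₁ i<)   = own i<
            last (inj₂ refl) = leaf
          finish : AnchoredWeb ⊎ (Outcome a (a + S (suc t)) ss ⊎ Own k) → AnchoredWeb ⊎ Outcome a (a + S (suc t)) ss
          finish (inj₁ w) = inj₁ w
          finish (inj₂ (inj₁ o)) = inj₂ o
          finish (inj₂ (inj₂ own)) = inj₂ (inj₁ record
            { a = a ; b = a + S (suc t)
            ; lo≤a = proj₁ bounds ; a<b = m<m+n a (s≤s z≤n) ; b≤hi = proj₂ bounds
            ; left = gapL ; right = gapR ; cell = λ r< → Leaf.cell (own r<)
            ; a<left = λ _ → s≤s (m≤m+n a _)
            ; left< = λ r< → <-trans ≤-refl (Leaf.a< (own r<))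
            ; <right = λ r< → ≤-trans (Leaf.≤b (own r<)) (n≤1+n _)
            ; right<b = gapR< ; separate = λ {r} _ → gapR<gapL r
            ; cleared = λ r< → Leaf.cleared (own r<) })
            where bounds = nest-bounds (m≤m+n a _) ns

        select : ∀ a → lo ≤ a → a + S (height m g) ≤ hi → AnchoredWeb ⊎ Selection lo hi m k N ys
        select a lo≤ ≤hi with search (height m g) a [] ([] lo≤ ≤hi) (m≤m+n _ 0)
        ... | inj₁ w = inj₁ w
        ... | inj₂ (inj₁ sel) = inj₂ sel
        ... | inj₂ (inj₂ (_ , () , _))

      cleared-widen : ∀ {lo hi lo′ hi′ m L Bad} → lo ≤ lo′ → hi′ ≤ hi → Cleared lo′ hi′ m L Bad → Cleared lo hi m L Bad
      cleared-widen lo≤ ≤hi cl = record { Cleared cl ; vert = λ v∈ → [ inj₁ , inj₂ ∘ range-widen lo≤ ≤hi ]′ (Cleared.vert cl v∈) }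

      m≤cm : ∀ m → m ≤ c * m
      m≤cm m = m≤n*m m c {{ℕ.>-nonZero 1≤c}}

      cm≤order : ∀ m g → c * m ≤ order m g
      cm≤order m g = m≤n*m (c * m) (c ^ many m g) {{m^n≢0 c (many m g) {{ℕ.>-nonZero 1≤c}}}}

      Slot : ∀ {X Y : Set} (lo hi m k : ℕ) → (X → List Pth) → List X → (Cell lo hi → Y → List Pth) → List Y → Set
      Slot lo hi m k NF xs N ys = Σ (Selection lo hi m k N ys) λ sel → ∀ {x} → x ∈ xs →
        Cleared lo hi m (NF x) (InRange (Selection.a sel) (Selection.b sel))

      module _ {X Y : Set} (m g f k : ℕ) (p≤m : p ≤ m) {lo hi : ℕ} (hi<K : hi < K) (fits : lo + slotLength k m g f ≤ hi)
               (NF : X → List Pth) (xs : List X) (xs≤ : length xs ≤ f)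
               (lkF : ∀ {x} → x ∈ xs → Linkage (NF x) × c * m ≤ length (NF x))
               (N : Cell lo hi → Y → List Pth) (ys : List Y) (ys≤ : length ys ≤ g)
               (lk : ∀ i {y} → y ∈ ys → Linkage (N i y) × order m g ≤ length (N i y)) where

        private
          B = treeSize k (height m g)
          s = blocks m f
          block : ℕ → Interval
          block u = lo + u * suc B , lo + u * suc B + B

          block-end : ∀ u → suc (lo + u * suc B + B) ≡ lo + suc u * suc B
          block-end u = trans (cong suc (+-assoc lo (u * suc B) B)) (trans (sym (+-suc lo (u * suc B + B)))
            (cong (lo +_) (trans (sym (+-suc (u * suc B) B)) (+-comm (u * suc B) (suc B)))))

          B≥1 : 1 ≤ B
          B≥1 = positive (height m g)
            where
            positive : ∀ t → 1 ≤ treeSize k t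
            positive zero    = ≤-refl
            positive (suc t) = s≤s z≤n

          valid : ∀ {u} → u ∈ upTo s → Valid lo hi (block u)
          valid {u} u∈ = m≤m+n lo _ , m<m+n _ B≥1 ,
            ≤-trans (n≤1+n _) (≤-trans (≤-reflexive (block-end u)) (≤-trans (+-monoʳ-≤ lo (*-monoˡ-≤ (suc B) (∈-upTo⁻ u∈))) fits))

          later : ∀ {u v} → u < v → proj₂ (block u) < proj₁ (block v)
          later {u} {v} u<v = ≤-trans (≤-reflexive (block-end u)) (+-monoʳ-≤ lo (*-monoˡ-≤ (suc B) u<v))

          apart : AllPairs (λ u v → Apart (block u) (block v)) (upTo s)
          apart = AllPairs.map (λ {u} {v} u≢v → case <-cmp u v of λ
            { (tri< lt _ _) → inj₁ (later lt) ; (tri≈ _ eq _) → ⊥-elim (u≢v eq) ; (tri> _ _ gt) → inj₂ (later gt) }) (Uniqueₚ.upTo⁺ s)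

        -- Linkages without an end in the slot must miss the interval altogether, so a whole block
        -- that all of them can avoid is fixed before the tree search. The search inside that block
        -- then deals with the linkages ending at its cells.
        select-slot : AnchoredWeb ⊎ Slot lo hi m k NF xs N ys
        select-slot with Avoid.avoid-one {Y = X} (segOf ∘ block) m (≤-trans p≤m (m≤cm m)) (upTo s)
            (segs-linkage hi<K block (upTo s) valid apart) (segs-anchored hi<K block (upTo s) valid) NF xs lkF
            (≤-trans (s≤s (*-monoˡ-≤ (l * (c * m)) xs≤)) (≤-reflexive (sym (Listₚ.length-upTo s))))
        ... | inj₁ w = inj₁ w
        ... | inj₂ (u , u∈ , red) = inside (Tree.select {Y = Y} m g k p≤m hi′<K N′ ys ys≤ (λ i → lk (widen i)) lo′ ≤-refl ≤-refl)
          where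
          lo′ = proj₁ (block u)
          hi′ = proj₂ (block u)
          lo≤ = proj₁ (valid u∈)
          ≤hi = proj₂ (proj₂ (valid u∈))
          hi′<K = ≤-<-trans ≤hi hi<K
          widen : Cell lo′ hi′ → Cell lo hi
          widen (i , lo< , i≤) = i , ≤-<-trans lo≤ lo< , ≤-trans i≤ ≤hi
          N′ : Cell lo′ hi′ → Y → List Pth
          N′ = N ∘ widen
          inside : AnchoredWeb ⊎ Selection lo′ hi′ m k N′ ys → AnchoredWeb ⊎ Slot lo hi m k NF xs N ys
          inside (inj₁ w) = inj₁ w
          inside (inj₂ sel) = inj₂ (record
              { Selection sel ; lo≤a = ≤-trans lo≤ lo≤a ; b≤hi = ≤-trans b≤hi ≤hi
              ; cell = λ r< → widen (cell r<) ; cleared = λ r< y∈ → cleared-widen lo≤ ≤hi (cleared r< y∈) } ,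
            λ x∈ → let module R = Reduct (red x∈) in record
              { paths = R.paths ; linkage = R.linkage ; size = R.size ; starts = Ref.starts R.ref ; ends = Ref.ends R.ref
              ; vert = λ v∈ → case Ref.vert R.ref v∈ of λ
                  { (inj₁ q) → inj₁ q
                  ; (inj₂ (Q , Q∈ , q)) → case ∈-map⁻ (segOf ∘ block) Q∈ of λ { (t , t∈ , refl) →
                      inj₂ (range-widen (proj₁ (valid t∈)) (proj₂ (proj₂ (valid t∈))) (segOf-range hi<K (valid t∈) q)) } }
              ; clear = λ (P , P∈ , v∈) inR → R.avoids (here refl) P∈ _ v∈ (range-segOf hi<K (valid u∈) (range-widen lo≤a b≤hi inR)) })
            where open Selection sel

    open Search public

    module OnGrid (zones width q m₀ : ℕ) (p≤m₀ : p ≤ m₀) (width≤m₀ : width ≤ m₀)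
                  (p≤zones : p ≤ zones) (2≤q : 2 ≤ q) (q≡ : q ≡ l * zones) where

      k : ℕ
      k = zones * (width + width)

      open Schedule k q m₀

      -- Processing the slots one by one

      module Configurations where

        Open : ℕ → ℕ → Pr
        Open lo hi v = ∃[ κ ] (sdbl lo < κ × κ < sdbl hi × Co κ v)

        record Node : Set where
          field
            a b        : ℕ
            left right : ℕ → ℕ

        open Node

        record ValidNode (w : ℕ) (d : Node) : Set where
          field
            lo≤a       : off w ≤ a d
            a<b        : a d < b d
            b≤hi       : b d ≤ off w + len w
            a<left     : ∀ {r} → r < k → a d < left d r
            left<right : ∀ {r} → r < k → left d r < right d r
            right<b    : ∀ {r} → r < k → right d r < b d
            separate   : ∀ {r} → suc r < k → right d r < left d (suc r)

        -- (w , e) is cell e of the unprocessed slot w < u, or region e of the processed slot w ≥ u.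
        Terminal : Set
        Terminal = ℕ × ℕ

        OK : ℕ → Terminal → Set
        OK u (w , e) = w < q × ((w < u × off w < e × e ≤ off w + len w) ⊎ (u ≤ w × e < k))

        module _ (u : ℕ) (node : ℕ → Node) where

          At : Terminal → Pr
          At (w , e) v = (w < u × Co (dbl e) v) ⊎ (u ≤ w × Open (left (node w) e) (right (node w) e) v)

          Through : Terminal → ℕ → Pr
          Through (w , e) s v = s ≡ w × Open (left (node s) e) (right (node s) e) v

          -- Each ordered pair of terminals in different slots has a linkage of its own, and wires
          -- of different pairs may intersect freely. Only their contact with the processed
          -- intervals is controlled: by `clean` it occurs inside the regions at their own two ends.
          record Wire (x y : Terminal) : Set where
            field
              paths   : List Pth
              linkage : Linkage paths
              size    : length paths ≡ ord u
              starts  : ∀ {P} → P ∈ paths → At x (st P)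
              ends    : ∀ {P} → P ∈ paths → At y (en P)
              clean   : ∀ {s v} → u ≤ s → s < q → v ∈ᵥ paths → InRange (a (node s)) (b (node s)) v →
                        Through x s v ⊎ Through y s v

        -- The slots from `u` on have been processed. `Conf q` is the bare backbone with its
        -- linkages between cells; in `Conf 0` every slot has become an interval with `k` regions.
        record Conf (u : ℕ) : Set where
          field
            node  : ℕ → Node
            valid : ∀ {s} → u ≤ s → s < q → ValidNode s (node s)
            wire  : ∀ {x y} → OK u x → OK u y → proj₁ x ≢ proj₁ y → Wire u node x y

        off-mono : ∀ {w w′} → w < w′ → off w + len w < off w′
        off-mono {w} {suc w′} (s≤s le) with m≤n⇒m<n∨m≡n le
        ... | inj₂ refl = ≤-refl
        ... | inj₁ lt   = ≤-trans (off-mono lt) (≤-trans (m≤m+n (off w′) (len w′)) (n≤1+n _))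

        slots-disjoint : ∀ {w w′ v} → off q < K → w < q → w′ < q → w ≢ w′ →
          InRange (off w) (off w + len w) v → InRange (off w′) (off w′ + len w′) v → ⊥
        slots-disjoint {w} {w′} fits w< w′< w≢ r r′ with <-cmp w w′
        ... | tri< lt _ _ = range-apart {0} {off q} fits {off w , off w + len w} {off w′ , off w′ + len w′}
                (z≤n , m<m+n _ (s≤s z≤n) , <⇒≤ (off-mono w<)) (z≤n , m<m+n _ (s≤s z≤n) , <⇒≤ (off-mono w′<)) (inj₁ (off-mono lt)) r r′
        ... | tri≈ _ eq _ = w≢ eq
        ... | tri> _ _ gt = range-apart {0} {off q} fits {off w , off w + len w} {off w′ , off w′ + len w′}
                (z≤n , m<m+n _ (s≤s z≤n) , <⇒≤ (off-mono w<)) (z≤n , m<m+n _ (s≤s z≤n) , <⇒≤ (off-mono w′<)) (inj₂ (off-mono gt)) r r′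

        p≤ord : ∀ u → p ≤ ord u
        p≤ord zero    = p≤m₀
        p≤ord (suc u) = ≤-trans (p≤ord u) (≤-trans (m≤cm (ord u)) (cm≤order (ord u) (others u + others u)))

        oldTerminals : ℕ → List Terminal
        oldTerminals zero    = []
        oldTerminals (suc w) = oldTerminals w ++ map (λ t → w , suc (off w + t)) (upTo (len w))

        newTerminals : ℕ → List Terminal
        newTerminals u = map (λ (d , e) → suc u + d , e) (cartesianProduct (upTo (q ∸ suc u)) (upTo k))

        otherTerminals : ℕ → List Terminal
        otherTerminals u = oldTerminals u ++ newTerminals u

        oldTerminals-length : ∀ u → length (oldTerminals u) ≤ off u
        oldTerminals-length zero    = z≤n
        oldTerminals-length (suc w) = ≤-trans (≤-reflexive (trans (length-++ (oldTerminals w))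
            (cong (length (oldTerminals w) +_) (trans (length-map _ (upTo (len w))) (Listₚ.length-upTo (len w))))))
          (≤-trans (+-monoˡ-≤ (len w) (oldTerminals-length w)) (n≤1+n _))

        otherTerminals-length : ∀ u → length (otherTerminals u) ≤ others u
        otherTerminals-length u = ≤-trans (≤-reflexive (length-++ (oldTerminals u))) (+-mono-≤ (oldTerminals-length u)
          (≤-trans (≤-reflexive (trans (length-map _ (cartesianProduct (upTo (q ∸ suc u)) (upTo k)))
            (trans (length-cartesianProduct (upTo (q ∸ suc u)) (upTo k))
              (cong₂ _*_ (Listₚ.length-upTo (q ∸ suc u)) (Listₚ.length-upTo k)))))
            (*-monoˡ-≤ k (m∸n≤m q (suc u)))))

        oldTerminals⁻ : ∀ u {x} → x ∈ oldTerminals u → proj₁ x < u × off (proj₁ x) < proj₂ x × proj₂ x ≤ off (proj₁ x) + len (proj₁ x)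
        oldTerminals⁻ (suc w) x∈ with ∈-++⁻ (oldTerminals w) x∈
        ... | inj₁ x∈′ = let a , b = oldTerminals⁻ w x∈′ in <-trans a ≤-refl , b
        ... | inj₂ x∈′ with ∈-map⁻ _ x∈′
        ... | t , t∈ , refl = ≤-refl , s≤s (m≤m+n (off w) t) , +-monoʳ-< (off w) (∈-upTo⁻ t∈)

        oldTerminals⁺ : ∀ u {w e} → w < u → off w < e → e ≤ off w + len w → (w , e) ∈ oldTerminals u
        oldTerminals⁺ (suc w′) {w} {e} w<u o< ≤o with m≤n⇒m<n∨m≡n (s≤s⁻¹ w<u)
        ... | inj₁ lt   = ∈-++⁺ˡ (oldTerminals⁺ w′ lt o< ≤o)
        ... | inj₂ refl = ∈-++⁺ʳ (oldTerminals w) (subst (λ z → (w , z) ∈ map (λ t → w , suc (off w + t)) (upTo (len w))) eq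
              (∈-map⁺ (λ t → w , suc (off w + t)) (∈-upTo⁺ (+-cancelˡ-< (off w) _ _ (≤-trans (≤-reflexive eq) ≤o)))))
          where
          eq : suc (off w + (e ∸ suc (off w))) ≡ e
          eq = m+[n∸m]≡n o<

        otherTerminals⁻ : ∀ {u x} → suc u ≤ q → x ∈ otherTerminals u → OK (suc u) x × proj₁ x ≢ u
        otherTerminals⁻ {u} u<q x∈ with ∈-++⁻ (oldTerminals u) x∈
        ... | inj₁ x∈′ = let a , b , d = oldTerminals⁻ u x∈′ in (<-trans a u<q , inj₁ (<-trans a ≤-refl , b , d)) , <⇒≢ a
        ... | inj₂ x∈′ with ∈-map⁻ _ x∈′
        ... | (d , e) , de∈ , refl with ∈-cartesianProduct⁻ (upTo (q ∸ suc u)) (upTo k) de∈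
        ... | d∈ , e∈ = (≤-trans (+-monoʳ-< (suc u) (∈-upTo⁻ d∈)) (≤-reflexive (m+[n∸m]≡n u<q)) , inj₂ (m≤m+n (suc u) d , ∈-upTo⁻ e∈)) ,
              >⇒≢ (m≤m+n (suc u) d)

        otherTerminals⁺ : ∀ {u x} → OK u x → proj₁ x ≢ u → x ∈ otherTerminals u
        otherTerminals⁺ {u} (_ , inj₁ (w<u , o< , ≤o)) _ = ∈-++⁺ˡ (oldTerminals⁺ u w<u o< ≤o)
        otherTerminals⁺ {u} {w , e} (w<q , inj₂ (u≤w , e<k)) w≢u = ∈-++⁺ʳ (oldTerminals u)
          (subst (λ z → (z , e) ∈ newTerminals u) eq
            (∈-map⁺ (λ (d , e) → suc u + d , e) (∈-cartesianProduct⁺ (∈-upTo⁺ (+-cancelˡ-< (suc u) _ _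
              (≤-trans (≤-reflexive (cong suc eq)) (≤-trans w<q (≤-reflexive (sym (m+[n∸m]≡n u<q))))))) (∈-upTo⁺ e<k))))
          where
          u<w : u < w
          u<w = ≤∧≢⇒< u≤w (λ eq → w≢u (sym eq))
          u<q : u < q
          u<q = <-trans u<w w<q
          eq : suc u + (w ∸ suc u) ≡ w
          eq = m+[n∸m]≡n u<w

        module Step (fits : off q < K) (u : ℕ) (u<q : u < q) (conf : Conf (suc u)) where

          open Conf conf

          lo = off u
          hi = off u + len u

          hi<K : hi < K
          hi<K = <-trans (off-mono u<q) fits

          Other : Set
          Other = Σ Terminal (_∈ otherTerminals u)

          ok : (x : Other) → OK (suc u) (proj₁ x)
          ok (_ , x∈) = proj₁ (otherTerminals⁻ u<q x∈)

          other : (x : Other) → proj₁ (proj₁ x) ≢ u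
          other (_ , x∈) = proj₂ (otherTerminals⁻ u<q x∈)

          okCell : (i : Cell lo hi) → OK (suc u) (u , proj₁ i)
          okCell (_ , lo< , ≤hi) = u<q , inj₁ (≤-refl , lo< , ≤hi)

          Distinct : Other × Other → Set
          Distinct (x , y) = proj₁ (proj₁ x) ≢ proj₁ (proj₁ y)

          distinct? : Decidable Distinct
          distinct? (x , y) = ¬? (proj₁ (proj₁ x) ≟ proj₁ (proj₁ y))

          os : List Other
          os = attach (otherTerminals u)

          os-length : length os ≤ others u
          os-length = ≤-trans (≤-reflexive (length-mapWith∈ (otherTerminals u) _)) (otherTerminals-length u)

          foreign : List (Other × Other)
          foreign = filter distinct? (cartesianProduct os os)

          Foreign : Set
          Foreign = Σ (Other × Other) (_∈ foreign)

          foreignWire : ((xy , _) : Foreign) → Wire (suc u) node (proj₁ (proj₁ xy)) (proj₁ (proj₂ xy))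
          foreignWire ((x , y) , xy∈) = wire (ok x) (ok y) (proj₂ (∈-filter⁻ distinct? {xs = cartesianProduct os os} xy∈))

          outWire : (i : Cell lo hi) (x : Other) → Wire (suc u) node (u , proj₁ i) (proj₁ x)
          outWire i x = wire (okCell i) (ok x) (λ eq → other x (sym eq))

          inWire : (i : Cell lo hi) (x : Other) → Wire (suc u) node (proj₁ x) (u , proj₁ i)
          inWire i x = wire (ok x) (okCell i) (other x)

          incident : List (Other ⊎ Other)
          incident = map inj₁ os ++ map inj₂ os

          incidentPaths : Cell lo hi → Other ⊎ Other → List Pth
          incidentPaths i (inj₁ x) = Wire.paths (outWire i x)
          incidentPaths i (inj₂ x) = Wire.paths (inWire i x)

          Chosen : Set
          Chosen = Slot lo hi (ord u) k (Wire.paths ∘ foreignWire) (attach foreign) incidentPaths incident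

          choose : AnchoredWeb ⊎ Chosen
          choose = select-slot (ord u) (others u + others u) (others u * others u) k (p≤ord u) hi<K ≤-refl
            (Wire.paths ∘ foreignWire) (attach foreign)
            (≤-trans (≤-reflexive (length-mapWith∈ foreign _)) (≤-trans (Listₚ.length-filter distinct? (cartesianProduct os os))
              (≤-trans (≤-reflexive (length-cartesianProduct os os)) (*-mono-≤ os-length os-length))))
            (λ {x} _ → Wire.linkage (foreignWire x) , ≤-trans (cm≤order (ord u) (others u + others u)) (≤-reflexive (sym (Wire.size (foreignWire x)))))
            incidentPaths incident
            (≤-trans (≤-reflexive (trans (length-++ (map inj₁ os)) (cong₂ _+_ (length-map inj₁ os) (length-map inj₂ os)))) (+-mono-≤ os-length os-length))
            (λ { i {inj₁ x} _ → Wire.linkage (outWire i x) , ≤-reflexive (sym (Wire.size (outWire i x)))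
               ; i {inj₂ x} _ → Wire.linkage (inWire i x) , ≤-reflexive (sym (Wire.size (inWire i x))) })

          module Update (chosen : Chosen) where

            open Selection (proj₁ chosen) using (cell; cleared) renaming (a to a₀; b to b₀; left to left₀; right to right₀)
            module Sel = Selection (proj₁ chosen)

            here-node : Node
            here-node = record { a = a₀ ; b = b₀ ; left = left₀ ; right = right₀ }

            node′ : ℕ → Node
            node′ s with s ≟ u
            ... | yes _ = here-node
            ... | no _  = node s

            node′-u : node′ u ≡ here-node
            node′-u with u ≟ u
            ... | yes _ = refl
            ... | no ¬p = ⊥-elim (¬p refl)

            node′-≢ : ∀ {s} → s ≢ u → node′ s ≡ node s
            node′-≢ {s} s≢ with s ≟ u
            ... | yes eq = ⊥-elim (s≢ eq)
            ... | no _ = refl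

            valid′ : ∀ {s} → u ≤ s → s < q → ValidNode s (node′ s)
            valid′ {s} u≤s s<q with m≤n⇒m<n∨m≡n u≤s
            ... | inj₁ u<s = subst (ValidNode s) (sym (node′-≢ (>⇒≢ u<s))) (valid u<s s<q)
            ... | inj₂ refl = subst (ValidNode u) (sym node′-u) record
              { lo≤a = Sel.lo≤a ; a<b = Sel.a<b ; b≤hi = Sel.b≤hi ; a<left = Sel.a<left
              ; left<right = λ r< → <-≤-trans (Sel.left< r<) (Sel.<right r<) ; right<b = Sel.right<b ; separate = Sel.separate }

            at-other : ∀ {x v} → proj₁ x ≢ u → At (suc u) node x v → At u node′ x v
            at-other {w , e} w≢ (inj₁ (w< , q)) = inj₁ (≤∧≢⇒< (s≤s⁻¹ w<) w≢ , q)
            at-other {w , e} {v} w≢ (inj₂ (u<w , o)) = inj₂ (<⇒≤ u<w , subst (λ d → Open (left d e) (right d e) v) (sym (node′-≢ w≢)) o)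

            at-here : ∀ {e v} (e< : e < k) → At (suc u) node (u , proj₁ (cell e<)) v → At u node′ (u , e) v
            at-here {e} {v} e< (inj₁ (_ , q)) = inj₂ (≤-refl , subst (λ d → Open (left d e) (right d e) v) (sym node′-u)
              (_ , ≤-trans ≤-refl (dbl-mono (Sel.left< e<)) , s≤s (dbl-mono (Sel.<right e<)) , q))
            at-here e< (inj₂ (u<u , _)) = ⊥-elim (<-irrefl refl u<u)

            off-area : ∀ {s v} → suc u ≤ s → s < q → InRange (a (node s)) (b (node s)) v → ¬ InRange lo hi v
            off-area u<s s<q r r′ = slots-disjoint fits s<q u<q (>⇒≢ u<s)
              (range-widen (ValidNode.lo≤a (valid u<s s<q)) (ValidNode.b≤hi (valid u<s s<q)) r) r′

            through-other : ∀ {x s v} → suc u ≤ s → Through (suc u) node x s v → Through u node′ x s v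
            through-other {w , e} {s} {v} u<s (eq , o) = eq , subst (λ d → Open (left d e) (right d e) v) (sym (node′-≢ (>⇒≢ u<s))) o

            through-cell : ∀ {i s v} {A : Set} → suc u ≤ s → Through (suc u) node (u , i) s v → A
            through-cell u<s (eq , _) = ⊥-elim (>⇒≢ u<s eq)

            ok-other : ∀ {x} → OK u x → proj₁ x ≢ u → Other
            ok-other {x} okx x≢ = x , otherTerminals⁺ okx x≢

            os⁺ : ∀ (x : Other) → x ∈ os
            os⁺ (x , x∈) = mapWith∈⁺ _ x∈

            in-region : ∀ {e v} (e< : e < k) → InRange a₀ b₀ v → ¬ InShell ((a₀ , left₀ e) , (right₀ e , b₀)) v → Through u node′ (u , e) u v
            in-region {e} {v} e< (κ , lo≤ , ≤hi , q) ¬shell = refl , subst (λ d → Open (left d e) (right d e) v) (sym node′-u)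
              (κ , ≰⇒> (λ le → ¬shell (inj₁ (κ , lo≤ , le , q))) , ≰⇒> (λ le → ¬shell (inj₂ (κ , le , ≤hi , q))) , q)

            range-u : ∀ {v} → InRange (a (node′ u)) (b (node′ u)) v → InRange a₀ b₀ v
            range-u {v} = subst (λ d → InRange (a d) (b d) v) node′-u

            range-s : ∀ {s v} → suc u ≤ s → InRange (a (node′ s)) (b (node′ s)) v → InRange (a (node s)) (b (node s)) v
            range-s {s} {v} u<s = subst (λ d → InRange (a d) (b d) v) (node′-≢ (>⇒≢ u<s))

            rewire : ∀ {x y x₀ y₀ Bad} (w : Wire (suc u) node x₀ y₀) → Cleared lo hi (ord u) (Wire.paths w) Bad →
              (∀ {v} → At (suc u) node x₀ v → At u node′ x v) → (∀ {v} → At (suc u) node y₀ v → At u node′ y v) →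
              (∀ {s v} → suc u ≤ s → Through (suc u) node x₀ s v → Through u node′ x s v) →
              (∀ {s v} → suc u ≤ s → Through (suc u) node y₀ s v → Through u node′ y s v) →
              (∀ {v} → InRange a₀ b₀ v → ¬ Bad v → Through u node′ x u v ⊎ Through u node′ y u v) → Wire u node′ x y
            rewire {x} {y} w cl atx aty thx thy here-clean = record
              { paths = Cleared.paths cl ; linkage = Cleared.linkage cl ; size = Cleared.size cl
              ; starts = λ P∈ → case ∈-map⁻ st (Cleared.starts cl P∈) of λ (Q , Q∈ , eq) → subst (At u node′ x) (sym eq) (atx (Wire.starts w Q∈))
              ; ends = λ P∈ → case ∈-map⁻ en (Cleared.ends cl P∈) of λ (Q , Q∈ , eq) → subst (At u node′ y) (sym eq) (aty (Wire.ends w Q∈))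
              ; clean = clean }
              where
              clean : ∀ {s v} → u ≤ s → s < q → v ∈ᵥ Cleared.paths cl → InRange (a (node′ s)) (b (node′ s)) v →
                Through u node′ x s v ⊎ Through u node′ y s v
              clean u≤s s<q v∈ r = case m≤n⇒m<n∨m≡n u≤s of λ
                { (inj₂ refl) → here-clean (range-u r) (Cleared.clear cl v∈)
                ; (inj₁ u<s) → case Cleared.vert cl v∈ of λ
                  -- Rerouting for slot `u` adds vertices of slot `u` only, so it creates no contact
                  -- with an interval chosen in a later slot.
                  { (inj₂ r′) → ⊥-elim (off-area u<s s<q (range-s u<s r) r′)
                  ; (inj₁ v∈′) → [ inj₁ ∘ thx u<s , inj₂ ∘ thy u<s ]′ (Wire.clean w u<s s<q v∈′ (range-s u<s r)) } }

            region< : ∀ {e} → OK u (u , e) → e < k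
            region< (_ , inj₁ (u<u , _)) = ⊥-elim (<-irrefl refl u<u)
            region< (_ , inj₂ (_ , e<))  = e<

            wire′ : ∀ {x y} → OK u x → OK u y → proj₁ x ≢ proj₁ y → Wire u node′ x y
            wire′ {w , e} {w′ , e′} okx oky w≢ with w ≟ u | w′ ≟ u
            ... | yes refl | yes refl = ⊥-elim (w≢ refl)
            ... | yes refl | no w′≢ = rewire (outWire (cell e<) y) (cleared e< (∈-++⁺ˡ (∈-map⁺ inj₁ (os⁺ y))))
                  (at-here e<) (at-other w′≢) through-cell through-other (λ r ¬sh → inj₁ (in-region e< r ¬sh))
              where e< = region< okx
                    y = ok-other oky w′≢
            ... | no w≢u | yes refl = rewire (inWire (cell e<) x) (cleared e< (∈-++⁺ʳ (map inj₁ os) (∈-map⁺ inj₂ (os⁺ x))))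
                  (at-other w≢u) (at-here e<) through-other through-cell (λ r ¬sh → inj₂ (in-region e< r ¬sh))
              where e< = region< oky
                    x = ok-other okx w≢u
            ... | no w≢u | no w′≢u = rewire (foreignWire xy) (proj₂ chosen (mapWith∈⁺ _ (proj₂ xy)))
                  (at-other w≢u) (at-other w′≢u) through-other through-other (λ r ¬r → ⊥-elim (¬r r))
              where
              xy : Foreign
              xy = (ok-other okx w≢u , ok-other oky w′≢u) ,
                ∈-filter⁺ distinct? (∈-cartesianProduct⁺ (os⁺ (ok-other okx w≢u)) (os⁺ (ok-other oky w′≢u))) w≢

            conf′ : Conf u
            conf′ = record { node = node′ ; valid = valid′ ; wire = wire′ }

          advance : AnchoredWeb ⊎ Conf u
          advance = [ inj₁ , inj₂ ∘ Update.conf′ ]′ choose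

        process : off q < K → ∀ u → u ≤ q → Conf u → AnchoredWeb ⊎ Conf 0
        process fits zero    _   conf = inj₂ conf
        process fits (suc u) u<q conf = [ inj₁ , process fits u (<⇒≤ u<q) ]′ (Step.advance fits u u<q conf)

        initial : off q < K → n₀ ≡ ord q → Conf q
        initial fits n₀≡ = record
          { node = λ _ → record { a = 0 ; b = 0 ; left = id ; right = id }
          ; valid = λ q≤ <q → ⊥-elim (<⇒≱ <q q≤)
          ; wire = λ okx oky ne → first okx oky ne }
          where
          cell≤K : ∀ {x} → OK q x → proj₂ x ≤ K
          cell≤K (_ , inj₁ (w< , _ , le)) = ≤-trans le (<⇒≤ (<-trans (off-mono w<) fits))
          cell≤K (w< , inj₂ (q≤ , _)) = ⊥-elim (<⇒≱ w< q≤)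
          distinct : ∀ {x y} → OK q x → OK q y → proj₁ x ≢ proj₁ y → proj₂ x ≢ proj₂ y
          distinct {w , e} {w′ , _} (_ , inj₁ (w< , o< , le)) (_ , inj₁ (w′< , o′< , le′)) ne refl with <-cmp w w′
          ... | tri< lt _ _ = <⇒≱ o′< (≤-trans le (<⇒≤ (off-mono lt)))
          ... | tri≈ _ eq _ = ne eq
          ... | tri> _ _ gt = <⇒≱ o< (≤-trans le′ (<⇒≤ (off-mono gt)))
          distinct (w< , inj₂ (q≤ , _)) _ _ = ⊥-elim (<⇒≱ w< q≤)
          distinct _ (w< , inj₂ (q≤ , _)) _ = ⊥-elim (<⇒≱ w< q≤)
          first : ∀ {x y} → OK q x → OK q y → proj₁ x ≢ proj₁ y → Wire q _ x y
          first okx oky ne with join (cell≤K okx) (cell≤K oky) (distinct okx oky ne)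
          ... | L , lk , size , ss , es = record
            { paths = L ; linkage = lk ; size = trans size n₀≡
            ; starts = λ P∈ → inj₁ (proj₁ okx , ss P∈) ; ends = λ P∈ → inj₁ (proj₁ oky , es P∈)
            ; clean = λ q≤ <q → ⊥-elim (<⇒≱ <q q≤) }

      open Configurations public

      -- Routing one path per commodity

      module Commodities where

        -- Zone z consists of the regions inR z t followed by the regions outR z t, for t < width.
        inR outR : ℕ → ℕ → ℕ
        inR z t  = z * (width + width) + t
        outR z t = z * (width + width) + (width + t)

        zone-below : ∀ {z z′ x x′} → z < z′ → x < width + width → z * (width + width) + x < z′ * (width + width) + x′
        zone-below {z} {z′} lt x< = <-≤-trans (+-monoʳ-< (z * (width + width)) x<)
          (≤-trans (≤-reflexive (+-comm (z * (width + width)) _)) (≤-trans (*-monoˡ-≤ (width + width) lt) (m≤m+n _ _)))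

        zone-unique : ∀ {z z′ x x′} → x < width + width → x′ < width + width →
          z * (width + width) + x ≡ z′ * (width + width) + x′ → z ≡ z′ × x ≡ x′
        zone-unique {z} {z′} {x} {x′} x< x′< eq with <-cmp z z′
        ... | tri≈ _ refl _ = refl , +-cancelˡ-≡ (z * (width + width)) x x′ eq
        ... | tri< lt _ _ = ⊥-elim (<-irrefl eq (zone-below lt x<))
        ... | tri> _ _ gt = ⊥-elim (<-irrefl (sym eq) (zone-below gt x′<))

        inR-small : ∀ {t} → t < width → t < width + width
        inR-small t< = ≤-trans t< (m≤m+n width width)

        outR-small : ∀ {t} → t < width → width + t < width + width
        outR-small t< = +-monoʳ-< width t<

        region<k : ∀ {z x} → z < zones → x < width + width → z * (width + width) + x < k
        region<k {z} z< x< = <-≤-trans (+-monoʳ-< (z * (width + width)) x<)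
          (≤-trans (≤-reflexive (+-comm (z * (width + width)) _)) (*-monoˡ-≤ (width + width) z<))

        inR≢outR : ∀ {z z′ t t′} → t < width → t′ < width → inR z t ≢ outR z′ t′
        inR≢outR {z} {z′} {t} {t′} t< t′< eq = <⇒≱ t< (subst (width ≤_) (sym (proj₂ (zone-unique {z} {z′} (inR-small t<) (outR-small t′<) eq))) (m≤m+n width t′))

        module Routing (fits : off q < K) (conf : Conf 0) where

          open Conf conf

          nodeI : ℕ → Interval
          nodeI s = Node.a (node s) , Node.b (node s)

          regionI : ℕ → ℕ → Interval
          regionI s r = Node.left (node s) r , Node.right (node s) r

          off≤ : ∀ {s} → s < q → off s + len s ≤ off q
          off≤ s< = <⇒≤ (off-mono s<)

          node-valid : ∀ {s} → s < q → Valid 0 (off q) (nodeI s)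
          node-valid s< = let open ValidNode (valid z≤n s<) in z≤n , a<b , ≤-trans b≤hi (off≤ s<)

          region-valid : ∀ {s r} → s < q → r < k → Valid 0 (off q) (regionI s r)
          region-valid s< r< = let open ValidNode (valid z≤n s<) in
            z≤n , left<right r< , ≤-trans (<⇒≤ (right<b r<)) (≤-trans b≤hi (off≤ s<))

          D : ℕ → Pth
          D s = segOf (nodeI s)

          R : ℕ → ℕ → Pth
          R s r = segOf (regionI s r)

          D-disjoint : ∀ {s s′ v} → s < q → s′ < q → v ∈ vts (D s) → v ∈ vts (D s′) → s ≡ s′
          D-disjoint {s} {s′} s< s′< v∈ v∈′ with s ≟ s′
          ... | yes eq = eq
          ... | no ne = ⊥-elim (slots-disjoint fits s< s′< ne (area s< v∈) (area s′< v∈′))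
            where
            area : ∀ {s v} → s < q → v ∈ vts (D s) → InRange (off s) (off s + len s) v
            area s< v∈ = let open ValidNode (valid z≤n s<) in range-widen lo≤a b≤hi (segOf-range fits (node-valid s<) v∈)

          R⊆D : ∀ {s r v} → s < q → r < k → v ∈ vts (R s r) → v ∈ vts (D s)
          R⊆D s< r< v∈ = let open ValidNode (valid z≤n s<) in range-segOf fits (node-valid s<)
            (range-widen (<⇒≤ (a<left r<)) (<⇒≤ (right<b r<)) (segOf-range fits (region-valid s< r<) v∈))

          right<left : ∀ {s r r′} → s < q → r < r′ → r′ < k → Node.right (node s) r < Node.left (node s) r′
          right<left {s} {r} {suc r′} s< r<r′ r′< with m≤n⇒m<n∨m≡n (s≤s⁻¹ r<r′)
          ... | inj₂ refl = ValidNode.separate (valid z≤n s<) r′<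
          ... | inj₁ lt = <-trans (right<left s< lt (<-trans ≤-refl r′<))
                (<-trans (ValidNode.left<right (valid z≤n s<) (<-trans ≤-refl r′<)) (ValidNode.separate (valid z≤n s<) r′<))

          R-disjoint : ∀ {s s′ r r′ v} → s < q → s′ < q → r < k → r′ < k → v ∈ vts (R s r) → v ∈ vts (R s′ r′) → s ≡ s′ × r ≡ r′
          R-disjoint {s} {s′} {r} {r′} s< s′< r< r′< v∈ v∈′ with D-disjoint s< s′< (R⊆D s< r< v∈) (R⊆D s′< r′< v∈′)
          ... | refl with <-cmp r r′
          ... | tri≈ _ eq _ = refl , eq
          ... | tri< lt _ _ = ⊥-elim (segOf-apart fits (region-valid s< r<) (region-valid s< r′<) (inj₁ (right<left s< lt r′<)) _ v∈ v∈′)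
          ... | tri> _ _ gt = ⊥-elim (segOf-apart fits (region-valid s< r<) (region-valid s< r′<) (inj₂ (right<left s< gt r<)) _ v∈ v∈′)

          Free : Pr
          Free v = ∀ {s} → s < q → v ∉ vts (D s)

          -- Commodity (s , z) is routed from the out-regions of zone z of D s to the in-regions of zone z of D (suc s).
          Commodity : Set
          Commodity = ℕ × ℕ

          Proper : Commodity → Set
          Proper (s , z) = suc s < q × z < zones

          srcSeg snkSeg : Commodity → ℕ → Pth
          srcSeg (s , z) t = R s (outR z t)
          snkSeg (s , z) t = R (suc s) (inR z t)

          Src Snk : Commodity → Pr
          Src e v = ∃[ t ] (t < width × v ∈ vts (srcSeg e t))
          Snk e v = ∃[ t ] (t < width × v ∈ vts (snkSeg e t))

          SrcEdge SnkEdge : Commodity → Rel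
          SrcEdge e u v = ∃[ t ] (t < width × (u , v) ∈ eds (srcSeg e t))
          SnkEdge e u v = ∃[ t ] (t < width × (u , v) ∈ eds (snkSeg e t))

          -- One-way traffic: a `between` edge never enters a source nor leaves a sink, and apart
          -- from its own regions a commodity avoids every `D s`. This is what makes `purify`
          -- possible when bundles are rerouted along one another.
          data Ed (e : Commodity) (u v : Vertex) : Set where
            leaving  : SrcEdge e u v → Ed e u v
            between  : Src e u ⊎ Free u → Free v ⊎ Snk e v → Ed e u v
            arriving : SnkEdge e u v → Ed e u v

          ed? : ∀ e u v → Dec (Ed e u v)
          ed? e u v with anyUpTo? (λ t → DecMem._∈?_ (≡-dec Fin._≟_ Fin._≟_) (u , v) (eds (srcSeg e t))) width
                       | anyUpTo? (λ t → DecMem._∈?_ (≡-dec Fin._≟_ Fin._≟_) (u , v) (eds (snkSeg e t))) width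
          ... | yes a | _ = yes (leaving a)
          ... | no _ | yes b = yes (arriving b)
          ... | no ¬a | no ¬b with anyUpTo? (λ t → u ∈? vts (srcSeg e t)) width | allUpTo? (λ s → ¬? (u ∈? vts (D s))) q
                                 | anyUpTo? (λ t → v ∈? vts (snkSeg e t)) width | allUpTo? (λ s → ¬? (v ∈? vts (D s))) q
          ... | yes x | _ | yes y | _ = yes (between (inj₁ x) (inj₂ y))
          ... | yes x | _ | _ | yes y = yes (between (inj₁ x) (inj₁ y))
          ... | _ | yes x | yes y | _ = yes (between (inj₂ x) (inj₂ y))
          ... | _ | yes x | _ | yes y = yes (between (inj₂ x) (inj₁ y))
          ... | no ¬x | no ¬x′ | _ | _ = no λ { (leaving a) → ¬a a ; (arriving b) → ¬b b ; (between x _) → [ ¬x , (λ f → ¬x′ (λ {s} → f {s})) ]′ x }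
          ... | _ | _ | no ¬y | no ¬y′ = no λ { (leaving a) → ¬a a ; (arriving b) → ¬b b ; (between _ y) → [ (λ f → ¬y′ (λ {s} → f {s})) , ¬y ]′ y }

          srcFirst snkLast : Commodity → ℕ → Vertex
          srcFirst (s , z) t = stn (Node.left (node s) (outR z t))
          snkLast (s , z) t  = stn (Node.right (node (suc s)) (inR z t))

          -- The ends are stations at the outer ends of regions. They lie in `A`, so a bundle of
          -- such paths can itself be the `𝒬` of a web.
          record Typed (e : Commodity) (P : Pth) : Set where
            field
              starts : ∃[ t ] (t < width × st P ≡ srcFirst e t)
              ends   : ∃[ t ] (t < width × en P ≡ snkLast e t)
              uses   : Ed e ⊢ P

          module _ {e : Commodity} (proper : Proper e) where

            private
              s< : proj₁ e < q
              s< = <-trans ≤-refl (proj₁ proper)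
              z< = proj₂ proper

            src< : ∀ {t} → t < width → outR (proj₂ e) t < k
            src< t< = region<k {proj₂ e} z< (outR-small t<)

            snk< : ∀ {t} → t < width → inR (proj₂ e) t < k
            snk< t< = region<k {proj₂ e} z< (inR-small t<)

            srcSeg-st : ∀ {t} → t < width → st (srcSeg e t) ≡ srcFirst e t
            srcSeg-st t< = let _ , lt , le = region-valid s< (src< t<) in seg-st (<⇒≤ lt) (≤-<-trans le fits)

            snkSeg-en : ∀ {t} → t < width → en (snkSeg e t) ≡ snkLast e t
            snkSeg-en t< = let _ , lt , le = region-valid (proj₁ proper) (snk< t<) in seg-en (<⇒≤ lt) (≤-<-trans le fits)

            srcFirst-Src : ∀ {t} → t < width → Src e (srcFirst e t)
            srcFirst-Src {t} t< = t , t< , subst (_∈ vts (srcSeg e t)) (srcSeg-st t<) (st∈ (srcSeg e t))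

            snkLast-Snk : ∀ {t} → t < width → Snk e (snkLast e t)
            snkLast-Snk {t} t< = t , t< , subst (_∈ vts (snkSeg e t)) (snkSeg-en t<) (en∈ (snkSeg e t))

            srcFirst∈A : ∀ {t} → t < width → srcFirst e t ∈ₛ A
            srcFirst∈A t< = let _ , lt , le = region-valid s< (src< t<) in stn∈A (<-trans lt (≤-<-trans le fits))

            snkLast∈A : ∀ {t} → t < width → snkLast e t ∈ₛ A
            snkLast∈A t< = let _ , lt , le = region-valid (proj₁ proper) (snk< t<) in stn∈A (≤-<-trans le fits)

            Src⊆D : ∀ {v} → Src e v → v ∈ vts (D (proj₁ e))
            Src⊆D (t , t< , v∈) = R⊆D s< (src< t<) v∈

            Snk⊆D : ∀ {v} → Snk e v → v ∈ vts (D (suc (proj₁ e)))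
            Snk⊆D (t , t< , v∈) = R⊆D (proj₁ proper) (snk< t<) v∈

            Src-Free : ∀ {v} → Src e v → ¬ Free v
            Src-Free s f = f s< (Src⊆D s)

            Snk-Free : ∀ {v} → Snk e v → ¬ Free v
            Snk-Free s f = f (proj₁ proper) (Snk⊆D s)

            Typed-nontrivial : ∀ {P} → Typed e P → Nontrivial P
            Typed-nontrivial ty eq with Typed.starts ty | Typed.ends ty
            ... | t , t< , st≡ | t′ , t′< , en≡ = 1+n≢n (sym (D-disjoint s< (proj₁ proper) (Src⊆D (srcFirst-Src t<))
                  (subst (λ v → v ∈ vts (D (suc (proj₁ e)))) (trans (sym en≡) (trans (sym eq) st≡)) (Snk⊆D (snkLast-Snk t′<)))))

          Src-Src : ∀ {e f v} → Proper e → Proper f → Src e v → Src f v → e ≡ f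
          Src-Src {s , z} {s′ , z′} pe pf (t , t< , v∈) (t′ , t′< , v∈′) =
            let s≡ , r≡ = R-disjoint (<-trans ≤-refl (proj₁ pe)) (<-trans ≤-refl (proj₁ pf)) (src< pe t<) (src< pf t′<) v∈ v∈′
            in cong₂ _,_ s≡ (proj₁ (zone-unique {z} {z′} (outR-small t<) (outR-small t′<) r≡))

          Snk-Snk : ∀ {e f v} → Proper e → Proper f → Snk e v → Snk f v → e ≡ f
          Snk-Snk {s , z} {s′ , z′} pe pf (t , t< , v∈) (t′ , t′< , v∈′) =
            let s≡ , r≡ = R-disjoint (proj₁ pe) (proj₁ pf) (snk< pe t<) (snk< pf t′<) v∈ v∈′
            in cong₂ _,_ (suc-injective s≡) (proj₁ (zone-unique {z} {z′} (inR-small t<) (inR-small t′<) r≡))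

          Src-Snk : ∀ {e f v} → Proper e → Proper f → Src e v → Snk f v → ⊥
          Src-Snk {s , z} {s′ , z′} pe pf (t , t< , v∈) (t′ , t′< , v∈′) =
            inR≢outR {z′} {z} t′< t< (sym (proj₂ (R-disjoint (<-trans ≤-refl (proj₁ pe)) (proj₁ pf) (src< pe t<) (snk< pf t′<) v∈ v∈′)))

          -- A path of commodity f using edges of another commodity e uses them only between free vertices: it cannot enter
          -- the sources of e, nor leave its sinks.
          purify : ∀ {e f P} → Proper e → Proper f → e ≢ f → (∃[ t ] (t < width × st P ≡ srcFirst f t)) →
            (∃[ t ] (t < width × en P ≡ snkLast f t)) → (λ u v → Ed f u v ⊎ Ed e u v) ⊢ P → Ed f ⊢ P
          purify {e} {f} {P} pe pf e≢f (t , t< , st≡) (t′ , t′< , en≡) l =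
            go (subst (λ v → Src f v ⊎ Free v ⊎ Snk f v) (sym st≡) (inj₁ (srcFirst-Src pf t<)))
               (subst (Snk f) (sym en≡) (snkLast-Snk pf t′<)) l
            where
            Class : Pr
            Class v = Src f v ⊎ Free v ⊎ Snk f v
            stuck : ∀ {x xs} → Snk e x → Linked (λ u v → Ed f u v ⊎ Ed e u v) (x ∷ xs) → Snk e (lastOf G x xs)
            stuck s [-] = s
            stuck s (inj₁ (leaving (t , t< , uv∈)) ∷ l)   = ⊥-elim (Src-Snk pf pe (t , t< , pair-left∈ uv∈) s)
            stuck s (inj₁ (between (inj₁ a) _) ∷ l)       = ⊥-elim (Src-Snk pf pe a s)
            stuck s (inj₁ (between (inj₂ a) _) ∷ l)       = ⊥-elim (Snk-Free pe s a)
            stuck s (inj₁ (arriving (t , t< , uv∈)) ∷ l)  = ⊥-elim (e≢f (Snk-Snk pe pf s (t , t< , pair-left∈ uv∈)))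
            stuck s (inj₂ (leaving (t , t< , uv∈)) ∷ l)   = ⊥-elim (Src-Snk pe pe (t , t< , pair-left∈ uv∈) s)
            stuck s (inj₂ (between (inj₁ a) _) ∷ l)       = ⊥-elim (Src-Snk pe pe a s)
            stuck s (inj₂ (between (inj₂ a) _) ∷ l)       = ⊥-elim (Snk-Free pe s a)
            stuck s (inj₂ (arriving (t , t< , uv∈)) ∷ l)  = stuck (t , t< , there (pair-right∈ uv∈)) l
            notSrc : ∀ {v} → Class v → ¬ Src e v
            notSrc (inj₁ a) b        = e≢f (Src-Src pe pf b a)
            notSrc (inj₂ (inj₁ a)) b = Src-Free pe b a
            notSrc (inj₂ (inj₂ a)) b = Src-Snk pe pf b a
            go : ∀ {x xs} → Class x → Snk f (lastOf G x xs) → Linked (λ u v → Ed f u v ⊎ Ed e u v) (x ∷ xs) → Linked (Ed f) (x ∷ xs)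
            go cl last [-] = [-]
            go cl last (inj₁ d ∷ l) = d ∷ go (next′ d) last l
              where
              next′ : ∀ {u v} → Ed f u v → Class v
              next′ (leaving (t , t< , uv∈))  = inj₁ (t , t< , there (pair-right∈ uv∈))
              next′ (between _ (inj₁ a))      = inj₂ (inj₁ (λ {s} → a {s}))
              next′ (between _ (inj₂ a))      = inj₂ (inj₂ a)
              next′ (arriving (t , t< , uv∈)) = inj₂ (inj₂ (t , t< , there (pair-right∈ uv∈)))
            go cl last (inj₂ (leaving (t , t< , uv∈)) ∷ l) = ⊥-elim (notSrc cl (t , t< , pair-left∈ uv∈))
            go cl last (inj₂ (between (inj₁ a) _) ∷ l) = ⊥-elim (notSrc cl a)
            go cl last (inj₂ (between (inj₂ a) (inj₁ b)) ∷ l) = between (inj₂ (λ {s} → a {s})) (inj₁ (λ {s} → b {s})) ∷ go (inj₂ (inj₁ (λ {s} → b {s}))) last l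
            go cl last (inj₂ (between (inj₂ a) (inj₂ b)) ∷ l) = ⊥-elim (e≢f (Snk-Snk pe pf (stuck b l) last))
            go cl last (inj₂ (arriving (t , t< , uv∈)) ∷ l) = ⊥-elim (no-sink cl)
              where
              no-sink : Class _ → ⊥
              no-sink (inj₁ a)        = Src-Snk pf pe a (t , t< , pair-left∈ uv∈)
              no-sink (inj₂ (inj₁ a)) = Snk-Free pe (t , t< , pair-left∈ uv∈) a
              no-sink (inj₂ (inj₂ a)) = e≢f (Snk-Snk pe pf (t , t< , pair-left∈ uv∈) a)

          commodityEdges : Commodity → List VertexEdge
          commodityEdges e = filter (λ (u , v) → ed? e u v) allEdges

          ∈-commodityEdges⁺ : ∀ {e u v} → Edge G u v → Ed e u v → OnList (commodityEdges e) u v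
          ∈-commodityEdges⁺ {e} uv d = ∈-filter⁺ (λ (u , v) → ed? e u v) (⇒allEdges uv) d

          ∈-commodityEdges⁻ : ∀ {e u v} → OnList (commodityEdges e) u v → Edge G u v × Ed e u v
          ∈-commodityEdges⁻ {e} uv∈ = let a , d = ∈-filter⁻ (λ (u , v) → ed? e u v) {xs = allEdges} uv∈ in allEdges⇒ a , d

          record Bundle (e : Commodity) (r : ℕ) : Set where
            field
              paths   : List Pth
              linkage : Linkage paths
              size    : r ≤ length paths
              typed   : ∀ {P} → P ∈ paths → Typed e P

          open-region : ∀ {s r v} → s < q → r < k → Open (Node.left (node s) r) (Node.right (node s) r) v → v ∈ vts (R s r)
          open-region s< r< (κ , a , b , q) = range-segOf fits (region-valid s< r<) (κ , <⇒≤ a , <⇒≤ b , q)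

          -- The part of a wire between its last vertex on D s and its next vertex on D (suc s) has a free interior; it is
          -- completed along the two regions it touches.
          module _ {s z t t′} (pe : Proper (s , z)) (t< : t < width) (t′< : t′ < width)
                   (W : Wire 0 node (s , outR z t) (suc s , inR z t′)) where

            private
              e : Commodity
              e = s , z
              s< : s < q
              s< = <-trans ≤-refl (proj₁ pe)
              s′< : suc s < q
              s′< = proj₁ pe

            open Wire W

            in-source : ∀ {X v} → X ∈ paths → v ∈ vts X → v ∈ vts (D s) → v ∈ vts (srcSeg e t)
            in-source X∈ v∈ v∈D = case clean z≤n s< (_ , X∈ , v∈) (segOf-range fits (node-valid s<) v∈D) of λ
              { (inj₁ (_ , o)) → open-region s< (src< pe t<) o
              ; (inj₂ (eq , _)) → ⊥-elim (1+n≢n (sym eq)) }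

            in-sink : ∀ {X v} → X ∈ paths → v ∈ vts X → v ∈ vts (D (suc s)) → v ∈ vts (snkSeg e t′)
            in-sink X∈ v∈ v∈D = case clean z≤n s′< (_ , X∈ , v∈) (segOf-range fits (node-valid s′<) v∈D) of λ
              { (inj₁ (eq , _)) → ⊥-elim (1+n≢n eq)
              ; (inj₂ (_ , o)) → open-region s′< (snk< pe t′<) o }

            free-between : ∀ {X v} → X ∈ paths → v ∈ vts X → v ∉ vts (D s) → v ∉ vts (D (suc s)) → Free v
            free-between X∈ v∈ v∉ v∉′ {s″} s″< v∈D = case clean z≤n s″< (_ , X∈ , v∈) (segOf-range fits (node-valid s″<) v∈D) of λ
              { (inj₁ (eq , _)) → v∉ (subst (λ i → _ ∈ vts (D i)) eq v∈D)
              ; (inj₂ (eq , _)) → v∉′ (subst (λ i → _ ∈ vts (D i)) eq v∈D) }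

            starts-D : ∀ {X} → X ∈ paths → st X ∈ vts (D s)
            starts-D X∈ = case starts X∈ of λ { (inj₁ (() , _)) ; (inj₂ (_ , o)) → R⊆D s< (src< pe t<) (open-region s< (src< pe t<) o) }

            ends-D : ∀ {X} → X ∈ paths → en X ∈ vts (D (suc s))
            ends-D X∈ = case ends X∈ of λ { (inj₁ (() , _)) ; (inj₂ (_ , o)) → R⊆D s′< (snk< pe t′<) (open-region s′< (snk< pe t′<) o) }

            complete : ∀ {X a b} → X ∈ paths → a ∈ vts (D s) → b ∈ vts (D (suc s)) → a ∈ vts X → b ∈ vts X →
              Walk (λ u v → Edge G u v × (u ≡ a ⊎ u ∉ vts (D s)) × u ∉ vts (D (suc s)) × v ∉ vts (D s)) (_∈ vts X) a b →
              Walk (OnList (commodityEdges e)) (λ v → v ∈ vts X ⊎ v ∈ vts (srcSeg e t) ⊎ v ∈ vts (snkSeg e t′))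
                (st (srcSeg e t)) (en (snkSeg e t′))
            complete {X} {a} {b} X∈ a∈D b∈D a∈X b∈X w =
              walk-map (λ _ _ uv → ∈-commodityEdges⁺ (linked⇒ (Path.linked (srcSeg e t)) uv) (leaving (t , t< , uv))) (inj₂ ∘ inj₁ ∘ proj₁)
                (prefixWalk {P = srcSeg e t} (⇒linked id) (in-source X∈ a∈X a∈D)) ⧺
              (walk-map edge inj₁ w ⧺
               walk-map (λ _ _ uv → ∈-commodityEdges⁺ (linked⇒ (Path.linked (snkSeg e t′)) uv) (arriving (t′ , t′< , uv))) (inj₂ ∘ inj₂ ∘ proj₁)
                (suffixWalk {P = snkSeg e t′} (⇒linked id) (in-sink X∈ b∈X b∈D)))
              where
              head : ∀ {v} → v ∈ vts X → v ∉ vts (D s) → Dec (v ∈ vts (D (suc s))) → Free v ⊎ Snk e v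
              head v∈ v∉ (yes v∈D) = inj₂ (t′ , t′< , in-sink X∈ v∈ v∈D)
              head v∈ v∉ (no v∉D)  = inj₁ (free-between X∈ v∈ v∉ v∉D)
              tail : ∀ {u} → u ∈ vts X → u ≡ a ⊎ u ∉ vts (D s) → u ∉ vts (D (suc s)) → Src e u ⊎ Free u
              tail _  (inj₁ refl) _  = inj₁ (t , t< , in-source X∈ a∈X a∈D)
              tail u∈ (inj₂ u∉)  u∉′ = inj₂ (free-between X∈ u∈ u∉ u∉′)
              edge : ∀ {u v} → u ∈ vts X → v ∈ vts X → Edge G u v × (u ≡ a ⊎ u ∉ vts (D s)) × u ∉ vts (D (suc s)) × v ∉ vts (D s) →
                OnList (commodityEdges e) u v
              edge {v = v} u∈ v∈ (uv , u? , u∉′ , v∉) = ∈-commodityEdges⁺ uv (between (tail u∈ u? u∉′) (head v∈ v∉ (v ∈? vts (D (suc s)))))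

            wire-walk : ∀ {X} → X ∈ paths → Walk (OnList (commodityEdges e))
              (λ v → v ∈ vts X ⊎ v ∈ vts (srcSeg e t) ⊎ v ∈ vts (snkSeg e t′)) (st (srcSeg e t)) (en (snkSeg e t′))
            wire-walk {X} X∈ = case stretch (_∈? vts (D s)) (_∈? vts (D (suc s))) (pathWalk {P = X} (Path.linked X)) (starts-D X∈) (ends-D X∈) of
              λ (a , b , a∈D , b∈D , a∈X , b∈X , w) → complete X∈ a∈D b∈D a∈X b∈X w

          -- A separator smaller than the width misses a source region, a sink region, and a path of the wire between them.
          no-separator : ∀ {e} → Proper e → ∀ S → length S < width →
            ∃[ t ] ∃[ t′ ] (t < width × t′ < width × Walk (OnList (commodityEdges e)) (_∉ S) (srcFirst e t) (snkLast e t′))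
          no-separator {e@(s , z)} pe S lt = case free-src , free-snk of λ ((t , t∈ , off-src) , (t′ , t′∈ , off-snk)) →
            case free-path (∈-upTo⁻ t∈) (∈-upTo⁻ t′∈) of λ (X , X∈ , off-X) →
            t , t′ , ∈-upTo⁻ t∈ , ∈-upTo⁻ t′∈ , subst₂ (Walk (OnList (commodityEdges e)) (_∉ S)) (srcSeg-st pe (∈-upTo⁻ t∈)) (snkSeg-en pe (∈-upTo⁻ t′∈))
              (walk-map (λ _ _ uv → uv) [ off-X , [ off-src , off-snk ]′ ]′ (wire-walk pe (∈-upTo⁻ t∈) (∈-upTo⁻ t′∈) (the-wire (∈-upTo⁻ t∈) (∈-upTo⁻ t′∈)) X∈))
            where
            s< : s < q
            s< = <-trans ≤-refl (proj₁ pe)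
            lt′ : length S < length (upTo width)
            lt′ = ≤-trans lt (≤-reflexive (sym (Listₚ.length-upTo width)))
            free-src : ∃[ t ] (t ∈ upTo width × (∀ {v} → v ∈ vts (srcSeg e t) → v ∉ S))
            free-src = misses-one (vts ∘ srcSeg e) S (upTo width)
              (AllPairs-map∈ (λ t∈ t′∈ t≢ v v∈ v∈′ → t≢ (+-cancelˡ-≡ width _ _ (+-cancelˡ-≡ (z * (width + width)) _ _
                (proj₂ (R-disjoint s< s< (src< pe (∈-upTo⁻ t∈)) (src< pe (∈-upTo⁻ t′∈)) v∈ v∈′))))) (Uniqueₚ.upTo⁺ width)) lt′
            free-snk : ∃[ t ] (t ∈ upTo width × (∀ {v} → v ∈ vts (snkSeg e t) → v ∉ S))
            free-snk = misses-one (vts ∘ snkSeg e) S (upTo width)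
              (AllPairs-map∈ (λ t∈ t′∈ t≢ v v∈ v∈′ → t≢ (+-cancelˡ-≡ (z * (width + width)) _ _
                (proj₂ (R-disjoint (proj₁ pe) (proj₁ pe) (snk< pe (∈-upTo⁻ t∈)) (snk< pe (∈-upTo⁻ t′∈)) v∈ v∈′)))) (Uniqueₚ.upTo⁺ width)) lt′
            the-wire : ∀ {t t′} → t < width → t′ < width → Wire 0 node (s , outR z t) (suc s , inR z t′)
            the-wire t< t′< = wire (s< , inj₂ (z≤n , src< pe t<)) (proj₁ pe , inj₂ (z≤n , snk< pe t′<)) (λ eq → 1+n≢n (sym eq))
            free-path : ∀ {t t′} (t< : t < width) (t′< : t′ < width) →
              ∃[ X ] (X ∈ Wire.paths (the-wire t< t′<) × (∀ {v} → v ∈ vts X → v ∉ S))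
            free-path t< t′< = misses-one vts S (Wire.paths W) (Linkage.disj (Wire.linkage W))
              (≤-trans lt (≤-trans width≤m₀ (≤-reflexive (sym (Wire.size W)))))
              where W = the-wire t< t′<

          bundle : ∀ {e} → Proper e → Bundle e width
          bundle {e} pe with menger (commodityEdges e) (proj₁ ∘ ∈-commodityEdges⁻ {e}) (map (srcFirst e) (upTo width)) (map (snkLast e) (upTo width)) width
          ... | inj₂ (S , lt , sep) = let t , t′ , t< , t′< , w = no-separator pe S lt in
                ⊥-elim (sep (∈-map⁺ (srcFirst e) (∈-upTo⁺ t<)) (∈-map⁺ (snkLast e) (∈-upTo⁺ t′<)) w)
          ... | inj₁ ℓ = record
            { paths = Link.paths ℓ ; linkage = record { disj = Link.disj ℓ ; nontriv = λ P∈ → Typed-nontrivial pe (typed P∈) }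
            ; size = ≤-reflexive (sym (Link.size ℓ)) ; typed = typed }
            where
            typed : ∀ {P} → P ∈ Link.paths ℓ → Typed e P
            typed {P} P∈ = record
              { starts = case ∈-map⁻ (srcFirst e) (Link.starts ℓ P∈) of λ (t , t∈ , eq) → t , ∈-upTo⁻ t∈ , eq
              ; ends = case ∈-map⁻ (snkLast e) (Link.ends ℓ P∈) of λ (t , t∈ , eq) → t , ∈-upTo⁻ t∈ , eq
              ; uses = ⊢-map {P = P} (proj₂ ∘ ∈-commodityEdges⁻ {e}) (Link.uses ℓ P∈) }

          record Routes (es : List Commodity) (V₀ : Pr) : Set where
            field
              path   : ∀ {e} → e ∈ es → Pth
              typed  : ∀ {e} (e∈ : e ∈ es) → Typed e (path e∈)
              disj   : ∀ {e f} (e∈ : e ∈ es) (f∈ : f ∈ es) → e ≢ f → Disj (path e∈) (path f∈)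
              inside : ∀ {e} (e∈ : e ∈ es) {v} → v ∈ vts (path e∈) → V₀ v

          p≤routeOrder : ∀ J → p ≤ routeOrder p J
          p≤routeOrder zero    = ≤-refl
          p≤routeOrder (suc J) = ≤-trans (p≤routeOrder J) (≤-trans (m≤cm (routeOrder p J)) (≤-trans (m≤n+m _ _) (n≤1+n _)))

          -- The first bundle has two roles: its paths are the `𝒬` along which the other bundles are
          -- rerouted, and the path `Q` that they all avoid becomes the route of `e`. By `purify` a
          -- rerouted path still belongs to its own commodity. Later routes stay within the reduced
          -- bundles, as `inside` records, and therefore off `Q`.
          route : ∀ es → Unique es → (∀ {e} → e ∈ es → Proper e) → (B : ∀ {e} → e ∈ es → Bundle e (routeOrder p (length es))) →
            AnchoredWeb ⊎ Routes es (λ v → ∃[ e ] Σ (e ∈ es) λ e∈ → v ∈ᵥ Bundle.paths (B e∈))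
          route [] _ _ _ = inj₂ record { path = λ () ; typed = λ () ; disj = λ () ; inside = λ () }
          route (e ∷ es) (e∉ ∷ u) proper B
            with Avoid.avoid-one {Y = Σ Commodity (_∈ es)} id r (≤-trans (p≤routeOrder (length es)) (m≤cm r)) 𝓛
                   (subst Linkage (sym (Listₚ.map-id 𝓛)) (Bundle.linkage B₀))
                   (subst Anchored (sym (Listₚ.map-id 𝓛)) anchored)
                   (λ (_ , f∈) → Bundle.paths (B (there f∈))) (attach es)
                   (λ {(_ , f∈)} _ → Bundle.linkage (B (there f∈)) , ≤-trans (≤-trans (m≤n+m (c * r) _) (n≤1+n _)) (Bundle.size (B (there f∈))))
                   (≤-trans (s≤s (≤-trans (≤-reflexive (cong (_* (l * (c * r))) (length-mapWith∈ es _))) (m≤m+n _ (c * r)))) (Bundle.size B₀))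
            where
            r = routeOrder p (length es)
            B₀ = B (here refl)
            𝓛 = Bundle.paths B₀
            anchored : Anchored 𝓛
            anchored Q∈ with Typed.starts (Bundle.typed B₀ Q∈) | Typed.ends (Bundle.typed B₀ Q∈)
            ... | t , t< , eq | t′ , t′< , eq′ = subst (_∈ₛ A) (sym eq) (srcFirst∈A (proper (here refl)) t<) ,
                                                 subst (_∈ₛ A) (sym eq′) (snkLast∈A (proper (here refl)) t′<)
          ... | inj₁ w = inj₁ w
          ... | inj₂ (Q , Q∈ , red) = extend (route es u (proper ∘ there) B′)
            where
            r = routeOrder p (length es)
            B₀ = B (here refl)
            𝓛 = Bundle.paths B₀
            module Red {f} (f∈ : f ∈ es) = Reduct (red (mapWith∈⁺ _ f∈))
            viaB₀ : ∀ {d} → d ∈ₑ map id 𝓛 → d ∈ₑ 𝓛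
            viaB₀ {d} = subst (d ∈ₑ_) (Listₚ.map-id 𝓛)
            B′ : ∀ {f} → f ∈ es → Bundle f r
            B′ {f} f∈ = record
              { paths = Red.paths f∈ ; linkage = Red.linkage f∈ ; size = ≤-reflexive (sym (Red.size f∈)) ; typed = typed }
              where
              old = B (there f∈)
              typed : ∀ {P} → P ∈ Red.paths f∈ → Typed f P
              typed {P} P∈ = record { starts = starts ; ends = ends
                ; uses = purify {e} {f} {P} (proper (here refl)) (proper (there f∈)) (All.lookup e∉ f∈) starts ends (⇒linked uses) }
                where
                starts : ∃[ t ] (t < width × st P ≡ srcFirst f t)
                starts = case ∈-map⁻ st (Ref.starts (Red.ref f∈) P∈) of λ (P₀ , P₀∈ , eq) →
                  let t , t< , eq′ = Typed.starts (Bundle.typed old P₀∈) in t , t< , trans eq eq′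
                ends : ∃[ t ] (t < width × en P ≡ snkLast f t)
                ends = case ∈-map⁻ en (Ref.ends (Red.ref f∈) P∈) of λ (P₀ , P₀∈ , eq) →
                  let t , t< , eq′ = Typed.ends (Bundle.typed old P₀∈) in t , t< , trans eq eq′
                uses : ∀ {u v} → (u , v) ∈ eds P → Ed f u v ⊎ Ed e u v
                uses uv∈ with Ref.edge (Red.ref f∈) (P , P∈ , uv∈)
                ... | inj₁ (P₀ , P₀∈ , q) = inj₁ (linked⇒ (Typed.uses (Bundle.typed old P₀∈)) q)
                ... | inj₂ q = let (P₀ , P₀∈ , q′) = viaB₀ q in inj₂ (linked⇒ (Typed.uses (Bundle.typed B₀ P₀∈)) q′)
            extend : AnchoredWeb ⊎ Routes es (λ v → ∃[ f ] Σ (f ∈ es) λ f∈ → v ∈ᵥ Bundle.paths (B′ f∈)) →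
              AnchoredWeb ⊎ Routes (e ∷ es) (λ v → ∃[ f ] Σ (f ∈ e ∷ es) λ f∈ → v ∈ᵥ Bundle.paths (B f∈))
            extend (inj₁ w) = inj₁ w
            extend (inj₂ rt) = inj₂ record { path = path′ ; typed = typed′ ; disj = disj′ ; inside = inside′ }
              where
              open Routes rt
              path′ : ∀ {f} → f ∈ e ∷ es → Pth
              path′ (here _)   = Q
              path′ (there f∈) = path f∈
              typed′ : ∀ {f} (f∈ : f ∈ e ∷ es) → Typed f (path′ f∈)
              typed′ (here refl) = Bundle.typed B₀ Q∈
              typed′ (there f∈)  = typed f∈
              off-Q : ∀ {f} (f∈ : f ∈ es) → Disj (path f∈) Q
              off-Q f∈ v v∈ v∈Q with inside f∈ v∈
              ... | g , g∈ , P , P∈ , v∈P = Red.avoids g∈ (here refl) P∈ v v∈P v∈Q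
              disj′ : ∀ {f g} (f∈ : f ∈ e ∷ es) (g∈ : g ∈ e ∷ es) → f ≢ g → Disj (path′ f∈) (path′ g∈)
              disj′ (here refl) (here refl) ne = ⊥-elim (ne refl)
              disj′ (here refl) (there g∈)  ne = Disj-sym {path g∈} {Q} (off-Q g∈)
              disj′ (there f∈)  (here refl) ne = off-Q f∈
              disj′ (there f∈)  (there g∈)  ne = disj f∈ g∈ ne
              inside′ : ∀ {f} (f∈ : f ∈ e ∷ es) {v} → v ∈ vts (path′ f∈) → ∃[ g ] Σ (g ∈ e ∷ es) λ g∈ → v ∈ᵥ Bundle.paths (B g∈)
              inside′ (here refl) v∈ = e , here refl , Q , Q∈ , v∈
              inside′ (there f∈)  v∈ with inside f∈ v∈
              ... | g , g∈ , v∈′ with Ref.vert (Red.ref g∈) v∈′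
              ... | inj₁ v∈″ = g , there g∈ , v∈″
              ... | inj₂ (P , P∈ , v∈P) = e , here refl , P , subst (P ∈_) (Listₚ.map-id 𝓛) P∈ , v∈P

      open Commodities public

      -- Tracks across the `D s` and the resulting web

      module Grid where

        commodities : List (ℕ × ℕ)
        commodities = cartesianProduct (upTo (q ∸ 1)) (upTo zones)

        module Assembly (fits : off q < K) (conf : Conf 0) where

          open Conf conf
          open Routing fits conf

          before-last : ∀ {s} → s < q ∸ 1 → suc s < q
          before-last h = ≤-trans (s≤s h) (≤-reflexive (m+[n∸m]≡n (<⇒≤ 2≤q)))

          before-last⁻ : ∀ {s} → suc s < q → s < q ∸ 1
          before-last⁻ h = +-cancelˡ-≤ 1 _ _ (≤-trans h (≤-reflexive (sym (m+[n∸m]≡n (<⇒≤ 2≤q)))))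

          ∈⇒proper : ∀ {e} → e ∈ commodities → Proper e
          ∈⇒proper e∈ = let a , b = ∈-cartesianProduct⁻ (upTo (q ∸ 1)) (upTo zones) e∈ in before-last (∈-upTo⁻ a) , ∈-upTo⁻ b

          proper⇒∈ : ∀ {e} → Proper e → e ∈ commodities
          proper⇒∈ (a , b) = ∈-cartesianProduct⁺ (∈-upTo⁺ (before-last⁻ a)) (∈-upTo⁺ b)

          module WithTracks (E : Commodity → Pth) (E-typed : ∀ {e} → Proper e → Typed e (E e))
                            (E-disjoint : ∀ {e f v} → Proper e → Proper f → v ∈ vts (E e) → v ∈ vts (E f) → e ≡ f) where

            E-class : ∀ {e v} → Proper e → v ∈ vts (E e) → Src e v ⊎ Free v ⊎ Snk e v
            E-class {e} pe v∈ = [ (λ (_ , vw∈) → left (linked⇒ (Typed.uses (E-typed pe)) vw∈)) ,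
                                  (λ (_ , wv∈) → right (linked⇒ (Typed.uses (E-typed pe)) wv∈)) ]′
                                (on-edge {E e} (Typed-nontrivial pe (E-typed pe)) v∈)
              where
              left : ∀ {u v} → Ed e u v → Src e u ⊎ Free u ⊎ Snk e u
              left (leaving (t , t< , uv∈))  = inj₁ (t , t< , pair-left∈ uv∈)
              left (between (inj₁ a) _)      = inj₁ a
              left (between (inj₂ a) _)      = inj₂ (inj₁ (λ {s} → a {s}))
              left (arriving (t , t< , uv∈)) = inj₂ (inj₂ (t , t< , pair-left∈ uv∈))
              right : ∀ {u v} → Ed e u v → Src e v ⊎ Free v ⊎ Snk e v
              right (leaving (t , t< , uv∈))  = inj₁ (t , t< , there (pair-right∈ uv∈))
              right (between _ (inj₁ a))      = inj₂ (inj₁ (λ {s} → a {s}))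
              right (between _ (inj₂ a))      = inj₂ (inj₂ a)
              right (arriving (t , t< , uv∈)) = inj₂ (inj₂ (t , t< , there (pair-right∈ uv∈)))

            E-on-D : ∀ {s z s′ v} → Proper (s , z) → s′ < q → v ∈ vts (E (s , z)) → v ∈ vts (D s′) →
              (s′ ≡ s × Src (s , z) v) ⊎ (s′ ≡ suc s × Snk (s , z) v)
            E-on-D pe s′< v∈ v∈D = case E-class pe v∈ of λ
              { (inj₁ a)        → inj₁ (D-disjoint s′< (<-trans ≤-refl (proj₁ pe)) v∈D (Src⊆D pe a) , a)
              ; (inj₂ (inj₁ a)) → ⊥-elim (a s′< v∈D)
              ; (inj₂ (inj₂ a)) → inj₂ (D-disjoint s′< (proj₁ pe) v∈D (Snk⊆D pe a) , a) }

            -- A zone includes the stretches of `D s` between its regions, since the tracks are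
            -- joined along these.
            InZone : ℕ → ℕ → Pr
            InZone s z v = ∃[ x ] ∃[ y ] (x < width + width × y < width + width ×
              InRange (Node.left (node s) (z * (width + width) + x)) (Node.right (node s) (z * (width + width) + y)) v)

            zone⊆D : ∀ {s z v} → s < q → z < zones → InZone s z v → v ∈ vts (D s)
            zone⊆D {s} {z} s< z< (x , y , x< , y< , r) = range-segOf fits (node-valid s<)
              (range-widen (<⇒≤ (a<left (region<k {z} z< x<))) (<⇒≤ (right<b (region<k {z} z< y<))) r)
              where open ValidNode (valid z≤n s<)

            zone-disjoint : ∀ {s z z′ v} → s < q → z < zones → z′ < zones → z ≢ z′ → InZone s z v → InZone s z′ v → ⊥
            zone-disjoint {s} s< z< z′< ne i i′ = case <-cmp _ _ of λ
              { (tri< lt _ _) → ordered z′< lt i i′ ; (tri≈ _ eq _) → ne eq ; (tri> _ _ gt) → ordered z< gt i′ i }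
              where
              ordered : ∀ {z z′ v} → z′ < zones → z < z′ → InZone s z v → InZone s z′ v → ⊥
              ordered {z} {z′} z′< lt (x , y , x< , y< , (κ , _ , ≤r , q₁)) (x′ , y′ , x′< , y′< , (κ′ , l≤ , ≤r′ , q₂)) =
                <⇒≱ (sdbl-mono-< below) (≤-trans l≤ (subst (_≤ _) same ≤r))
                where
                z*< = region<k {z′} z′< x′<
                below : Node.right (node s) (z * (width + width) + y) < Node.left (node s) (z′ * (width + width) + x′)
                below = right<left s< (zone-below lt y<) z*<
                bound : ∀ {z y} → z < zones → y < width + width → sdbl (Node.right (node s) (z * (width + width) + y)) ≤ dbl K
                bound {z} z< y< = sdbl≤dblK (≤-<-trans (proj₂ (proj₂ (region-valid s< (region<k {z} z< y<)))) fits)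
                same : κ ≡ κ′
                same = Co-unique (≤-trans ≤r (bound (<-trans lt z′<) y<)) (≤-trans ≤r′ (bound z′< y′<)) q₁ q₂

            region-in-zone : ∀ {s z x v} → s < q → z < zones → x < width + width → v ∈ vts (R s (z * (width + width) + x)) → InZone s z v
            region-in-zone {s} {z} {x} s< z< x< v∈ = x , x , x< , x< , segOf-range fits (region-valid s< (region<k {z} z< x<)) v∈

            -- All that the crossing argument requires of an edge. It holds for the edges of the
            -- tracks and of the `D s`, hence for any linkage rerouted among them.
            data Adjacent (u v : Vertex) : Set where
              within : ∀ {s} → s < q → u ∈ vts (D s) → v ∈ vts (D s) → Adjacent u v
              along  : ∀ {e} → Proper e → u ∈ vts (E e) → v ∈ vts (E e) → Adjacent u v

            H : Rel
            H u v = Edge G u v × Adjacent u v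

            OnTrack : ℕ → Pr
            OnTrack z v = (∃[ s ] (suc s < q × v ∈ vts (E (s , z)))) ⊎ (∃[ s ] (s < q × InZone s z v))

            E-zone-disjoint : ∀ {z z′ s s′ v} → z < zones → z′ < zones → z ≢ z′ → suc s < q → v ∈ vts (E (s , z)) →
              s′ < q → InZone s′ z′ v → ⊥
            E-zone-disjoint {z} z< z′< ne s< v∈ s′< i = case E-on-D (s< , z<) s′< v∈ (zone⊆D s′< z′< i) of λ
              { (inj₁ (refl , t , t< , v∈R)) → zone-disjoint s′< z< z′< ne (region-in-zone {z = z} s′< z< (outR-small t<) v∈R) i
              ; (inj₂ (refl , t , t< , v∈R)) → zone-disjoint s′< z< z′< ne (region-in-zone {z = z} s′< z< (inR-small t<) v∈R) i }

            track-disjoint : ∀ {z z′ v} → z < zones → z′ < zones → z ≢ z′ → OnTrack z v → OnTrack z′ v → ⊥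
            track-disjoint z< z′< ne (inj₁ (s , s< , v∈)) (inj₁ (s′ , s′< , v∈′)) =
              ne (cong proj₂ (E-disjoint (s< , z<) (s′< , z′<) v∈ v∈′))
            track-disjoint z< z′< ne (inj₁ (s , s< , v∈)) (inj₂ (s′ , s′< , i)) = E-zone-disjoint z< z′< ne s< v∈ s′< i
            track-disjoint z< z′< ne (inj₂ (s , s< , i)) (inj₁ (s′ , s′< , v∈)) = E-zone-disjoint z′< z< (ne ∘ sym) s′< v∈ s< i
            track-disjoint z< z′< ne (inj₂ (s , s< , i)) (inj₂ (s′ , s′< , i′)) =
              case D-disjoint s< s′< (zone⊆D s< z< i) (zone⊆D s′< z′< i′) of λ { refl → zone-disjoint s< z< z′< ne i i′ }

            E-walk : ∀ {s z} → Proper (s , z) → Walk H (OnTrack z) (st (E (s , z))) (en (E (s , z)))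
            E-walk {s} {z} pe = walk-map (λ {u} {v} _ _ uv∈ → linked⇒ (Path.linked (E (s , z))) uv∈ , along pe (pair-left∈ uv∈) (there (pair-right∈ uv∈)))
              (λ v∈ → inj₁ (s , proj₁ pe , v∈)) (pathWalk {E = λ u v → (u , v) ∈ eds (E (s , z))} {P = E (s , z)} (⇒linked id))

            -- The in-regions of a zone precede its out-regions, so the backbone leads forward from
            -- where one route arrives to where the next one leaves.
            joint-walk : ∀ {s z} → suc (suc s) < q → z < zones → Walk H (OnTrack z) (en (E (s , z))) (st (E (suc s , z)))
            joint-walk {s} {z} s< z< with Typed.ends (E-typed {s , z} (<-trans ≤-refl s< , z<)) | Typed.starts (E-typed {suc s , z} (s< , z<))
            ... | t , t< , en≡ | t′ , t′< , st≡ = subst₂ (Walk H (OnTrack z)) (trans (seg-st (<⇒≤ i<j) j<K) (sym en≡)) (trans (seg-en (<⇒≤ i<j) j<K) (sym st≡))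
              (walk-map (λ {u} {v} _ _ uv∈ → linked⇒ (Path.linked (seg i j)) uv∈ , within s′< (zone⊆D s′< z< (zoned (pair-left∈ uv∈))) (zone⊆D s′< z< (zoned (there (pair-right∈ uv∈)))))
                (λ v∈ → inj₂ (suc s , s′< , zoned v∈))
                (pathWalk {E = λ u v → (u , v) ∈ eds (seg i j)} {P = seg i j} (⇒linked id)))
              where
              s′< : suc s < q
              s′< = <-trans ≤-refl s<
              i = Node.right (node (suc s)) (inR z t)
              j = Node.left (node (suc s)) (outR z t′)
              out<k = region<k {z} z< (outR-small t′<)
              in<k = region<k {z} z< (inR-small t<)
              i<j : i < j
              i<j = right<left s′< (+-monoʳ-< (z * (width + width)) (<-≤-trans t< (m≤m+n width t′))) out<k
              outer = region-valid s′< out<k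
              j<K : j < K
              j<K = ≤-<-trans (<⇒≤ (proj₁ (proj₂ outer))) (≤-<-trans (proj₂ (proj₂ outer)) fits)
              zoned : ∀ {v} → v ∈ vts (seg i j) → InZone (suc s) z v
              zoned v∈ = t , width + t′ , inR-small t< , outR-small t′< ,
                range-widen (<⇒≤ (ValidNode.left<right (valid z≤n s′<) in<k)) (<⇒≤ (ValidNode.left<right (valid z≤n s′<) out<k))
                  (seg-∈⁻ (<⇒≤ i<j) j<K v∈)

            track-walk : ∀ s {z} → suc s < q → z < zones → Walk H (OnTrack z) (st (E (0 , z))) (en (E (s , z)))
            track-walk zero    s< z< = E-walk (s< , z<)
            track-walk (suc s) s< z< = track-walk s (<-trans ≤-refl s<) z< ⧺ (joint-walk s< z< ⧺ E-walk (s< , z<))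

            -- Index of the last layer of commodities; they arrive at `D (suc final)`, the last of
            -- the `D s`.
            final : ℕ
            final = q ∸ 2

            final< : suc final < q
            final< = ≤-reflexive (m+[n∸m]≡n 2≤q)

            Track : ℕ → Set
            Track z = InPath H (OnTrack z) (st (E (0 , z))) (en (E (final , z)))

            track : ∀ {z} → z < zones → Track z
            track z< = toPath proj₁ (track-walk final final< z<)

            tracks : List (Σ ℕ (_∈ upTo zones))
            tracks = attach (upTo zones)

            P : Σ ℕ (_∈ upTo zones) → Pth
            P (_ , z∈) = InPath.path (track (∈-upTo⁻ z∈))

            𝒫 : List Pth
            𝒫 = map P tracks

            D₀ : ∀ {Q} → Q ∈ 𝒫 → st Q ∈ vts (D 0)
            D₀ Q∈ with ∈-map⁻ P Q∈
            ... | (z , z∈) , _ , refl with Typed.starts (E-typed {0 , z} (2≤q , ∈-upTo⁻ z∈))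
            ... | t , t< , st≡ = subst (_∈ vts (D 0)) (trans (sym st≡) (sym (InPath.starts (track (∈-upTo⁻ z∈)))))
                  (Src⊆D (2≤q , ∈-upTo⁻ z∈) (srcFirst-Src (2≤q , ∈-upTo⁻ z∈) t<))

            D₁ : ∀ {Q} → Q ∈ 𝒫 → en Q ∈ vts (D (suc final))
            D₁ Q∈ with ∈-map⁻ P Q∈
            ... | (z , z∈) , _ , refl with Typed.ends (E-typed {final , z} (final< , ∈-upTo⁻ z∈))
            ... | t , t< , en≡ = subst (_∈ vts (D (suc final))) (trans (sym en≡) (sym (InPath.ends (track (∈-upTo⁻ z∈)))))
                  (Snk⊆D (final< , ∈-upTo⁻ z∈) (snkLast-Snk (final< , ∈-upTo⁻ z∈) t<))

            𝒫-H : ∀ {u v} → (u , v) ∈ₑ 𝒫 → Adjacent u v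
            𝒫-H (Q , Q∈ , uv∈) with ∈-map⁻ P Q∈
            ... | (z , z∈) , _ , refl = proj₂ (linked⇒ (InPath.uses (track (∈-upTo⁻ z∈))) uv∈)

            𝒫-linkage : Linkage 𝒫
            𝒫-linkage = record
              { disj = AllPairsₚ.map⁺ (AllPairs.map (λ { {z , z∈} {z′ , z′∈} ne v v∈ v∈′ →
                  track-disjoint (∈-upTo⁻ z∈) (∈-upTo⁻ z′∈) ne (InPath.inside (track (∈-upTo⁻ z∈)) v∈) (InPath.inside (track (∈-upTo⁻ z′∈)) v∈′) })
                  (AllPairsₚ.map⁻ (subst Unique (sym (trans (map-mapWith∈ (upTo zones) _ proj₁) (mapWith∈-id (upTo zones)))) (Uniqueₚ.upTo⁺ zones))))
              ; nontriv = λ {Q} Q∈ eq → 1+n≢0 (D-disjoint final< (<⇒≤ 2≤q) (D₁ Q∈) (subst (_∈ vts (D 0)) eq (D₀ Q∈))) }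

            𝒬 : List Pth
            𝒬 = map (segOf ∘ nodeI) (upTo q)

            𝒬-linkage : Linkage 𝒬
            𝒬-linkage = record
              { disj = AllPairsₚ.map⁺ (AllPairs-map∈ (λ s∈ s′∈ ne v v∈ v∈′ → ne (D-disjoint (∈-upTo⁻ s∈) (∈-upTo⁻ s′∈) v∈ v∈′)) (Uniqueₚ.upTo⁺ q))
              ; nontriv = λ Q∈ → case ∈-map⁻ (segOf ∘ nodeI) Q∈ of λ { (s , s∈ , refl) → segOf-nontrivial fits (node-valid (∈-upTo⁻ s∈)) } }

            -- The vertices of the tracks and of the D s′ that precede D s.
            Below : ℕ → Pr
            Below s v = (∃[ s′ ] (s′ < s × s′ < q × v ∈ vts (D s′))) ⊎ (∃[ e ] (proj₁ e < s × Proper e × v ∈ vts (E e)))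

            -- A route `E (s′ , z)` meets the `D`'s only in `D s′` and `D (suc s′)`. A step leading
            -- from below level `s` to a vertex not below it must therefore start on `D s`.
            below-step : ∀ {s u v} → s < q → u ∉ vts (D s) → Below s u → Adjacent u v → Below s v
            below-step s< u∉ (inj₁ (s′ , s′<s , s′< , u∈)) (within s″< u∈″ v∈) =
              case D-disjoint s′< s″< u∈ u∈″ of λ { refl → inj₁ (s′ , s′<s , s′< , v∈) }
            below-step s< u∉ (inj₁ (s′ , s′<s , s′< , u∈)) (along {e} pe u∈E v∈) = case E-on-D pe s′< u∈E u∈ of λ
              { (inj₁ (refl , _)) → inj₂ (e , s′<s , pe , v∈)
              ; (inj₂ (refl , _)) → inj₂ (e , <-trans ≤-refl s′<s , pe , v∈) }
            below-step s< u∉ (inj₂ (e , e<s , pe , u∈)) (within s″< u∈″ v∈) = case E-on-D pe s″< u∈ u∈″ of λ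
              { (inj₁ (refl , _)) → inj₁ (_ , e<s , s″< , v∈)
              ; (inj₂ (refl , _)) → case m≤n⇒m<n∨m≡n e<s of λ
                { (inj₁ lt)   → inj₁ (_ , lt , s″< , v∈)
                ; (inj₂ refl) → ⊥-elim (u∉ u∈″) } }
            below-step s< u∉ (inj₂ (e , e<s , pe , u∈)) (along pf u∈′ v∈) =
              case E-disjoint pe pf u∈ u∈′ of λ { refl → inj₂ (e , e<s , pe , v∈) }

            below-end : ∀ {s v} → s < q → v ∉ vts (D s) → Below s v → v ∉ vts (D (suc final))
            below-end {s} s< v∉ (inj₁ (s′ , s′<s , s′< , v∈)) v∈D = case D-disjoint s′< final< v∈ v∈D of λ
              { refl → <⇒≱ s< (≤-trans (≤-reflexive (sym (m+[n∸m]≡n 2≤q))) s′<s) }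
            below-end {s} s< v∉ (inj₂ (e , e<s , pe , v∈)) v∈D = case E-on-D pe final< v∈ v∈D of λ
              { (inj₁ (refl , _)) → <-irrefl refl (<-≤-trans (proj₁ pe) (≤-reflexive (sym (m+[n∸m]≡n 2≤q))))
              ; (inj₂ (eq , _)) → v∉ (subst (λ z → _ ∈ vts (D z)) (≤-antisym (≤-trans (≤-reflexive eq) e<s)
                  (s≤s⁻¹ (≤-trans s< (≤-reflexive (sym (m+[n∸m]≡n 2≤q)))))) v∈D) }

            crosses : ∀ {s} → s < q → ∀ x xs → Linked Adjacent (x ∷ xs) → x ∈ vts (D 0) → lastOf G x xs ∈ vts (D (suc final)) →
              Any (_∈ vts (D s)) (x ∷ xs)
            crosses {s} s< x xs l x∈ last∈D with x ∈? vts (D s)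
            ... | yes x∈s = here x∈s
            ... | no x∉ = go x xs l x∉ (inj₁ (0 , ≤∧≢⇒< z≤n (λ { refl → x∉ x∈ }) , <⇒≤ 2≤q , x∈)) last∈D
              where
              go : ∀ x xs → Linked Adjacent (x ∷ xs) → x ∉ vts (D s) → Below s x → lastOf G x xs ∈ vts (D (suc final)) → Any (_∈ vts (D s)) (x ∷ xs)
              go x []       _       x∉ b last∈D = ⊥-elim (below-end s< x∉ b last∈D)
              go x (y ∷ ys) (e ∷ l) x∉ b last∈D with y ∈? vts (D s)
              ... | yes y∈ = there (here y∈)
              ... | no y∉  = there (go y ys l y∉ (below-step s< x∉ b e) last∈D)

            -- Minimisation may dissolve the tracks, but every path of `L` still starts on `D 0`,
            -- ends on `D (suc final)` and has adjacent consecutive vertices. By `crosses` it meets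
            -- every `D s`, so no path is missed at all.
            grid-web : AnchoredWeb
            grid-web with minimise 𝒫-linkage 𝒬
            ... | L , lk , ref , size , min = web lk 𝒬-linkage (segs-anchored fits nodeI (upTo q) (λ s∈ → node-valid (∈-upTo⁻ s∈)))
              (≤-trans p≤zones (≤-reflexive (sym size′)))
              (trans (length-map _ (upTo q)) (trans (Listₚ.length-upTo q) (trans q≡ (cong (l *_) (sym size′)))))
              min λ Q∈ → case ∈-map⁻ (segOf ∘ nodeI) Q∈ of λ { (s , s∈ , refl) →
                ≤-trans (≤-reflexive (trans (cong (c *_) (none (∈-upTo⁻ s∈))) (*-zeroʳ c))) z≤n }
              where
              size′ : length L ≡ zones
              size′ = trans size (trans (length-map P tracks) (trans (length-mapWith∈ (upTo zones) _) (Listₚ.length-upTo zones)))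
              adjacent : ∀ {u v} → (u , v) ∈ₑ L → Adjacent u v
              adjacent e∈ with Ref.edge ref e∈
              ... | inj₁ q₁ = 𝒫-H q₁
              ... | inj₂ (Q , Q∈ , uv∈) with ∈-map⁻ (segOf ∘ nodeI) Q∈
              ... | s , s∈ , refl = within (∈-upTo⁻ s∈) (pair-left∈ uv∈) (there (pair-right∈ uv∈))
              meets : ∀ {s Q} → s < q → Q ∈ L → Meets G Q (D s)
              meets {s} {Q} s< Q∈ = crosses s< _ _ (⇒linked (λ e∈ → adjacent (Q , Q∈ , e∈)))
                (case ∈-map⁻ st (Ref.starts ref Q∈) of λ (Q₀ , Q₀∈ , eq) → subst (_∈ vts (D 0)) (sym eq) (D₀ Q₀∈))
                (case ∈-map⁻ en (Ref.ends ref Q∈) of λ (Q₀ , Q₀∈ , eq) → subst (_∈ vts (D (suc final))) (sym eq) (D₁ Q₀∈))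
              none : ∀ {s} → s < q → missed G L (D s) ≡ 0
              none {s} s< = cong length (Listₚ.filter-none (λ Q → ¬? (meets? G Q (D s))) (All.tabulate (λ Q∈ ¬m → ¬m (meets s< Q∈))))

          module WithRoutes {V₀ : Pr} (routes : Routes commodities V₀) where

            open Routes routes

            proper? : ∀ e → Dec (Proper e)
            proper? (s , z) = (suc s <? q) ×-dec (z <? zones)

            E : Commodity → Pth
            E e with proper? e
            ... | yes pe = path (proper⇒∈ pe)
            -- Default value for pairs that are not commodities.
            ... | no _   = D 0

            E-typed : ∀ {e} → Proper e → Typed e (E e)
            E-typed {e} pe with proper? e
            ... | yes pe′ = typed (proper⇒∈ pe′)
            ... | no ¬p = ⊥-elim (¬p pe)

            E-disjoint : ∀ {e f v} → Proper e → Proper f → v ∈ vts (E e) → v ∈ vts (E f) → e ≡ f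
            E-disjoint {e} {f} {v} pe pf v∈ v∈′ with ≡-dec _≟_ _≟_ e f
            ... | yes eq = eq
            ... | no ne with proper? e | proper? f
            ... | yes pe′ | yes pf′ = ⊥-elim (disj (proper⇒∈ pe′) (proper⇒∈ pf′) ne v v∈ v∈′)
            ... | no ¬p | _ = ⊥-elim (¬p pe)
            ... | yes _ | no ¬p = ⊥-elim (¬p pf)

          result : routeOrder p (length commodities) ≤ width → AnchoredWeb
          result enough with route commodities (Uniqueₚ.cartesianProduct⁺ (Uniqueₚ.upTo⁺ (q ∸ 1)) (Uniqueₚ.upTo⁺ zones)) ∈⇒proper
            (λ e∈ → let b = bundle (∈⇒proper e∈) in record { Bundle b ; size = ≤-trans enough (Bundle.size b) })
          ... | inj₁ w = w
          ... | inj₂ routes = WithTracks.grid-web (WithRoutes.E routes) (WithRoutes.E-typed routes) (WithRoutes.E-disjoint routes)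

        web-from-backbone : off q < K → n₀ ≡ ord q → routeOrder p (length commodities) ≤ width → AnchoredWeb
        web-from-backbone fits n₀≡ enough = [ id , (λ conf → Assembly.result fits conf enough) ]′ (process fits q ≤-refl (initial fits n₀≡))

      open Grid public

-- Choice of the constants

theorem4p2 : ∀ (k p l c : ℕ) → 1 ≤ k → 1 ≤ p → 1 ≤ l → 1 ≤ c →
    ∃[ l' ] ∀ (G : Digraph) → BrambleNumberAtLeast G l' →
    ButterflyMinor (CylGrid k) (toM G)
    ⊎ (∃[ p' ] (p ≤ p' × ∃[ A ] (WellLinked G A ×
    Σ (Web G p' (l * p') c) (λ W →
    (∀ x → top G W x → x ∈ₛ A) × (∀ x → bottom G W x → x ∈ₛ A)))))
-- There are `suc K` cells, and each of them together with its station uses up `suc N` of the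
-- bramble order.
theorem4p2 k p l c 1≤k 1≤p 1≤l 1≤c = suc K * suc N , λ G (β , β-order) →
  let b = OfDigraph.backbone G β N K n₀ (s≤s z≤n) (m≤n⇒m≤1+n (m≤m+n K n₀)) (m≤n⇒m≤1+n (m≤n+m n₀ K)) β-order
      p′ , p≤p′ , W , tops , bottoms = OfDigraph.OnBackbone.OnGrid.web-from-backbone G p l c 1≤p 1≤l 1≤c b zones width q m₀
        (m≤n+m p width) (m≤m+n width p) (n≤1+n p) 2≤q refl ≤-refl refl (≤-reflexive (cong (routeOrder p) commodities-length))
  in inj₂ (p′ , p≤p′ , OfDigraph.Backbone.A b , OfDigraph.Backbone.wellLinked b , W , tops , bottoms)
  where
  open Sizes l c
  zones q width m₀ K n₀ N : ℕ
  -- `suc p` instead of `p` ensures `2 ≤ q` even for `l ≡ 1`, so that there is at least one layer of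
  -- commodities.
  zones = suc p
  q     = l * zones
  -- The number of commodities is `(q ∸ 1) * zones`; bundles of this order allow one path to be
  -- routed in each.
  width = routeOrder p ((q ∸ 1) * zones)
  -- Order of the wires left at the end: at least `width`, so that a separator smaller than `width`
  -- misses one of their paths, and at least `p` for the webs met on the way.
  m₀    = width + p
  K     = suc (Schedule.off (zones * (width + width)) q m₀ q)
  n₀    = Schedule.ord (zones * (width + width)) q m₀ q
  -- Positive, at least `K` so that the stations are well linked, and at least `n₀` so that the
  -- cells are joined by linkages of the initial order.
  N     = suc (K + n₀)
  2≤q : 2 ≤ q
  2≤q = *-mono-≤ 1≤l (s≤s 1≤p)
  commodities-length : length (cartesianProduct (upTo (q ∸ 1)) (upTo zones)) ≡ (q ∸ 1) * zones
  commodities-length = trans (Lists.length-cartesianProduct (upTo (q ∸ 1)) (upTo zones))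
    (cong₂ _*_ (Listₚ.length-upTo (q ∸ 1)) (Listₚ.length-upTo zones))
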